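{- (i) Let $n\ge0$ and $k$ be integers with $n\le k\le 3n$, and let $\eta=k-n$. If $\eta\le n$ then $$E_2(n,k)=\frac{(n+\eta)!}{\eta!\,(n-\eta)!\,2^\eta}\;{}_2F_1\!\left[-\tfrac{\eta}{2},-\tfrac{\eta}{2}+\tfrac12;\,n-\eta+1;\,\tfrac83\right].$$ If $\eta\ge n$ then $$E_2(n,k)=\frac{(\eta+n)!}{(2n-\eta)!\,(\eta-n)!\,2^n\,3^{\eta-n}}\;{}_2F_1\!\left[-n+\tfrac{\eta}{2},-n+\tfrac{\eta}{2}+\tfrac12;\,\eta-n+1;\,\tfrac83\right].$$ (ii) For all $n\ge0$, $$G_2(n)=\sum_{\eta=0}^{n-1}\frac{(n+\eta)!}{\eta!\,(n-\eta)!\,2^\eta}\,{}_2F_1\!\left[-\tfrac{\eta}{2},-\tfrac{\eta}{2}+\tfrac12;\,n-\eta+1;\,\tfrac83\right]+\sum_{\eta=n}^{2n}\frac{(n+\eta)!}{(2n-\eta)!\,(\eta-n)!\,2^n\,3^{\eta-n}}\,{}_2F_1\!\left[-n+\tfrac{\eta}{2},-n+\tfrac{\eta}{2}+\tfrac12;\,\eta-n+1;\,\tfrac83\right].$$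
   Context: $E_2(n,k)$ is the number of partitions of $\{1,\ldots,k\}$ into exactly $n$ nonempty blocks, each of size at most $3$. ${}_2F_1[a,b;c;z]=\sum_{j\ge0}\frac{(a)_j(b)_j}{(c)_j\,j!}z^j$ with $(a)_j=a(a+1)\cdots(a+j-1)$; in all instances above one numerator parameter is a nonpositive integer and $c$ is a positive integer, so the series is a finite sum. Gift exchange game with steal limit $\sigma\ge 0$ and $m\ge 1$ gifts: there are $m$ players and $m$ distinct wrapped gifts, initially all in a pool. The players are called one at a time in a fixed order. When a player is called, and also whenever a player's gift has just been stolen, that player (who currently holds no gift) makes a move: either take one of the gifts still in the pool (it is unwrapped and held by that player), or steal an unwrapped gift currently held by another player, provided this gift has so far been stolen fewer than $\sigma$ times in total; the player from whom it was stolen then immediately makes a move. The game ends as soon as the last gift in the pool is taken. A scenario is the complete sequence of moves. For $n\ge 0$, $G_2(n)$ is the number of scenarios of the game with steal limit $\sigma=2$ and $m=n+1$ gifts in which the gifts are taken from the pool in the order $1,2,\ldots,n+1$. -}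

module Defs where

open import Data.Bool using (Bool; true; false; _∧_; not; if_then_else_)
open import Data.Nat as ℕ using (ℕ; zero; suc; _+_; _*_; _∸_)
open import Data.Nat.Properties as ℕP using ()
open import Data.Fin as Fin using (Fin; toℕ)
open import Data.Fin.Properties as FinP using ()
open import Data.List as List using (List; []; _∷_; _++_; map; concatMap; length; filter; allFin; foldr; upTo)
open import Data.List.Properties as ListP using (≡-dec)
open import Data.Vec as Vec using (Vec; []; _∷_; lookup; _[_]≔_; replicate)
open import Data.Maybe using (Maybe; just; nothing)
open import Data.Integer as ℤ using (+_)
open import Data.Rational as ℚ using (ℚ; 0ℚ; 1ℚ; 1/_; ≢-nonZero)
open import Data.Rational.Properties as ℚP using ()
open import Relation.Nullary using (Dec; yes; no)
open import Relation.Nullary.Decidable using (⌊_⌋)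
open import Relation.Binary.PropositionalEquality using (_≡_)

Subset : ℕ → Set
Subset k = Vec Bool k

size : ∀ {k} → Subset k → ℕ
size []          = 0
size (true ∷ b)  = suc (size b)
size (false ∷ b) = size b

allSubsets : (k : ℕ) → List (Subset k)
allSubsets zero    = [] ∷ []
allSubsets (suc k) = map (true ∷_) (allSubsets k) ++ map (false ∷_) (allSubsets k)

-- All sub-lists of a list; for a duplicate-free list these are exactly
-- its subsets (each once).  Hence  sublists (allSubsets k)  lists every
-- set of subsets of Fin k exactly once.
sublists : ∀ {a} {A : Set a} → List A → List (List A)
sublists []       = [] ∷ []
sublists (x ∷ xs) = map (x ∷_) (sublists xs) ++ sublists xs

_==ℕ_ : ℕ → ℕ → Bool
m ==ℕ n = ⌊ m ℕ.≟ n ⌋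

_≤ℕ_ : ℕ → ℕ → Bool
m ≤ℕ n = ⌊ m ℕ.≤? n ⌋

allB : ∀ {a} {A : Set a} → (A → Bool) → List A → Bool
allB p = foldr (λ x r → p x ∧ r) true

countB : ∀ {a} {A : Set a} → (A → Bool) → List A → ℕ
countB p = foldr (λ x r → if p x then suc r else r) 0

isE₂Partition : (n k : ℕ) → List (Subset k) → Bool
isE₂Partition n k F =
  (length F ==ℕ n)
  ∧ allB (λ b → not (size b ==ℕ 0) ∧ (size b ≤ℕ 3)) F
  ∧ allB (λ i → countB (λ b → lookup b i) F ==ℕ 1) (allFin k)

E₂ : ℕ → ℕ → ℕ
E₂ n k = length (filter (λ F → isE₂Partition n k F ≡? true) (sublists (allSubsets k)))
  where
  _≡?_ : (x y : Bool) → Dec (x ≡ y)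
  _≡?_ = Data.Bool._≟_
    where import Data.Bool

-- The gift exchange game with steal limit σ and m gifts / m players.
-- Gifts are Fin m; players are numbered 0,1,…,m-1 and called in that
-- order.

data Move (m : ℕ) : Set where
  take  : Fin m → Move m
  steal : Fin m → Move m

record GameState (m : ℕ) : Set where
  field
    holder : Vec (Maybe ℕ) m  -- nothing = gift still wrapped in the pool
    steals : Vec ℕ m
    mover  : ℕ
    called : ℕ                -- number of players called so far
open GameState

initialState : (m : ℕ) → GameState m
initialState m = record
  { holder = replicate m nothing ; steals = replicate m 0 ; mover = 0 ; called = 1 }

inPool : ∀ {m} → GameState m → Fin m → Bool
inPool s g with lookup (holder s) g
... | nothing = true
... | just _  = false

poolEmpty : ∀ {m} → GameState m → Bool
poolEmpty {m} s = allB (λ g → not (inPool s g)) (allFin m)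

stealable : ∀ {m} → ℕ → GameState m → Fin m → Bool
stealable σ s g with lookup (holder s) g
... | nothing = false
... | just q  = not (q ==ℕ mover s) ∧ (suc (lookup (steals s) g) ≤ℕ σ)

legalMoves : ∀ {m} → ℕ → GameState m → List (Move m)
legalMoves {m} σ s =
  map take (List.filter (λ g → inPool s g ≟B true) (allFin m))
  ++ map steal (List.filter (λ g → stealable σ s g ≟B true) (allFin m))
  where
  import Data.Bool
  _≟B_ = Data.Bool._≟_

step : ∀ {m} → GameState m → Move m → GameState m
step s (take g) = record s
  { holder = holder s [ g ]≔ just (mover s)
  ; mover  = called s
  ; called = suc (called s) }
step s (steal g) with lookup (holder s) g
... | nothing = s
... | just q  = record s
  { holder = holder s [ g ]≔ just (mover s)
  ; steals = steals s [ g ]≔ suc (lookup (steals s) g)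
  ; mover  = q }

-- Every move either takes a gift
-- (≤ m times) or increases a steal counter (≤ σ·m times), so fuel
-- (σ+1)·m suffices to list all scenarios of the game.
scenariosFrom : ∀ {m} → ℕ → ℕ → GameState m → List (List (Move m))
scenariosFrom σ fuel s with poolEmpty s
... | true = [] ∷ []
scenariosFrom σ zero     s | false = []
scenariosFrom σ (suc f)  s | false =
  concatMap (λ mv → map (mv ∷_) (scenariosFrom σ f (step s mv))) (legalMoves σ s)

scenarios : (σ m : ℕ) → List (List (Move m))
scenarios σ m = scenariosFrom σ (suc σ * m) (initialState m)

takenGifts : ∀ {m} → List (Move m) → List (Fin m)
takenGifts []             = []
takenGifts (take g  ∷ ms) = g ∷ takenGifts ms
takenGifts (steal _ ∷ ms) = takenGifts ms

-- G₂(n): scenarios with σ = 2 and m = n+1 gifts in which the gifts are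
-- taken from the pool in the order 1,2,…,n+1 (here 0,1,…,n).
G₂ : ℕ → ℕ
G₂ n = length (filter (λ ms → ≡-dec FinP._≟_ (takenGifts ms) (allFin (suc n)))
                      (scenarios 2 (suc n)))

ℕ→ℚ : ℕ → ℚ
ℕ→ℚ k = (+ k) ℚ./ 1

-- total reciprocal (value 0 at 0); only applied to nonzero arguments below
inv₀ : ℚ → ℚ
inv₀ q with q ℚP.≟ 0ℚ
... | yes _   = 0ℚ
... | no q≢0  = 1/_ q {{≢-nonZero q≢0}}

-- a / b for naturals, as a rational (b ≠ 0 in all uses)
infixl 7 _/ℕ_
_/ℕ_ : ℕ → ℕ → ℚ
a /ℕ b = ℕ→ℚ a ℚ.* inv₀ (ℕ→ℚ b)

_^ℚ_ : ℚ → ℕ → ℚ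
q ^ℚ zero  = 1ℚ
q ^ℚ suc j = q ℚ.* (q ^ℚ j)

poch : ℚ → ℕ → ℚ
poch a zero    = 1ℚ
poch a (suc j) = poch a j ℚ.* (a ℚ.+ ℕ→ℚ j)

hypTerm : ℚ → ℚ → ℚ → ℚ → ℕ → ℚ
hypTerm a b c z j =
  poch a j ℚ.* poch b j ℚ.* inv₀ (poch c j ℚ.* ℕ→ℚ (j ℕ.!)) ℚ.* (z ^ℚ j)

-- When a numerator
-- parameter is a nonpositive integer -d with d ≤ N (and c is a positive
-- integer), this partial sum is the (finite) value of 2F1[a,b;c;z].
₂F₁≤ : ℕ → ℚ → ℚ → ℚ → ℚ → ℚ
₂F₁≤ N a b c z = foldr ℚ._+_ 0ℚ (List.applyUpTo (hypTerm a b c z) (suc N))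

Σℚ : List ℚ → ℚ
Σℚ = foldr ℚ._+_ 0ℚ

-- Splitting off the block of the first element, the number P(n,k) of partitions of a k-set into n blocks of
-- size at most 3 (which is E₂(n,k)) satisfies P(n+1,k+1) = P(n,k) + k P(n,k−1) + C(k,2) P(n,k−2). Refined by
-- the numbers s, t, r of singletons, pairs and triples, the same recurrence gives the count k!/(s! t! r! 2^t 6^r).
-- Summing over r with t + 2r = η = k − n, the ratio of consecutive terms is that of the terminating series
-- ₂F₁[−d/2, −d/2 + ½; c + 1; 8/3]: starting from r = 0 with (d, c) = (η, n − η) when η ≤ n, and from r = η − n
-- (no singletons) with (d, c) = (2n − η, η − n) when η ≥ n.
--
-- In the game with steal limit 2 a state matters only through the numbers p and q of unwrapped gifts stolen
-- zero times and once, and the scenario count obeys "take the next gift, or steal one of the p, or one of the q".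
-- The two block-adding operators F ↦ F(L) + L F(L−1) + C(L,2) F(L−2) and F ↦ F(L) + L F(L−1) commute, which
-- solves this recurrence as G₂(n) = Σ_L P(n,L); only n ≤ L ≤ 3n contribute, giving the two sums of (ii).

module Submission where

module BoundedPartitions where

  open import Data.Nat
  open import Data.Nat.Properties
  open import Relation.Binary.PropositionalEquality
  open import Data.Nat.Solver using (module +-*-Solver)
  open import Data.Empty using (⊥; ⊥-elim)
  open import Data.Product using (Σ; _,_; _×_)
  open import Data.Sum using (_⊎_; inj₁; inj₂)
  open import Relation.Nullary using (¬_; yes; no)

  choose₂ : ℕ → ℕ
  choose₂ zero = 0
  choose₂ (suc m) = m + choose₂ m

  choose₂*2 : ∀ k → choose₂ k * 2 ≡ k * (k ∸ 1)
  choose₂*2 zero = refl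
  choose₂*2 (suc zero) = refl
  choose₂*2 (suc (suc k)) = begin
    (suc k + choose₂ (suc k)) * 2 ≡⟨ *-distribʳ-+ 2 (suc k) (choose₂ (suc k)) ⟩
    suc k * 2 + choose₂ (suc k) * 2 ≡⟨ cong (suc k * 2 +_) (choose₂*2 (suc k)) ⟩
    suc k * 2 + suc k * k ≡⟨ solve 1 (λ k → (con 1 :+ k) :* con 2 :+ (con 1 :+ k) :* k := (con 2 :+ k) :* (con 1 :+ k)) refl k ⟩
    suc (suc k) * suc k ∎
    where open ≡-Reasoning
          open +-*-Solver

  *-suc∸1 : ∀ u (g : ℕ → ℕ) → u * g (suc (u ∸ 1)) ≡ u * g u
  *-suc∸1 zero g = refl
  *-suc∸1 (suc u) g = refl

  choose₂*-suc∸2 : ∀ u (g : ℕ → ℕ) → choose₂ u * g (suc (u ∸ 2)) ≡ choose₂ u * g (u ∸ 1)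
  choose₂*-suc∸2 zero g = refl
  choose₂*-suc∸2 (suc zero) g = refl
  choose₂*-suc∸2 (suc (suc u)) g = refl

  -- Partitions of a k-set into n blocks of size ≤ 3, counted by the block of the first element:
  -- a singleton, a pair with one of the other k elements, or a triple with two of them.
  parts : ℕ → ℕ → ℕ
  parts zero zero = 1
  parts zero (suc k) = 0
  parts (suc n) zero = 0
  parts (suc n) (suc k) = parts n k + k * parts n (k ∸ 1) + choose₂ k * parts n (k ∸ 2)

  -- Those with exactly r triples; partsWithPred shifts r down by one without truncated subtraction.
  mutual
    partsWith : ℕ → ℕ → ℕ → ℕ
    partsWith zero zero zero = 1
    partsWith zero zero (suc r) = 0
    partsWith zero (suc k) r = 0
    partsWith (suc n) zero r = 0
    partsWith (suc n) (suc k) r = partsWith n k r + k * partsWith n (k ∸ 1) r + choose₂ k * partsWithPred n (k ∸ 2) r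

    partsWithPred : ℕ → ℕ → ℕ → ℕ
    partsWithPred n k zero = 0
    partsWithPred n k (suc r) = partsWith n k r

  Profile : ℕ → ℕ → ℕ → Set
  Profile n k r = Σ ℕ λ s → Σ ℕ λ t → (s + t + r ≡ n) × (s + 2 * t + 3 * r ≡ k)

  +≢0⇒≢0⊎≢0 : ∀ a b → ¬ a + b ≡ 0 → ¬ a ≡ 0 ⊎ ¬ b ≡ 0
  +≢0⇒≢0⊎≢0 zero b h = inj₂ h
  +≢0⇒≢0⊎≢0 (suc a) b h = inj₁ (λ ())

  *≢0⇒≢0ˡ : ∀ a b → ¬ a * b ≡ 0 → ¬ a ≡ 0
  *≢0⇒≢0ˡ a b h refl = h refl

  *≢0⇒≢0ʳ : ∀ a b → ¬ a * b ≡ 0 → ¬ b ≡ 0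
  *≢0⇒≢0ʳ a b h refl = h (*-zeroʳ a)

  partsWith-profile : ∀ n k r → ¬ partsWith n k r ≡ 0 → Profile n k r
  partsWith-profile zero zero zero h = 0 , 0 , refl , refl
  partsWith-profile zero zero (suc r) h = ⊥-elim (h refl)
  partsWith-profile zero (suc k) r h = ⊥-elim (h refl)
  partsWith-profile (suc n) zero r h = ⊥-elim (h refl)
  partsWith-profile (suc n) (suc k) r h with +≢0⇒≢0⊎≢0 (partsWith n k r + k * partsWith n (k ∸ 1) r) (choose₂ k * partsWithPred n (k ∸ 2) r) h
  ... | inj₁ h1 with +≢0⇒≢0⊎≢0 (partsWith n k r) (k * partsWith n (k ∸ 1) r) h1
  ...   | inj₁ ½+½ with partsWith-profile n k r ½+½
  ...     | s , t , e1 , e2 = suc s , t , cong suc e1 , cong suc e2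
  partsWith-profile (suc n) (suc k) r h | inj₁ h1 | inj₂ ½+½ with k | *≢0⇒≢0ˡ k _ ½+½ | partsWith-profile n (k ∸ 1) r (*≢0⇒≢0ʳ k _ ½+½)
  ... | zero | k≢0 | _ = ⊥-elim (k≢0 refl)
  ... | suc k' | _ | s , t , e1 , e2 = s , suc t , trans (cong (λ x → x + r) (+-suc s t)) (cong suc e1) ,
        trans (2*suc≡2+ s t r) (cong (λ x → suc (suc x)) e2)
    where
    open +-*-Solver
    2*suc≡2+ : ∀ s t r → s + 2 * suc t + 3 * r ≡ suc (suc (s + 2 * t + 3 * r))
    2*suc≡2+ = solve 3 (λ s t r → s :+ con 2 :* (con 1 :+ t) :+ con 3 :* r := con 2 :+ (s :+ con 2 :* t :+ con 3 :* r)) refl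
  partsWith-profile (suc n) (suc k) r h | inj₂ h1 with r | k | *≢0⇒≢0ˡ (choose₂ k) _ h1 | *≢0⇒≢0ʳ (choose₂ k) _ h1
  ... | zero | _ | _ | h3 = ⊥-elim (h3 refl)
  ... | suc r' | zero | ½+½ | _ = ⊥-elim (½+½ refl)
  ... | suc r' | suc zero | ½+½ | _ = ⊥-elim (½+½ refl)
  ... | suc r' | suc (suc k') | _ | h3 with partsWith-profile n k' r' h3
  ...   | s , t , e1 , e2 = s , t , trans (+-suc (s + t) r') (cong suc e1) ,
          trans (3*suc≡3+ s t r') (cong (λ x → suc (suc (suc x))) e2)
    where
    open +-*-Solver
    3*suc≡3+ : ∀ s t r → s + 2 * t + 3 * suc r ≡ suc (suc (suc (s + 2 * t + 3 * r)))
    3*suc≡3+ = solve 3 (λ s t r → s :+ con 2 :* t :+ con 3 :* (con 1 :+ r) := con 3 :+ (s :+ con 2 :* t :+ con 3 :* r)) refl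

  partsWith-vanishes : ∀ n k r → ¬ Profile n k r → partsWith n k r ≡ 0
  partsWith-vanishes n k r nv with partsWith n k r ≟ 0
  ... | yes e = e
  ... | no ne = ⊥-elim (nv (partsWith-profile n k r ne))

  blockDenominator : ℕ → ℕ → ℕ → ℕ
  blockDenominator s t r = s ! * t ! * r ! * 2 ^ t * 6 ^ r

  ClosedForm : ℕ → Set
  ClosedForm n = ∀ k s t r → s + t + r ≡ n → s + 2 * t + 3 * r ≡ k → partsWith n k r * blockDenominator s t r ≡ k !

  open +-*-Solver

  closedForm-singleton : ∀ n k s t r → ClosedForm n → s + t + r ≡ suc n → s + 2 * t + 3 * r ≡ suc k → partsWith n k r * blockDenominator s t r ≡ s * k !
  closedForm-singleton n k (suc s) t r ih e1 e2 = begin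
    partsWith n k r * (suc s * s ! * t ! * r ! * 2 ^ t * 6 ^ r)
      ≡⟨ solve 7 (λ a b c d e f g → a :* ((con 1 :+ b) :* c :* d :* e :* f :* g) := (con 1 :+ b) :* (a :* (c :* d :* e :* f :* g))) refl (partsWith n k r) s (s !) (t !) (r !) (2 ^ t) (6 ^ r) ⟩
    suc s * (partsWith n k r * blockDenominator s t r) ≡⟨ cong (suc s *_) (ih k s t r (suc-injective e1) (suc-injective e2)) ⟩
    suc s * k ! ∎
    where open ≡-Reasoning
  closedForm-singleton n k zero t r ih e1 e2 = cong (_* blockDenominator zero t r) (partsWith-vanishes n k r nv)
    where
    nv : ¬ Profile n k r
    nv (s' , t' , f1 , f2) = m+1+n≢m (s' + 2 * t' + 3 * r + 1) (begin
      s' + 2 * t' + 3 * r + 1 + suc s' ≡⟨ solve 3 (λ a b c → a :+ con 2 :* b :+ con 3 :* c :+ con 1 :+ (con 1 :+ a) := con 2 :* (a :+ b :+ c :+ con 1) :+ c) refl s' t' r ⟩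
      2 * (s' + t' + r + 1) + r ≡⟨ cong (λ x → 2 * (x + 1) + r) f1 ⟩
      2 * (n + 1) + r ≡⟨ cong (λ x → 2 * x + r) (trans (+-comm n 1) (sym e1)) ⟩
      2 * (t + r) + r ≡⟨ solve 2 (λ a b → con 2 :* (a :+ b) :+ b := con 2 :* a :+ con 3 :* b) refl t r ⟩
      2 * t + 3 * r ≡⟨ e2 ⟩
      suc k ≡⟨ cong suc (sym f2) ⟩
      suc (s' + 2 * t' + 3 * r) ≡⟨ +-comm 1 _ ⟩
      s' + 2 * t' + 3 * r + 1 ∎)
      where open ≡-Reasoning

  closedForm-pair : ∀ n k s t r → ClosedForm n → s + t + r ≡ suc n → s + 2 * t + 3 * r ≡ suc k → (k * partsWith n (k ∸ 1) r) * blockDenominator s t r ≡ (2 * t) * k !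
  closedForm-pair n zero s (suc t') r ih e1 e2 = ⊥-elim (bad (trans (l s t' r) e2))
    where
    l : ∀ s t r → suc (suc (s + 2 * t + 3 * r)) ≡ s + 2 * suc t + 3 * r
    l = solve 3 (λ s t r → con 2 :+ (s :+ con 2 :* t :+ con 3 :* r) := s :+ con 2 :* (con 1 :+ t) :+ con 3 :* r) refl
    bad : ∀ {x} → suc (suc x) ≡ 1 → ⊥
    bad ()
  closedForm-pair n (suc k) s (suc t') r ih e1 e2 = begin
    (suc k * partsWith n k r) * (s ! * (suc t' * t' !) * r ! * (2 * 2 ^ t') * 6 ^ r)
      ≡⟨ solve 8 (λ K a b c d e f T → ((con 1 :+ K) :* a) :* (b :* ((con 1 :+ T) :* c) :* d :* (con 2 :* e) :* f)
                := (con 2 :* (con 1 :+ T)) :* ((con 1 :+ K) :* (a :* (b :* c :* d :* e :* f)))) refl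
                k (partsWith n k r) (s !) (t' !) (r !) (2 ^ t') (6 ^ r) t' ⟩
    (2 * suc t') * (suc k * (partsWith n k r * blockDenominator s t' r))
      ≡⟨ cong (λ x → (2 * suc t') * (suc k * x)) (ih k s t' r (suc-injective (trans (l1 s t' r) e1)) (suc-injective (suc-injective (trans (l2 s t' r) e2)))) ⟩
    (2 * suc t') * (suc k * k !) ∎
    where
    open ≡-Reasoning
    l1 : ∀ s t r → suc (s + t + r) ≡ s + suc t + r
    l1 = solve 3 (λ s t r → con 1 :+ (s :+ t :+ r) := s :+ (con 1 :+ t) :+ r) refl
    l2 : ∀ s t r → suc (suc (s + 2 * t + 3 * r)) ≡ s + 2 * suc t + 3 * r
    l2 = solve 3 (λ s t r → con 2 :+ (s :+ con 2 :* t :+ con 3 :* r) := s :+ con 2 :* (con 1 :+ t) :+ con 3 :* r) refl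
  closedForm-pair n zero s zero r ih e1 e2 = refl
  closedForm-pair n (suc k) s zero r ih e1 e2 = begin
    (suc k * partsWith n k r) * blockDenominator s 0 r ≡⟨ cong (λ x → (suc k * x) * blockDenominator s 0 r) (partsWith-vanishes n k r nv) ⟩
    (suc k * 0) * blockDenominator s 0 r ≡⟨ cong (_* blockDenominator s 0 r) (*-zeroʳ (suc k)) ⟩
    0 ∎
    where
    open ≡-Reasoning
    nv : ¬ Profile n k r
    nv (s' , t' , f1 , f2) = m+1+n≢m (s + 2 * 0 + 3 * r) (begin
      s + 2 * 0 + 3 * r + suc t' ≡⟨ solve 3 (λ a b c → a :+ con 2 :* con 0 :+ con 3 :* c :+ (con 1 :+ b) := (a :+ con 0 :+ c) :+ con 2 :* c :+ (con 1 :+ b)) refl s t' r ⟩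
      (s + 0 + r) + 2 * r + suc t' ≡⟨ cong (λ x → x + 2 * r + suc t') (trans e1 (cong suc (sym f1))) ⟩
      suc (s' + t' + r) + 2 * r + suc t' ≡⟨ solve 3 (λ a b c → (con 1 :+ (a :+ b :+ c)) :+ con 2 :* c :+ (con 1 :+ b) := con 2 :+ (a :+ con 2 :* b :+ con 3 :* c)) refl s' t' r ⟩
      suc (suc (s' + 2 * t' + 3 * r)) ≡⟨ cong (λ x → suc (suc x)) f2 ⟩
      suc (suc k) ≡⟨ sym e2 ⟩
      s + 2 * 0 + 3 * r ∎)

  closedForm-triple : ∀ n k s t r → ClosedForm n → s + t + r ≡ suc n → s + 2 * t + 3 * r ≡ suc k → (choose₂ k * partsWithPred n (k ∸ 2) r) * blockDenominator s t r ≡ (3 * r) * k !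
  closedForm-triple n k s t zero ih e1 e2 = cong (_* blockDenominator s t 0) (*-zeroʳ (choose₂ k))
  closedForm-triple n zero s t (suc r') ih e1 e2 = ⊥-elim (bad (trans (l s t r') e2))
    where
    l : ∀ s t r → suc (suc (suc (s + 2 * t + 3 * r))) ≡ s + 2 * t + 3 * suc r
    l = solve 3 (λ s t r → con 3 :+ (s :+ con 2 :* t :+ con 3 :* r) := s :+ con 2 :* t :+ con 3 :* (con 1 :+ r)) refl
    bad : ∀ {x} → suc (suc (suc x)) ≡ 1 → ⊥
    bad ()
  closedForm-triple n (suc zero) s t (suc r') ih e1 e2 = ⊥-elim (bad (trans (l s t r') e2))
    where
    l : ∀ s t r → suc (suc (suc (s + 2 * t + 3 * r))) ≡ s + 2 * t + 3 * suc r
    l = solve 3 (λ s t r → con 3 :+ (s :+ con 2 :* t :+ con 3 :* r) := s :+ con 2 :* t :+ con 3 :* (con 1 :+ r)) refl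
    bad : ∀ {x} → suc (suc (suc x)) ≡ 2 → ⊥
    bad ()
  closedForm-triple n (suc (suc k)) s t (suc r') ih e1 e2 = begin
    (choose₂ K * partsWith n k r') * (s ! * t ! * (suc r' * r' !) * 2 ^ t * (6 * 6 ^ r'))
      ≡⟨ solve 8 (λ T a b c d e f R → (T :* a) :* (b :* c :* ((con 1 :+ R) :* d) :* e :* (con 6 :* f))
           := (con 3 :* (con 1 :+ R)) :* ((T :* con 2) :* (a :* (b :* c :* d :* e :* f)))) refl
           (choose₂ K) (partsWith n k r') (s !) (t !) (r' !) (2 ^ t) (6 ^ r') r' ⟩
    (3 * suc r') * ((choose₂ K * 2) * (partsWith n k r' * blockDenominator s t r'))
      ≡⟨ cong₂ (λ x y → (3 * suc r') * (x * y)) (choose₂*2 K) (ih k s t r' (suc-injective (trans (l1 s t r') e1)) (suc-injective (suc-injective (suc-injective (trans (l2 s t r') e2))))) ⟩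
    (3 * suc r') * ((K * suc k) * k !)
      ≡⟨ cong ((3 * suc r') *_) (*-assoc K (suc k) (k !)) ⟩
    (3 * suc r') * K ! ∎
    where
    K = suc (suc k)
    open ≡-Reasoning
    l1 : ∀ s t r → suc (s + t + r) ≡ s + t + suc r
    l1 = solve 3 (λ s t r → con 1 :+ (s :+ t :+ r) := s :+ t :+ (con 1 :+ r)) refl
    l2 : ∀ s t r → suc (suc (suc (s + 2 * t + 3 * r))) ≡ s + 2 * t + 3 * suc r
    l2 = solve 3 (λ s t r → con 3 :+ (s :+ con 2 :* t :+ con 3 :* r) := s :+ con 2 :* t :+ con 3 :* (con 1 :+ r)) refl

  partsWith-closedForm : ∀ n → ClosedForm n
  partsWith-closedForm zero k zero zero zero e1 refl = refl
  partsWith-closedForm zero k zero zero (suc r) () e2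
  partsWith-closedForm zero k zero (suc t) r () e2
  partsWith-closedForm zero k (suc s) t r () e2
  partsWith-closedForm (suc n) zero (suc s) t r e1 ()
  partsWith-closedForm (suc n) zero zero (suc t) r e1 ()
  partsWith-closedForm (suc n) zero zero zero (suc r) e1 ()
  partsWith-closedForm (suc n) zero zero zero zero () e2
  partsWith-closedForm (suc n) (suc k) s t r e1 e2 = begin
    (partsWith n k r + k * partsWith n (k ∸ 1) r + choose₂ k * partsWithPred n (k ∸ 2) r) * blockDenominator s t r
      ≡⟨ solve 4 (λ a b c d → (a :+ b :+ c) :* d := a :* d :+ b :* d :+ c :* d) refl (partsWith n k r) (k * partsWith n (k ∸ 1) r) (choose₂ k * partsWithPred n (k ∸ 2) r) (blockDenominator s t r) ⟩
    partsWith n k r * blockDenominator s t r + (k * partsWith n (k ∸ 1) r) * blockDenominator s t r + (choose₂ k * partsWithPred n (k ∸ 2) r) * blockDenominator s t r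
      ≡⟨ cong₂ _+_ (cong₂ _+_ (closedForm-singleton n k s t r ih e1 e2) (closedForm-pair n k s t r ih e1 e2)) (closedForm-triple n k s t r ih e1 e2) ⟩
    s * k ! + 2 * t * k ! + 3 * r * k ! ≡⟨ solve 4 (λ a b c d → a :* d :+ con 2 :* b :* d :+ con 3 :* c :* d := (a :+ con 2 :* b :+ con 3 :* c) :* d) refl s t r (k !) ⟩
    (s + 2 * t + 3 * r) * k ! ≡⟨ cong (_* k !) e2 ⟩
    suc k * k ! ∎
    where
    open ≡-Reasoning
    ih : ClosedForm n
    ih = partsWith-closedForm n

  sumTo : ℕ → (ℕ → ℕ) → ℕ
  sumTo zero g = 0
  sumTo (suc N) g = sumTo N g + g N

  sumTo-cong : ∀ N {g h : ℕ → ℕ} → (∀ r → g r ≡ h r) → sumTo N g ≡ sumTo N h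
  sumTo-cong zero e = refl
  sumTo-cong (suc N) e = cong₂ _+_ (sumTo-cong N e) (e N)

  sumTo-+ : ∀ N (g h : ℕ → ℕ) → sumTo N (λ r → g r + h r) ≡ sumTo N g + sumTo N h
  sumTo-+ zero g h = refl
  sumTo-+ (suc N) g h = trans (cong (_+ (g N + h N)) (sumTo-+ N g h))
    (solve 4 (λ a b c d → (a :+ b) :+ (c :+ d) := (a :+ c) :+ (b :+ d)) refl (sumTo N g) (sumTo N h) (g N) (h N))

  sumTo-* : ∀ N c (g : ℕ → ℕ) → sumTo N (λ r → c * g r) ≡ c * sumTo N g
  sumTo-* zero c g = sym (*-zeroʳ c)
  sumTo-* (suc N) c g = trans (cong (_+ c * g N) (sumTo-* N c g)) (sym (*-distribˡ-+ c (sumTo N g) (g N)))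

  sumTo-shift : ∀ N (g : ℕ → ℕ) → sumTo (suc N) g ≡ g 0 + sumTo N (λ r → g (suc r))
  sumTo-shift zero g = +-comm 0 (g 0)
  sumTo-shift (suc N) g = trans (cong (_+ g (suc N)) (sumTo-shift N g)) (+-assoc (g 0) _ _)

  sumTo-zero : ∀ N (g : ℕ → ℕ) → (∀ r → r < N → g r ≡ 0) → sumTo N g ≡ 0
  sumTo-zero zero g e = refl
  sumTo-zero (suc N) g e = cong₂ _+_ (sumTo-zero N g (λ r lt → e r (m<n⇒m<1+n lt))) (e N ≤-refl)

  sumTo-split : ∀ a M (g : ℕ → ℕ) → sumTo (a + M) g ≡ sumTo a g + sumTo M (λ l → g (a + l))
  sumTo-split a zero g = trans (cong (λ z → sumTo z g) (+-identityʳ a)) (sym (+-identityʳ _))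
  sumTo-split a (suc M) g = begin
    sumTo (a + suc M) g ≡⟨ cong (λ z → sumTo z g) (+-suc a M) ⟩
    sumTo (a + M) g + g (a + M) ≡⟨ cong (_+ g (a + M)) (sumTo-split a M g) ⟩
    sumTo a g + sumTo M (λ l → g (a + l)) + g (a + M) ≡⟨ +-assoc (sumTo a g) _ _ ⟩
    sumTo a g + sumTo (suc M) (λ l → g (a + l)) ∎
    where open ≡-Reasoning

  partsWith-tooManyTriples : ∀ n k r → n < r → partsWith n k r ≡ 0
  partsWith-tooManyTriples n k r lt = partsWith-vanishes n k r nv
    where
    nv : ¬ Profile n k r
    nv (s , t , e1 , e2) = <⇒≱ lt (≤-trans (m≤n+m r (s + t)) (≤-reflexive e1))

  parts≡sumTo-partsWith : ∀ n k N → n < N → parts n k ≡ sumTo N (partsWith n k)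
  parts≡sumTo-partsWith zero k (suc N) lt = trans (base k) (sym (trans (sumTo-shift N (partsWith 0 k)) (trans (cong (partsWith 0 k 0 +_) (sumTo-zero N _ (λ r _ → partsWith-tooManyTriples 0 k (suc r) (s≤s z≤n)))) (+-identityʳ _))))
    where
    base : ∀ k → parts 0 k ≡ partsWith 0 k 0
    base zero = refl
    base (suc k) = refl
  parts≡sumTo-partsWith (suc n) zero N lt = sym (sumTo-zero N _ (λ _ _ → refl))
  parts≡sumTo-partsWith (suc n) (suc k) (suc N) lt = sym (begin
    sumTo (suc N) (λ r → partsWith n k r + k * partsWith n (k ∸ 1) r + choose₂ k * partsWithPred n (k ∸ 2) r)
      ≡⟨ sumTo-+ (suc N) (λ r → partsWith n k r + k * partsWith n (k ∸ 1) r) (λ r → choose₂ k * partsWithPred n (k ∸ 2) r) ⟩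
    sumTo (suc N) (λ r → partsWith n k r + k * partsWith n (k ∸ 1) r) + sumTo (suc N) (λ r → choose₂ k * partsWithPred n (k ∸ 2) r)
      ≡⟨ cong₂ _+_ (sumTo-+ (suc N) (partsWith n k) (λ r → k * partsWith n (k ∸ 1) r)) (sumTo-* (suc N) (choose₂ k) (partsWithPred n (k ∸ 2))) ⟩
    sumTo (suc N) (partsWith n k) + sumTo (suc N) (λ r → k * partsWith n (k ∸ 1) r) + choose₂ k * sumTo (suc N) (partsWithPred n (k ∸ 2))
      ≡⟨ cong₂ (λ x y → sumTo (suc N) (partsWith n k) + x + choose₂ k * y) (sumTo-* (suc N) k (partsWith n (k ∸ 1))) (sumTo-shift N (partsWithPred n (k ∸ 2))) ⟩
    sumTo (suc N) (partsWith n k) + k * sumTo (suc N) (partsWith n (k ∸ 1)) + choose₂ k * (0 + sumTo N (partsWith n (k ∸ 2)))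
      ≡⟨ sym (cong₂ _+_ (cong₂ _+_ (parts≡sumTo-partsWith n k (suc N) lt') (cong (k *_) (parts≡sumTo-partsWith n (k ∸ 1) (suc N) lt'))) (cong (choose₂ k *_) (parts≡sumTo-partsWith n (k ∸ 2) N (≤-pred lt)))) ⟩
    parts n k + k * parts n (k ∸ 1) + choose₂ k * parts n (k ∸ 2) ∎)
    where
    open ≡-Reasoning
    lt' : n < suc N
    lt' = m<n⇒m<1+n (≤-pred lt)

  parts-vanishes : ∀ n k → (∀ r → ¬ Profile n k r) → parts n k ≡ 0
  parts-vanishes n k noProfile = trans (parts≡sumTo-partsWith n k (suc n) ≤-refl)
    (sumTo-zero (suc n) (partsWith n k) (λ r _ → partsWith-vanishes n k r (noProfile r)))

  parts-tooFew : ∀ n k → k < n → parts n k ≡ 0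
  parts-tooFew n k k<n = parts-vanishes n k noProfile
    where
    noProfile : ∀ r → ¬ Profile n k r
    noProfile r (s , t , e1 , e2) = <⇒≱ k<n (begin
      n                       ≡⟨ sym e1 ⟩
      s + t + r               ≤⟨ +-mono-≤ (+-monoʳ-≤ s (m≤m+n t (t + 0))) (m≤m+n r (r + (r + 0))) ⟩
      s + 2 * t + 3 * r       ≡⟨ e2 ⟩
      k                       ∎)
      where open ≤-Reasoning

  parts-tooMany : ∀ n k → 3 * n < k → parts n k ≡ 0
  parts-tooMany n k 3n<k = parts-vanishes n k noProfile
    where
    noProfile : ∀ r → ¬ Profile n k r
    noProfile r (s , t , e1 , e2) = <⇒≱ 3n<k (begin
      k                       ≡⟨ sym e2 ⟩
      s + 2 * t + 3 * r       ≤⟨ +-monoˡ-≤ (3 * r) (+-mono-≤ (m≤m+n s (s + (s + 0))) (*-monoˡ-≤ t {2} {3} (s≤s (s≤s z≤n)))) ⟩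
      3 * s + 3 * t + 3 * r   ≡⟨ solve 3 (λ s t r → con 3 :* s :+ con 3 :* t :+ con 3 :* r := con 3 :* (s :+ t :+ r)) refl s t r ⟩
      3 * (s + t + r)         ≡⟨ cong (3 *_) e1 ⟩
      3 * n                   ∎)
      where open ≤-Reasoning


module SetPartitions where

  open import Defs
  open BoundedPartitions using (choose₂; parts; *-suc∸1; choose₂*-suc∸2)
  open import Data.Bool as B using (Bool; true; false; _∧_; not; if_then_else_; T)
  open import Data.Bool.Properties using (∧-assoc; ∧-zeroʳ)
  open import Data.Nat as ℕ using (ℕ; zero; suc; _+_; _*_; _∸_)
  import Data.Nat.Properties as ℕP
  import Data.Nat.Solver as NSol
  open import Data.Fin as Fin using (Fin)
  open import Data.List as List using (List; []; _∷_; _++_; map; length; filter; tabulate)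
  open import Data.List.Properties using (length-++; length-map)
  open import Data.Vec as Vec using ([]; _∷_; lookup; replicate)
  open import Relation.Binary.PropositionalEquality
  open import Relation.Nullary using (¬_; yes; no)

  sumL : ∀ {a} {A : Set a} → List A → (A → ℕ) → ℕ
  sumL [] g = 0
  sumL (x ∷ xs) g = g x + sumL xs g

  𝟙 : Bool → ℕ
  𝟙 true = 1
  𝟙 false = 0

  sumL-++ : ∀ {a} {A : Set a} (xs ys : List A) g → sumL (xs ++ ys) g ≡ sumL xs g + sumL ys g
  sumL-++ [] ys g = refl
  sumL-++ (x ∷ xs) ys g = trans (cong (g x +_) (sumL-++ xs ys g)) (sym (ℕP.+-assoc (g x) _ _))

  sumL-map : ∀ {a b} {A : Set a} {C : Set b} (f : A → C) xs g → sumL (map f xs) g ≡ sumL xs (λ x → g (f x))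
  sumL-map f [] g = refl
  sumL-map f (x ∷ xs) g = cong (g (f x) +_) (sumL-map f xs g)

  sumL-cong : ∀ {a} {A : Set a} (xs : List A) {g h : A → ℕ} → (∀ x → g x ≡ h x) → sumL xs g ≡ sumL xs h
  sumL-cong [] e = refl
  sumL-cong (x ∷ xs) e = cong₂ _+_ (e x) (sumL-cong xs e)

  sumL-zero : ∀ {a} {A : Set a} (xs : List A) {g : A → ℕ} → (∀ x → g x ≡ 0) → sumL xs g ≡ 0
  sumL-zero [] e = refl
  sumL-zero (x ∷ xs) e = cong₂ _+_ (e x) (sumL-zero xs e)

  sumL-+ : ∀ {a} {A : Set a} (xs : List A) (g h : A → ℕ) → sumL xs (λ x → g x + h x) ≡ sumL xs g + sumL xs h
  sumL-+ [] g h = refl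
  sumL-+ (x ∷ xs) g h = trans (cong (g x + h x +_) (sumL-+ xs g h))
    (solve 4 (λ a b c d → (a :+ b) :+ (c :+ d) := (a :+ c) :+ (b :+ d)) refl (g x) (h x) (sumL xs g) (sumL xs h))
    where open NSol.+-*-Solver

  countB-sumL : ∀ {a} {A : Set a} (p : A → Bool) xs → countB p xs ≡ sumL xs (λ x → 𝟙 (p x))
  countB-sumL p [] = refl
  countB-sumL p (x ∷ xs) with p x
  ... | true = cong suc (countB-sumL p xs)
  ... | false = countB-sumL p xs

  length-filter : ∀ {a} {A : Set a} (p : A → Bool) xs → length (filter (λ x → p x B.≟ true) xs) ≡ countB p xs
  length-filter p [] = refl
  length-filter p (x ∷ xs) with p x
  ... | true = cong suc (length-filter p xs)
  ... | false = length-filter p xs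

  sublists-++ : ∀ {a} {A : Set a} (xs ys : List A) (g : List A → ℕ) →
    sumL (sublists (xs ++ ys)) g ≡ sumL (sublists xs) (λ a → sumL (sublists ys) (λ b → g (a ++ b)))
  sublists-++ [] ys g = sym (ℕP.+-identityʳ _)
  sublists-++ (x ∷ xs) ys g = begin
    sumL (map (x ∷_) (sublists (xs ++ ys)) ++ sublists (xs ++ ys)) g
      ≡⟨ sumL-++ (map (x ∷_) (sublists (xs ++ ys))) _ g ⟩
    sumL (map (x ∷_) (sublists (xs ++ ys))) g + sumL (sublists (xs ++ ys)) g
      ≡⟨ cong (_+ sumL (sublists (xs ++ ys)) g) (sumL-map (x ∷_) (sublists (xs ++ ys)) g) ⟩
    sumL (sublists (xs ++ ys)) (λ l → g (x ∷ l)) + sumL (sublists (xs ++ ys)) g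
      ≡⟨ cong₂ _+_ (sublists-++ xs ys (λ l → g (x ∷ l))) (sublists-++ xs ys g) ⟩
    sumL (sublists xs) (λ a → sumL (sublists ys) (λ b → g (x ∷ a ++ b))) + sumL (sublists xs) (λ a → sumL (sublists ys) (λ b → g (a ++ b)))
      ≡⟨ cong (_+ sumL (sublists xs) (λ a → sumL (sublists ys) (λ b → g (a ++ b)))) (sym (sumL-map (x ∷_) (sublists xs) (λ a → sumL (sublists ys) (λ b → g (a ++ b))))) ⟩
    sumL (map (x ∷_) (sublists xs)) (λ a → sumL (sublists ys) (λ b → g (a ++ b))) + sumL (sublists xs) (λ a → sumL (sublists ys) (λ b → g (a ++ b)))
      ≡⟨ sym (sumL-++ (map (x ∷_) (sublists xs)) _ _) ⟩
    sumL (map (x ∷_) (sublists xs) ++ sublists xs) (λ a → sumL (sublists ys) (λ b → g (a ++ b))) ∎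
    where open ≡-Reasoning

  sublists-map : ∀ {a b} {A : Set a} {C : Set b} (f : A → C) (xs : List A) (g : List C → ℕ) →
    sumL (sublists (map f xs)) g ≡ sumL (sublists xs) (λ a → g (map f a))
  sublists-map f [] g = refl
  sublists-map f (x ∷ xs) g = begin
    sumL (map (f x ∷_) (sublists (map f xs)) ++ sublists (map f xs)) g
      ≡⟨ sumL-++ (map (f x ∷_) (sublists (map f xs))) _ g ⟩
    sumL (map (f x ∷_) (sublists (map f xs))) g + sumL (sublists (map f xs)) g
      ≡⟨ cong₂ _+_ (trans (sumL-map (f x ∷_) (sublists (map f xs)) g) (sublists-map f xs (λ l → g (f x ∷ l)))) (sublists-map f xs g) ⟩
    sumL (sublists xs) (λ a → g (f x ∷ map f a)) + sumL (sublists xs) (λ a → g (map f a))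
      ≡⟨ cong (_+ sumL (sublists xs) (λ a → g (map f a))) (sym (sumL-map (x ∷_) (sublists xs) (λ a → g (map f a)))) ⟩
    sumL (map (x ∷_) (sublists xs)) (λ a → g (map f a)) + sumL (sublists xs) (λ a → g (map f a))
      ≡⟨ sym (sumL-++ (map (x ∷_) (sublists xs)) _ _) ⟩
    sumL (map (x ∷_) (sublists xs) ++ sublists xs) (λ a → g (map f a)) ∎
    where open ≡-Reasoning

  sublists-onlyEmpty : ∀ {a} {A : Set a} (xs : List A) (g : List A → ℕ) → (∀ y l → g (y ∷ l) ≡ 0) → sumL (sublists xs) g ≡ g []
  sublists-onlyEmpty [] g e = ℕP.+-identityʳ _
  sublists-onlyEmpty (x ∷ xs) g e = begin
    sumL (map (x ∷_) (sublists xs) ++ sublists xs) g ≡⟨ sumL-++ (map (x ∷_) (sublists xs)) _ g ⟩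
    sumL (map (x ∷_) (sublists xs)) g + sumL (sublists xs) g ≡⟨ cong₂ _+_ (trans (sumL-map (x ∷_) (sublists xs) g) (sumL-zero (sublists xs) (λ l → e x l))) (sublists-onlyEmpty xs g e) ⟩
    g [] ∎
    where open ≡-Reasoning

  sublists-onlySingletons : ∀ {a} {A : Set a} (xs : List A) (g : List A → ℕ) → g [] ≡ 0 → (∀ y z l → g (y ∷ z ∷ l) ≡ 0) →
    sumL (sublists xs) g ≡ sumL xs (λ y → g (y ∷ []))
  sublists-onlySingletons [] g e0 e2 = trans (ℕP.+-identityʳ _) e0
  sublists-onlySingletons (x ∷ xs) g e0 e2 = begin
    sumL (map (x ∷_) (sublists xs) ++ sublists xs) g ≡⟨ sumL-++ (map (x ∷_) (sublists xs)) _ g ⟩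
    sumL (map (x ∷_) (sublists xs)) g + sumL (sublists xs) g
      ≡⟨ cong₂ _+_ (trans (sumL-map (x ∷_) (sublists xs) g) (sublists-onlyEmpty xs (λ l → g (x ∷ l)) (λ y l → e2 x y l))) (sublists-onlySingletons xs g e0 e2) ⟩
    g (x ∷ []) + sumL xs (λ y → g (y ∷ [])) ∎
    where open ≡-Reasoning

  allFinB : ∀ n → (Fin n → Bool) → Bool
  allFinB zero q = true
  allFinB (suc n) q = q Fin.zero ∧ allFinB n (λ i → q (Fin.suc i))

  allFinB-cong : ∀ n {p q : Fin n → Bool} → (∀ i → p i ≡ q i) → allFinB n p ≡ allFinB n q
  allFinB-cong zero e = refl
  allFinB-cong (suc n) e = cong₂ _∧_ (e Fin.zero) (allFinB-cong n (λ i → e (Fin.suc i)))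

  allFinB-∧ : ∀ n (p q : Fin n → Bool) → allFinB n (λ i → p i ∧ q i) ≡ allFinB n p ∧ allFinB n q
  allFinB-∧ zero p q = refl
  allFinB-∧ (suc n) p q = begin
    (p Fin.zero ∧ q Fin.zero) ∧ allFinB n (λ i → p (Fin.suc i) ∧ q (Fin.suc i))
      ≡⟨ cong ((p Fin.zero ∧ q Fin.zero) ∧_) (allFinB-∧ n (λ i → p (Fin.suc i)) (λ i → q (Fin.suc i))) ⟩
    (p Fin.zero ∧ q Fin.zero) ∧ (allFinB n (λ i → p (Fin.suc i)) ∧ allFinB n (λ i → q (Fin.suc i)))
      ≡⟨ ∧-interchange (p Fin.zero) (q Fin.zero) _ _ ⟩
    (p Fin.zero ∧ allFinB n (λ i → p (Fin.suc i))) ∧ (q Fin.zero ∧ allFinB n (λ i → q (Fin.suc i))) ∎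
    where
    open ≡-Reasoning
    ∧-interchange : ∀ a b c d → (a ∧ b) ∧ (c ∧ d) ≡ (a ∧ c) ∧ (b ∧ d)
    ∧-interchange true true c d = refl
    ∧-interchange true false c d = sym (∧-zeroʳ c)
    ∧-interchange false b c d = refl

  allB-tabulate : ∀ {a} {A : Set a} n (p : A → Bool) (f : Fin n → A) → allB p (tabulate f) ≡ allFinB n (λ i → p (f i))
  allB-tabulate zero p f = refl
  allB-tabulate (suc n) p f = cong (p (f Fin.zero) ∧_) (allB-tabulate n p (λ i → f (Fin.suc i)))

  allB-++ : ∀ {a} {A : Set a} (p : A → Bool) xs ys → allB p (xs ++ ys) ≡ allB p xs ∧ allB p ys
  allB-++ p [] ys = refl
  allB-++ p (x ∷ xs) ys = trans (cong (p x ∧_) (allB-++ p xs ys)) (sym (∧-assoc (p x) _ _))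

  allB-map : ∀ {a b} {A : Set a} {C : Set b} (p : C → Bool) (f : A → C) xs → allB p (map f xs) ≡ allB (λ x → p (f x)) xs
  allB-map p f [] = refl
  allB-map p f (x ∷ xs) = cong (p (f x) ∧_) (allB-map p f xs)

  countB-++ : ∀ {a} {A : Set a} (p : A → Bool) xs ys → countB p (xs ++ ys) ≡ countB p xs + countB p ys
  countB-++ p [] ys = refl
  countB-++ p (x ∷ xs) ys with p x
  ... | true = cong suc (countB-++ p xs ys)
  ... | false = countB-++ p xs ys

  countB-map : ∀ {a b} {A : Set a} {C : Set b} (p : C → Bool) (f : A → C) xs → countB p (map f xs) ≡ countB (λ x → p (f x)) xs
  countB-map p f [] = refl
  countB-map p f (x ∷ xs) with p (f x)
  ... | true = cong suc (countB-map p f xs)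
  ... | false = countB-map p f xs

  countB-true : ∀ {a} {A : Set a} (xs : List A) → countB (λ _ → true) xs ≡ length xs
  countB-true [] = refl
  countB-true (x ∷ xs) = cong suc (countB-true xs)

  countB-false : ∀ {a} {A : Set a} (xs : List A) → countB (λ _ → false) xs ≡ 0
  countB-false [] = refl
  countB-false (x ∷ xs) = countB-false xs

  ind-∧ : ∀ a b → 𝟙 (a ∧ b) ≡ (if a then 𝟙 b else 0)
  ind-∧ true b = refl
  ind-∧ false b = refl

  sumL-if : ∀ {a} {A : Set a} (xs : List A) c (g : A → ℕ) → sumL xs (λ x → if c then g x else 0) ≡ (if c then sumL xs g else 0)
  sumL-if xs true g = refl
  sumL-if xs false g = sumL-zero xs (λ _ → refl)

  implies : Bool → Bool → Bool
  implies true u = u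
  implies false u = true

  isSubsetOf : ∀ {k} → Subset k → Subset k → Bool
  isSubsetOf [] [] = true
  isSubsetOf (x ∷ b) (u ∷ U) = implies x u ∧ isSubsetOf b U

  diff : ∀ {k} → Subset k → Subset k → Subset k
  diff [] [] = []
  diff (u ∷ U) (x ∷ b) = (u ∧ not x) ∷ diff U b

  T→≡ : ∀ {b} → T b → b ≡ true
  T→≡ {true} _ = refl

  ¬T→≡ : ∀ {b} → ¬ T b → b ≡ false
  ¬T→≡ {true} h with h _
  ... | ()
  ¬T→≡ {false} _ = refl

  ≤ℕ≡ : ∀ s m → (s ≤ℕ m) ≡ (s ℕ.≤ᵇ m)
  ≤ℕ≡ s m with s ℕP.≤? m
  ... | yes p = sym (T→≡ (ℕP.≤⇒≤ᵇ p))
  ... | no ¬p = sym (¬T→≡ (λ t → ¬p (ℕP.≤ᵇ⇒≤ s m t)))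

  ==ℕ≡ : ∀ s m → (s ==ℕ m) ≡ (s ℕ.≡ᵇ m)
  ==ℕ≡ s m with s ℕP.≟ m
  ... | yes p = sym (T→≡ (ℕP.≡⇒≡ᵇ s m p))
  ... | no ¬p = sym (¬T→≡ (λ t → ¬p (ℕP.≡ᵇ⇒≡ s m t)))

  ==ℕ-suc : ∀ s m → (suc s ==ℕ suc m) ≡ (s ==ℕ m)
  ==ℕ-suc s m = trans (==ℕ≡ (suc s) (suc m)) (sym (==ℕ≡ s m))

  suc==ℕ0 : ∀ s → (suc s ==ℕ 0) ≡ false
  suc==ℕ0 s = ==ℕ≡ (suc s) 0

  0==ℕsuc : ∀ s → (0 ==ℕ suc s) ≡ false
  0==ℕsuc s = ==ℕ≡ 0 (suc s)

  2+==ℕ1 : ∀ s → (suc (suc s) ==ℕ 1) ≡ false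
  2+==ℕ1 s = trans (==ℕ-suc (suc s) 0) (suc==ℕ0 s)

  ≤ℕ-suc : ∀ s m → (suc s ≤ℕ suc m) ≡ (s ≤ℕ m)
  ≤ℕ-suc s m = trans (≤ℕ≡ (suc s) (suc m)) (trans (l s m) (sym (≤ℕ≡ s m)))
    where
    l : ∀ s m → (suc s ℕ.≤ᵇ suc m) ≡ (s ℕ.≤ᵇ m)
    l zero m = refl
    l (suc s) m = refl

  sumSubsets : ℕ → ∀ k → Subset k → (ℕ → ℕ) → ℕ
  sumSubsets m k U g = sumL (allSubsets k) (λ b → if ((size b ≤ℕ m) ∧ isSubsetOf b U) then g (size (diff U b)) else 0)

  sumSubsets-∷ : ∀ m k x (U : Subset k) g → sumSubsets m (suc k) (x ∷ U) g ≡
    sumL (allSubsets k) (λ b → if ((suc (size b) ≤ℕ m) ∧ (implies true x ∧ isSubsetOf b U)) then g (size ((x ∧ false) ∷ diff U b)) else 0)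
    + sumL (allSubsets k) (λ b → if ((size b ≤ℕ m) ∧ isSubsetOf b U) then g (size ((x ∧ true) ∷ diff U b)) else 0)
  sumSubsets-∷ m k x U g = trans (sumL-++ (map (true ∷_) (allSubsets k)) _ _)
    (cong₂ _+_ (sumL-map (true ∷_) (allSubsets k) _) (sumL-map (false ∷_) (allSubsets k) _))

  closed₀ closed₁ closed₂ : ℕ → (ℕ → ℕ) → ℕ
  closed₀ u g = g u
  closed₁ u g = g u + u * g (u ∸ 1)
  closed₂ u g = g u + u * g (u ∸ 1) + choose₂ u * g (u ∸ 2)

  sumSubsets-closed : ℕ → ∀ k → Subset k → (ℕ → ℕ) → ℕ
  sumSubsets-closed zero k U g = closed₀ (size U) g
  sumSubsets-closed (suc zero) k U g = closed₁ (size U) g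
  sumSubsets-closed (suc (suc m)) k U g = closed₂ (size U) g

  sumSubsets≡closed : ∀ m → m ℕ.≤ 2 → ∀ k (U : Subset k) g → sumSubsets m k U g ≡ sumSubsets-closed m k U g
  sumSubsets≡closed zero _ zero [] g = ℕP.+-identityʳ (g 0)
  sumSubsets≡closed (suc zero) _ zero [] g = trans (ℕP.+-identityʳ (g 0)) (sym (ℕP.+-identityʳ (g 0)))
  sumSubsets≡closed (suc (suc zero)) _ zero [] g = sym (ℕP.+-identityʳ (g 0 + 0))
  sumSubsets≡closed (suc (suc (suc m))) (ℕ.s≤s (ℕ.s≤s ())) k U g
  sumSubsets≡closed m m≤2 (suc k) (false ∷ U) g = trans (sumSubsets-∷ m k false U g)
    (trans (cong₂ _+_ (sumL-zero (allSubsets k) (λ b → cong (λ c → if c then _ else 0) (∧-zeroʳ (suc (size b) ≤ℕ m)))) refl)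
       (trans (sumSubsets≡closed m m≤2 k U g) (same m)))
    where
    same : ∀ m → sumSubsets-closed m k U g ≡ sumSubsets-closed m (suc k) (false ∷ U) g
    same zero = refl
    same (suc zero) = refl
    same (suc (suc m)) = refl
  sumSubsets≡closed zero _ (suc k) (true ∷ U) g = trans (sumSubsets-∷ zero k true U g)
    (trans (cong (_+ sumSubsets zero k U (λ z → g (suc z))) (sumL-zero (allSubsets k) (λ b → refl)))
      (sumSubsets≡closed zero ℕ.z≤n k U (λ z → g (suc z))))
  sumSubsets≡closed (suc zero) _ (suc k) (true ∷ U) g = begin
    sumSubsets 1 (suc k) (true ∷ U) g ≡⟨ sumSubsets-∷ 1 k true U g ⟩
    sumL (allSubsets k) (λ b → if ((suc (size b) ≤ℕ 1) ∧ isSubsetOf b U) then g (size (diff U b)) else 0) + sumSubsets 1 k U (λ z → g (suc z))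
      ≡⟨ cong (_+ sumSubsets 1 k U (λ z → g (suc z))) (sumL-cong (allSubsets k) (λ b → cong (λ c → if (c ∧ isSubsetOf b U) then g (size (diff U b)) else 0) (≤ℕ-suc (size b) 0))) ⟩
    sumSubsets 0 k U g + sumSubsets 1 k U (λ z → g (suc z)) ≡⟨ cong₂ _+_ (sumSubsets≡closed 0 ℕ.z≤n k U g) (sumSubsets≡closed 1 (ℕ.s≤s ℕ.z≤n) k U (λ z → g (suc z))) ⟩
    g u + (g (suc u) + u * g (suc (u ∸ 1))) ≡⟨ cong (λ z → g u + (g (suc u) + z)) (*-suc∸1 u g) ⟩
    g u + (g (suc u) + u * g u) ≡⟨ solve 3 (λ a b u → a :+ (b :+ u :* a) := b :+ (con 1 :+ u) :* a) refl (g u) (g (suc u)) u ⟩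
    g (suc u) + suc u * g u ∎
    where
    open ≡-Reasoning
    open NSol.+-*-Solver
    u = size U
  sumSubsets≡closed (suc (suc zero)) _ (suc k) (true ∷ U) g = begin
    sumSubsets 2 (suc k) (true ∷ U) g ≡⟨ sumSubsets-∷ 2 k true U g ⟩
    sumL (allSubsets k) (λ b → if ((suc (size b) ≤ℕ 2) ∧ isSubsetOf b U) then g (size (diff U b)) else 0) + sumSubsets 2 k U (λ z → g (suc z))
      ≡⟨ cong (_+ sumSubsets 2 k U (λ z → g (suc z))) (sumL-cong (allSubsets k) (λ b → cong (λ c → if (c ∧ isSubsetOf b U) then g (size (diff U b)) else 0) (≤ℕ-suc (size b) 1))) ⟩
    sumSubsets 1 k U g + sumSubsets 2 k U (λ z → g (suc z)) ≡⟨ cong₂ _+_ (sumSubsets≡closed 1 (ℕ.s≤s ℕ.z≤n) k U g) (sumSubsets≡closed 2 ℕP.≤-refl k U (λ z → g (suc z))) ⟩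
    (g u + u * g (u ∸ 1)) + (g (suc u) + u * g (suc (u ∸ 1)) + choose₂ u * g (suc (u ∸ 2)))
      ≡⟨ cong₂ (λ y z → (g u + u * g (u ∸ 1)) + (g (suc u) + y + z)) (*-suc∸1 u g) (choose₂*-suc∸2 u g) ⟩
    (g u + u * g (u ∸ 1)) + (g (suc u) + u * g u + choose₂ u * g (u ∸ 1))
      ≡⟨ solve 5 (λ a b c u t → (a :+ u :* b) :+ (c :+ u :* a :+ t :* b) := c :+ (con 1 :+ u) :* a :+ (u :+ t) :* b) refl (g u) (g (u ∸ 1)) (g (suc u)) u (choose₂ u) ⟩
    g (suc u) + suc u * g u + (u + choose₂ u) * g (u ∸ 1) ∎
    where
    open ≡-Reasoning
    open NSol.+-*-Solver
    u = size U

  isBlock : ∀ {k} → Subset k → Bool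
  isBlock b = not (size b ==ℕ 0) ∧ (size b ≤ℕ 3)

  isSmallBlock : ∀ {k} → Subset k → Bool
  isSmallBlock b = size b ≤ℕ 2

  multiplicity : ∀ {k} → List (Subset k) → Fin k → ℕ
  multiplicity F i = countB (λ b → lookup b i) F

  covers : ∀ k → Subset k → List (Subset k) → Bool
  covers k U F = allFinB k (λ i → multiplicity F i ==ℕ 𝟙 (lookup U i))

  isPartitionOf : ℕ → ∀ k → Subset k → List (Subset k) → Bool
  isPartitionOf n k U F = (length F ==ℕ n) ∧ allB isBlock F ∧ covers k U F

  -- Partitioning an arbitrary subset U of Fin k, not just Fin k, lets the count recurse on the first element.
  partitionsOf : ℕ → ∀ k → Subset k → ℕ
  partitionsOf n k U = sumL (sublists (allSubsets k)) (λ F → 𝟙 (isPartitionOf n k U F))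

  allB-cong : ∀ {a} {A : Set a} (xs : List A) {p q : A → Bool} → (∀ x → p x ≡ q x) → allB p xs ≡ allB q xs
  allB-cong [] e = refl
  allB-cong (x ∷ xs) e = cong₂ _∧_ (e x) (allB-cong xs e)

  isBlock-∷-true : ∀ {k} (b : Subset k) → isBlock (true ∷ b) ≡ isSmallBlock b
  isBlock-∷-true b = cong₂ _∧_ (cong not (suc==ℕ0 (size b))) (≤ℕ-suc (size b) 2)

  isPartitionOf-split : ∀ n k u (U : Subset k) (A B : List (Subset k)) →
    isPartitionOf n (suc k) (u ∷ U) (map (true ∷_) A ++ map (false ∷_) B) ≡
    ((length A + length B) ==ℕ n) ∧ ((allB isSmallBlock A ∧ allB isBlock B) ∧ ((length A ==ℕ 𝟙 u) ∧ allFinB k (λ i → (multiplicity A i + multiplicity B i) ==ℕ 𝟙 (lookup U i))))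
  isPartitionOf-split n k u U A B = cong₂ _∧_ eL (cong₂ _∧_ eO (cong₂ _∧_ eZ eS))
    where
    L = map (true ∷_) A ++ map (false ∷_) B
    eL : (length L ==ℕ n) ≡ ((length A + length B) ==ℕ n)
    eL = cong (_==ℕ n) (trans (length-++ (map (true ∷_) A)) (cong₂ _+_ (length-map _ A) (length-map _ B)))
    eO : allB isBlock L ≡ (allB isSmallBlock A ∧ allB isBlock B)
    eO = trans (allB-++ isBlock (map (true ∷_) A) _)
           (cong₂ _∧_ (trans (allB-map isBlock (true ∷_) A) (allB-cong A isBlock-∷-true)) (allB-map isBlock (false ∷_) B))
    eZ : (multiplicity L Fin.zero ==ℕ 𝟙 u) ≡ (length A ==ℕ 𝟙 u)
    eZ = cong (_==ℕ 𝟙 u) (trans (countB-++ _ (map (true ∷_) A) _)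
           (trans (cong₂ _+_ (trans (countB-map _ (true ∷_) A) (countB-true A)) (trans (countB-map _ (false ∷_) B) (countB-false B)))
             (ℕP.+-identityʳ _)))
    eS : allFinB k (λ i → multiplicity L (Fin.suc i) ==ℕ 𝟙 (lookup U i)) ≡ allFinB k (λ i → (multiplicity A i + multiplicity B i) ==ℕ 𝟙 (lookup U i))
    eS = allFinB-cong k (λ i → cong (_==ℕ 𝟙 (lookup U i))
           (trans (countB-++ _ (map (true ∷_) A) _) (cong₂ _+_ (countB-map _ (true ∷_) A) (countB-map _ (false ∷_) B))))

  sizeTest : ∀ {k} → List (Subset k) → List (Subset k) → ℕ → Bool
  sizeTest A B n = (length A + length B) ==ℕ n

  blocksTest : ∀ {k} → List (Subset k) → List (Subset k) → Bool
  blocksTest A B = allB isSmallBlock A ∧ allB isBlock B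

  coverTest : ∀ k → Subset k → List (Subset k) → List (Subset k) → Bool
  coverTest k U A B = allFinB k (λ i → (multiplicity A i + multiplicity B i) ==ℕ 𝟙 (lookup U i))

  partitionsOf-split : ∀ n k u (U : Subset k) → partitionsOf n (suc k) (u ∷ U) ≡
    sumL (sublists (allSubsets k)) (λ A → sumL (sublists (allSubsets k)) (λ B → 𝟙 (isPartitionOf n (suc k) (u ∷ U) (map (true ∷_) A ++ map (false ∷_) B))))
  partitionsOf-split n k u U = begin
    sumL (sublists (map (true ∷_) S ++ map (false ∷_) S)) g
      ≡⟨ sublists-++ (map (true ∷_) S) (map (false ∷_) S) g ⟩
    sumL (sublists (map (true ∷_) S)) (λ a → sumL (sublists (map (false ∷_) S)) (λ b → g (a ++ b)))
      ≡⟨ sublists-map (true ∷_) S _ ⟩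
    sumL (sublists S) (λ A → sumL (sublists (map (false ∷_) S)) (λ b → g (map (true ∷_) A ++ b)))
      ≡⟨ sumL-cong (sublists S) (λ A → sublists-map (false ∷_) S (λ b → g (map (true ∷_) A ++ b))) ⟩
    sumL (sublists S) (λ A → sumL (sublists S) (λ B → g (map (true ∷_) A ++ map (false ∷_) B))) ∎
    where
    open ≡-Reasoning
    S = allSubsets k
    g = λ F → 𝟙 (isPartitionOf n (suc k) (u ∷ U) F)

  ∧-zero-inner : ∀ a b c → a ∧ (b ∧ (false ∧ c)) ≡ false
  ∧-zero-inner a b c = trans (cong (a ∧_) (∧-zeroʳ b)) (∧-zeroʳ a)

  partitionsOf-absent : ∀ n k (U : Subset k) → partitionsOf n (suc k) (false ∷ U) ≡ partitionsOf n k U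
  partitionsOf-absent n k U = trans (partitionsOf-split n k false U) (trans (sublists-onlyEmpty (allSubsets k) _ (λ y l → sumL-zero (sublists (allSubsets k))
    (λ B → trans (cong 𝟙 (isPartitionOf-split n k false U (y ∷ l) B))
      (cong 𝟙 (trans (cong (λ c → sizeTest (y ∷ l) B n ∧ (blocksTest (y ∷ l) B ∧ (c ∧ coverTest k U (y ∷ l) B))) (suc==ℕ0 (length l))) (∧-zero-inner (sizeTest (y ∷ l) B n) (blocksTest (y ∷ l) B) (coverTest k U (y ∷ l) B)))))))
    (sumL-cong (sublists (allSubsets k)) (λ B → cong 𝟙 (isPartitionOf-split n k false U [] B))))

  partitionsOf-noBlocks : ∀ k (U : Subset k) → partitionsOf 0 (suc k) (true ∷ U) ≡ 0
  partitionsOf-noBlocks k U = trans (partitionsOf-split 0 k true U) (sumL-zero (sublists (allSubsets k)) (λ A → sumL-zero (sublists (allSubsets k)) (λ B →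
    trans (cong 𝟙 (isPartitionOf-split 0 k true U A B)) (cong 𝟙 (noEmptyPartition A B)))))
    where
    noEmptyPartition : ∀ (A B : List (Subset k)) → ((length A + length B) ==ℕ 0) ∧ ((allB isSmallBlock A ∧ allB isBlock B) ∧ ((length A ==ℕ 1) ∧ allFinB k (λ i → (multiplicity A i + multiplicity B i) ==ℕ 𝟙 (lookup U i)))) ≡ false
    noEmptyPartition [] B = ∧-zero-inner (sizeTest [] B 0) (blocksTest [] B) (coverTest k U [] B)
    noEmptyPartition (y ∷ l) B = cong (λ c → c ∧ (blocksTest (y ∷ l) B ∧ ((length (y ∷ l) ==ℕ 1) ∧ coverTest k U (y ∷ l) B))) (suc==ℕ0 (length l + length B))

  covers-pointwise : ∀ x u c → (((if x then 1 else 0) + c) ==ℕ 𝟙 u) ≡ implies x u ∧ (c ==ℕ 𝟙 (u ∧ not x))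
  covers-pointwise true true c = ==ℕ-suc c 0
  covers-pointwise true false c = suc==ℕ0 c
  covers-pointwise false true c = refl
  covers-pointwise false false c = refl

  subB-allFinB : ∀ {k} (b U : Subset k) → allFinB k (λ i → implies (lookup b i) (lookup U i)) ≡ isSubsetOf b U
  subB-allFinB [] [] = refl
  subB-allFinB (x ∷ b) (u ∷ U) = cong (implies x u ∧_) (subB-allFinB b U)

  lookup-diff : ∀ {k} (U b : Subset k) i → lookup (diff U b) i ≡ lookup U i ∧ not (lookup b i)
  lookup-diff (u ∷ U) (x ∷ b) Fin.zero = refl
  lookup-diff (u ∷ U) (x ∷ b) (Fin.suc i) = lookup-diff U b i

  ∧-rearrange : ∀ x o oB s c → x ∧ ((o ∧ true) ∧ oB) ∧ (true ∧ (s ∧ c)) ≡ (o ∧ s) ∧ (x ∧ oB ∧ c)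
  ∧-rearrange true true true true c = refl
  ∧-rearrange true true true false c = refl
  ∧-rearrange true true false true c = refl
  ∧-rearrange true true false false c = refl
  ∧-rearrange true false oB s c = refl
  ∧-rearrange false true oB true c = refl
  ∧-rearrange false true oB false c = refl
  ∧-rearrange false false oB s c = refl

  partitionsOf-firstBlock : ∀ n k (U : Subset k) → partitionsOf (suc n) (suc k) (true ∷ U) ≡
    sumL (allSubsets k) (λ b → if (isSmallBlock b ∧ isSubsetOf b U) then partitionsOf n k (diff U b) else 0)
  partitionsOf-firstBlock n k U = trans (partitionsOf-split (suc n) k true U) (sublists-onlySingletons (allSubsets k) _ e0 e2 ∙ sumL-cong (allSubsets k) single)
    where
    _∙_ = trans
    S = allSubsets k
    inner = λ A → sumL (sublists S) (λ B → 𝟙 (isPartitionOf (suc n) (suc k) (true ∷ U) (map (true ∷_) A ++ map (false ∷_) B)))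
    e0 : inner [] ≡ 0
    e0 = sumL-zero (sublists S) (λ B → cong 𝟙 (isPartitionOf-split (suc n) k true U [] B ∙ ∧-zero-inner (sizeTest [] B (suc n)) (blocksTest [] B) (coverTest k U [] B)))
    e2 : ∀ y z l → inner (y ∷ z ∷ l) ≡ 0
    e2 y z l = sumL-zero (sublists S) (λ B → cong 𝟙 (isPartitionOf-split (suc n) k true U (y ∷ z ∷ l) B ∙
      (cong (λ c → sizeTest (y ∷ z ∷ l) B (suc n) ∧ (blocksTest (y ∷ z ∷ l) B ∧ (c ∧ coverTest k U (y ∷ z ∷ l) B))) (2+==ℕ1 (length l)) ∙ ∧-zero-inner (sizeTest (y ∷ z ∷ l) B (suc n)) (blocksTest (y ∷ z ∷ l) B) (coverTest k U (y ∷ z ∷ l) B))))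
    single : ∀ b → inner (b ∷ []) ≡ (if (isSmallBlock b ∧ isSubsetOf b U) then partitionsOf n k (diff U b) else 0)
    single b = sumL-cong (sublists S) (λ B → cong 𝟙 (isPartitionOf-split (suc n) k true U (b ∷ []) B ∙ bool B) ∙ ind-∧ (isSmallBlock b ∧ isSubsetOf b U) _)
        ∙ sumL-if (sublists S) (isSmallBlock b ∧ isSubsetOf b U) (λ B → 𝟙 (isPartitionOf n k (diff U b) B))
      where
      bool : ∀ B → ((1 + length B) ==ℕ suc n) ∧ (((isSmallBlock b ∧ true) ∧ allB isBlock B) ∧ ((1 ==ℕ 1) ∧ allFinB k (λ i → (multiplicity (b ∷ []) i + multiplicity B i) ==ℕ 𝟙 (lookup U i))))
                   ≡ (isSmallBlock b ∧ isSubsetOf b U) ∧ isPartitionOf n k (diff U b) B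
      bool B = cong₂ (λ p q → p ∧ (((isSmallBlock b ∧ true) ∧ allB isBlock B) ∧ (true ∧ q))) (==ℕ-suc (length B) n)
                   (allFinB-cong k (λ i → covers-pointwise (lookup b i) (lookup U i) (multiplicity B i))
                    ∙ (allFinB-∧ k (λ i → implies (lookup b i) (lookup U i)) (λ i → multiplicity B i ==ℕ 𝟙 (lookup U i ∧ not (lookup b i)))
                    ∙ cong₂ _∧_ (subB-allFinB b U) (allFinB-cong k (λ i → cong (λ z → multiplicity B i ==ℕ 𝟙 z) (sym (lookup-diff U b i))))))
               ∙ ∧-rearrange (length B ==ℕ n) (isSmallBlock b) (allB isBlock B) (isSubsetOf b U) (covers k (diff U b) B)

  partitionsOf≡parts : ∀ k n (U : Subset k) → partitionsOf n k U ≡ parts n (size U)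
  partitionsOf≡parts zero zero [] = refl
  partitionsOf≡parts zero (suc zero) [] = refl
  partitionsOf≡parts zero (suc (suc n)) [] = cong₂ _+_ (cong 𝟙 (cong (λ c → c ∧ ((isBlock {0} [] ∧ true) ∧ true)) (==ℕ-suc 0 (suc n) ∙ 0==ℕsuc n))) (cong₂ _+_ (cong 𝟙 (cong (λ c → c ∧ (true ∧ true)) (0==ℕsuc (suc n)))) refl)
    where _∙_ = trans
  partitionsOf≡parts (suc k) n (false ∷ U) = trans (partitionsOf-absent n k U) (partitionsOf≡parts k n U)
  partitionsOf≡parts (suc k) zero (true ∷ U) = partitionsOf-noBlocks k U
  partitionsOf≡parts (suc k) (suc n) (true ∷ U) = trans (partitionsOf-firstBlock n k U)
    (trans (sumL-cong (allSubsets k) (λ b → cong (λ z → if (isSmallBlock b ∧ isSubsetOf b U) then z else 0) (partitionsOf≡parts k n (diff U b))))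
      (sumSubsets≡closed 2 ℕP.≤-refl k U (parts n)))

  lookup-replicate-true : ∀ k (i : Fin k) → lookup (replicate k true) i ≡ true
  lookup-replicate-true (suc k) Fin.zero = refl
  lookup-replicate-true (suc k) (Fin.suc i) = lookup-replicate-true k i

  size-replicate-true : ∀ k → size (replicate k true) ≡ k
  size-replicate-true zero = refl
  size-replicate-true (suc k) = cong suc (size-replicate-true k)

  isE₂Partition≡isPartitionOf : ∀ n k F → isE₂Partition n k F ≡ isPartitionOf n k (replicate k true) F
  isE₂Partition≡isPartitionOf n k F = cong (λ z → (length F ==ℕ n) ∧ allB isBlock F ∧ z)
    (trans (allB-tabulate k (λ i → countB (λ b → lookup b i) F ==ℕ 1) (λ i → i))
      (allFinB-cong k (λ i → cong (λ z → multiplicity F i ==ℕ 𝟙 z) (sym (lookup-replicate-true k i)))))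

  E₂≡parts : ∀ n k → E₂ n k ≡ parts n k
  E₂≡parts n k = begin
    E₂ n k ≡⟨ length-filter (isE₂Partition n k) (sublists (allSubsets k)) ⟩
    countB (isE₂Partition n k) (sublists (allSubsets k)) ≡⟨ countB-sumL (isE₂Partition n k) (sublists (allSubsets k)) ⟩
    sumL (sublists (allSubsets k)) (λ F → 𝟙 (isE₂Partition n k F)) ≡⟨ sumL-cong (sublists (allSubsets k)) (λ F → cong 𝟙 (isE₂Partition≡isPartitionOf n k F)) ⟩
    partitionsOf n k (replicate k true) ≡⟨ partitionsOf≡parts k n (replicate k true) ⟩
    parts n (size (replicate k true)) ≡⟨ cong (parts n) (size-replicate-true k) ⟩
    parts n k ∎
    where open ≡-Reasoning


module NatRational where

  open import Defs
  open import Data.Nat as ℕ using (ℕ)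
  import Data.Nat.Properties as ℕP
  open import Data.Integer as ℤ using (ℤ; +_)
  import Data.Integer.Properties as ℤP
  open import Data.Rational as ℚ using (ℚ; mkℚ; 0ℚ; 1ℚ; ↥_; ↧_)
  open import Data.Rational.Properties as ℚP using ()
  import Data.Nat.Coprimality as C
  open import Relation.Binary.PropositionalEquality
  open import Relation.Nullary using (yes; no; ¬_)
  import Relation.Nullary
  open import Data.Empty using (⊥-elim)
  open import Data.Rational.Solver using (module +-*-Solver)

  ℕ→ℚ≡mkℚ : ∀ k → ℕ→ℚ k ≡ mkℚ (+ k) 0 (C.sym (C.1-coprimeTo k))
  ℕ→ℚ≡mkℚ k = ℚP.↥p/↧p≡p (mkℚ (+ k) 0 (C.sym (C.1-coprimeTo k)))

  ℕ→ℚ-+ : ∀ a b → ℕ→ℚ (a ℕ.+ b) ≡ ℕ→ℚ a ℚ.+ ℕ→ℚ b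
  ℕ→ℚ-+ a b = trans (ℚP./-cong {p₁ = + (a ℕ.+ b)} {q₁ = 1} {q₂ = 1}
      (trans (ℤP.pos-+ a b) (cong₂ ℤ._+_ (sym (ℤP.*-identityʳ (+ a))) (sym (ℤP.*-identityʳ (+ b))))) refl)
    (sym (cong₂ ℚ._+_ (ℕ→ℚ≡mkℚ a) (ℕ→ℚ≡mkℚ b)))

  ℕ→ℚ-* : ∀ a b → ℕ→ℚ (a ℕ.* b) ≡ ℕ→ℚ a ℚ.* ℕ→ℚ b
  ℕ→ℚ-* a b = trans (ℚP./-cong {p₁ = + (a ℕ.* b)} {q₁ = 1} {q₂ = 1} (ℤP.pos-* a b) refl)
    (sym (cong₂ ℚ._*_ (ℕ→ℚ≡mkℚ a) (ℕ→ℚ≡mkℚ b)))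

  inv₀-inverseˡ : ∀ x → ¬ x ≡ 0ℚ → inv₀ x ℚ.* x ≡ 1ℚ
  inv₀-inverseˡ x x≢0 with x ℚP.≟ 0ℚ
  ... | yes p = ⊥-elim (x≢0 p)
  ... | no ¬p = ℚP.*-inverseˡ x {{ℚ.≢-nonZero ¬p}}

  inv₀-inverseʳ : ∀ x → ¬ x ≡ 0ℚ → x ℚ.* inv₀ x ≡ 1ℚ
  inv₀-inverseʳ x x≢0 = trans (ℚP.*-comm x (inv₀ x)) (inv₀-inverseˡ x x≢0)

  inv₀-0 : ∀ x → x ≡ 0ℚ → inv₀ x ≡ 0ℚ
  inv₀-0 x refl = refl

  inv₀-unique : ∀ x y → ¬ x ≡ 0ℚ → x ℚ.* y ≡ 1ℚ → y ≡ inv₀ x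
  inv₀-unique x y x≢0 xy=1 = begin
    y ≡⟨ sym (ℚP.*-identityˡ y) ⟩
    1ℚ ℚ.* y ≡⟨ cong (ℚ._* y) (sym (inv₀-inverseˡ x x≢0)) ⟩
    (inv₀ x ℚ.* x) ℚ.* y ≡⟨ ℚP.*-assoc (inv₀ x) x y ⟩
    inv₀ x ℚ.* (x ℚ.* y) ≡⟨ cong (inv₀ x ℚ.*_) xy=1 ⟩
    inv₀ x ℚ.* 1ℚ ≡⟨ ℚP.*-identityʳ (inv₀ x) ⟩
    inv₀ x ∎
    where open ≡-Reasoning

  *-nonZero : ∀ x y → ¬ x ≡ 0ℚ → ¬ y ≡ 0ℚ → ¬ (x ℚ.* y) ≡ 0ℚ
  *-nonZero x y x≢0 y≢0 xy=0 = y≢0 (begin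
    y ≡⟨ sym (ℚP.*-identityˡ y) ⟩
    1ℚ ℚ.* y ≡⟨ cong (ℚ._* y) (sym (inv₀-inverseˡ x x≢0)) ⟩
    (inv₀ x ℚ.* x) ℚ.* y ≡⟨ ℚP.*-assoc (inv₀ x) x y ⟩
    inv₀ x ℚ.* (x ℚ.* y) ≡⟨ cong (inv₀ x ℚ.*_) xy=0 ⟩
    inv₀ x ℚ.* 0ℚ ≡⟨ ℚP.*-zeroʳ (inv₀ x) ⟩
    0ℚ ∎)
    where open ≡-Reasoning

  inv₀-* : ∀ x y → inv₀ (x ℚ.* y) ≡ inv₀ x ℚ.* inv₀ y
  inv₀-* x y = go (x ℚP.≟ 0ℚ) (y ℚP.≟ 0ℚ)
    where
    open +-*-Solver
    go : Relation.Nullary.Dec (x ≡ 0ℚ) → Relation.Nullary.Dec (y ≡ 0ℚ) → inv₀ (x ℚ.* y) ≡ inv₀ x ℚ.* inv₀ y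
    go (yes x0) _ = trans (inv₀-0 (x ℚ.* y) (trans (cong (ℚ._* y) x0) (ℚP.*-zeroˡ y)))
       (sym (trans (cong (ℚ._* inv₀ y) (inv₀-0 x x0)) (ℚP.*-zeroˡ (inv₀ y))))
    go (no _) (yes y0) = trans (inv₀-0 (x ℚ.* y) (trans (cong (x ℚ.*_) y0) (ℚP.*-zeroʳ x)))
       (sym (trans (cong (inv₀ x ℚ.*_) (inv₀-0 y y0)) (ℚP.*-zeroʳ (inv₀ x))))
    go (no x≢0) (no y≢0) = sym (inv₀-unique (x ℚ.* y) (inv₀ x ℚ.* inv₀ y) (*-nonZero x y x≢0 y≢0) eq)
      where
      eq : (x ℚ.* y) ℚ.* (inv₀ x ℚ.* inv₀ y) ≡ 1ℚ
      eq = begin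
        (x ℚ.* y) ℚ.* (inv₀ x ℚ.* inv₀ y) ≡⟨ solve 4 (λ a b c d → (a :* b) :* (c :* d) := (a :* c) :* (b :* d)) refl x y (inv₀ x) (inv₀ y) ⟩
        (x ℚ.* inv₀ x) ℚ.* (y ℚ.* inv₀ y) ≡⟨ cong₂ ℚ._*_ (inv₀-inverseʳ x x≢0) (inv₀-inverseʳ y y≢0) ⟩
        1ℚ ∎
        where open ≡-Reasoning

  inv₀-involutive : ∀ x → inv₀ (inv₀ x) ≡ x
  inv₀-involutive x = go (x ℚP.≟ 0ℚ)
    where
    go : Relation.Nullary.Dec (x ≡ 0ℚ) → inv₀ (inv₀ x) ≡ x
    go (yes x0) = trans (inv₀-0 (inv₀ x) (inv₀-0 x x0)) (sym x0)
    go (no x≢0) = sym (inv₀-unique (inv₀ x) x ix≢0 (inv₀-inverseˡ x x≢0))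
      where
      ix≢0 : ¬ inv₀ x ≡ 0ℚ
      ix≢0 e = ℚP.1≢0 (trans (sym (inv₀-inverseˡ x x≢0)) (trans (cong (ℚ._* x) e) (ℚP.*-zeroˡ x)))

  ℕ→ℚ≡0⇒≡0 : ∀ a → ℕ→ℚ a ≡ 0ℚ → a ≡ 0
  ℕ→ℚ≡0⇒≡0 a e = ℤP.+-injective (cong ↥_ (trans (sym (ℕ→ℚ≡mkℚ a)) e))

  ℕ→ℚ-nonZero : ∀ a → ¬ a ≡ 0 → ¬ ℕ→ℚ a ≡ 0ℚ
  ℕ→ℚ-nonZero a a≢0 e = a≢0 (ℕ→ℚ≡0⇒≡0 a e)

  /ℕ-* : ∀ a b c d → (a /ℕ b) ℚ.* (c /ℕ d) ≡ (a ℕ.* c) /ℕ (b ℕ.* d)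
  /ℕ-* a b c d = begin
    (ℕ→ℚ a ℚ.* inv₀ (ℕ→ℚ b)) ℚ.* (ℕ→ℚ c ℚ.* inv₀ (ℕ→ℚ d))
      ≡⟨ solve 4 (λ p q r s → (p :* q) :* (r :* s) := (p :* r) :* (q :* s)) refl (ℕ→ℚ a) (inv₀ (ℕ→ℚ b)) (ℕ→ℚ c) (inv₀ (ℕ→ℚ d)) ⟩
    (ℕ→ℚ a ℚ.* ℕ→ℚ c) ℚ.* (inv₀ (ℕ→ℚ b) ℚ.* inv₀ (ℕ→ℚ d))
      ≡⟨ cong₂ ℚ._*_ (sym (ℕ→ℚ-* a c)) (sym (trans (cong inv₀ (ℕ→ℚ-* b d)) (inv₀-* (ℕ→ℚ b) (ℕ→ℚ d)))) ⟩
    ℕ→ℚ (a ℕ.* c) ℚ.* inv₀ (ℕ→ℚ (b ℕ.* d)) ∎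
    where open ≡-Reasoning
          open +-*-Solver

  /ℕ-self : ∀ d → ¬ d ≡ 0 → d /ℕ d ≡ 1ℚ
  /ℕ-self d d≢0 = inv₀-inverseʳ (ℕ→ℚ d) (ℕ→ℚ-nonZero d d≢0)

  /ℕ-cancelʳ : ∀ a b d → ¬ d ≡ 0 → (a ℕ.* d) /ℕ (b ℕ.* d) ≡ a /ℕ b
  /ℕ-cancelʳ a b d d≢0 = begin
    (a ℕ.* d) /ℕ (b ℕ.* d) ≡⟨ sym (/ℕ-* a b d d) ⟩
    (a /ℕ b) ℚ.* (d /ℕ d) ≡⟨ cong ((a /ℕ b) ℚ.*_) (/ℕ-self d d≢0) ⟩
    (a /ℕ b) ℚ.* 1ℚ ≡⟨ ℚP.*-identityʳ _ ⟩
    a /ℕ b ∎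
    where open ≡-Reasoning

  /ℕ-cross : ∀ a b c d → ¬ b ≡ 0 → ¬ d ≡ 0 → a ℕ.* d ≡ c ℕ.* b → a /ℕ b ≡ c /ℕ d
  /ℕ-cross a b c d b≢0 d≢0 e = begin
    a /ℕ b ≡⟨ sym (/ℕ-cancelʳ a b d d≢0) ⟩
    (a ℕ.* d) /ℕ (b ℕ.* d) ≡⟨ cong₂ _/ℕ_ e (ℕP.*-comm b d) ⟩
    (c ℕ.* b) /ℕ (d ℕ.* b) ≡⟨ /ℕ-cancelʳ c d b b≢0 ⟩
    c /ℕ d ∎
    where open ≡-Reasoning

  inv₀-/ℕ : ∀ a b → inv₀ (a /ℕ b) ≡ b /ℕ a
  inv₀-/ℕ a b = trans (inv₀-* (ℕ→ℚ a) (inv₀ (ℕ→ℚ b)))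
    (trans (cong (inv₀ (ℕ→ℚ a) ℚ.*_) (inv₀-involutive (ℕ→ℚ b))) (ℚP.*-comm (inv₀ (ℕ→ℚ a)) (ℕ→ℚ b)))

  ℕ→ℚ≡/ℕ1 : ∀ a → ℕ→ℚ a ≡ a /ℕ 1
  ℕ→ℚ≡/ℕ1 a = sym (ℚP.*-identityʳ (ℕ→ℚ a))


module HalfHypergeometric where

  open import Defs
  open NatRational
  open BoundedPartitions
  open import Data.Nat as ℕ using (ℕ; zero; suc; _!; _^_)
  import Data.Nat.Properties as ℕP
  import Data.Nat.Solver as NSol
  open import Data.Integer using (+_)
  open import Data.Rational as ℚ using (ℚ; 0ℚ; 1ℚ; _/_; -_)
  import Data.Rational.Properties as ℚP
  open import Data.Rational.Solver using (module +-*-Solver)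
  open import Data.Sum using (inj₁; inj₂)
  open import Data.Product using (_,_)
  open import Relation.Binary.PropositionalEquality
  open import Relation.Nullary using (¬_; yes; no)

  ½ : ℚ
  ½ = + 1 / 2

  ½*½ : ½ ℚ.* ½ ≡ inv₀ (ℕ→ℚ 4)
  ½*½ = refl

  ½+½ : ½ ℚ.+ ½ ≡ 1ℚ
  ½+½ = refl

  ≡*[½+½] : ∀ x → x ≡ x ℚ.* (½ ℚ.+ ½)
  ≡*[½+½] x = sym (trans (cong (x ℚ.*_) ½+½) (ℚP.*-identityʳ x))

  halfShift-product : ∀ j e → (- (ℕ→ℚ (j ℕ.+ j ℕ.+ suc e) ℚ.* ½) ℚ.+ ℕ→ℚ j) ℚ.* ((- (ℕ→ℚ (j ℕ.+ j ℕ.+ suc e) ℚ.* ½) ℚ.+ ½) ℚ.+ ℕ→ℚ j)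
             ≡ (suc e ℕ.* e) /ℕ 4
  halfShift-product j e = begin
    (- (D' ℚ.* ½) ℚ.+ x) ℚ.* ((- (D' ℚ.* ½) ℚ.+ ½) ℚ.+ x)
      ≡⟨ cong₂ (λ p q → (- (p ℚ.* ½) ℚ.+ q) ℚ.* ((- (p ℚ.* ½) ℚ.+ ½) ℚ.+ q)) eD (≡*[½+½] x) ⟩
    (- ((x ℚ.+ x ℚ.+ (1ℚ ℚ.+ y)) ℚ.* ½) ℚ.+ x ℚ.* (½ ℚ.+ ½)) ℚ.* ((- ((x ℚ.+ x ℚ.+ (1ℚ ℚ.+ y)) ℚ.* ½) ℚ.+ ½) ℚ.+ x ℚ.* (½ ℚ.+ ½))
      ≡⟨ solve 3 (λ x y ½ → (:- ((x :+ x :+ (con 1ℚ :+ y)) :* ½) :+ x :* (½ :+ ½)) :* ((:- ((x :+ x :+ (con 1ℚ :+ y)) :* ½) :+ ½) :+ x :* (½ :+ ½))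
                  := ((con 1ℚ :+ y) :* y) :* (½ :* ½)) refl x y ½ ⟩
    ((1ℚ ℚ.+ y) ℚ.* y) ℚ.* (½ ℚ.* ½)
      ≡⟨ cong₂ ℚ._*_ (trans (cong (ℚ._* y) (sym (ℕ→ℚ-+ 1 e))) (sym (ℕ→ℚ-* (suc e) e))) ½*½ ⟩
    (suc e ℕ.* e) /ℕ 4 ∎
    where
    open ≡-Reasoning
    open +-*-Solver
    x = ℕ→ℚ j
    y = ℕ→ℚ e
    D' = ℕ→ℚ (j ℕ.+ j ℕ.+ suc e)
    eD : D' ≡ x ℚ.+ x ℚ.+ (1ℚ ℚ.+ y)
    eD = trans (ℕ→ℚ-+ (j ℕ.+ j) (suc e)) (cong₂ ℚ._+_ (ℕ→ℚ-+ j j) (ℕ→ℚ-+ 1 e))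

  halfShift-zero : ∀ j → - (ℕ→ℚ (j ℕ.+ j) ℚ.* ½) ℚ.+ ℕ→ℚ j ≡ 0ℚ
  halfShift-zero j = begin
    - (ℕ→ℚ (j ℕ.+ j) ℚ.* ½) ℚ.+ x ≡⟨ cong₂ (λ p q → - (p ℚ.* ½) ℚ.+ q) (ℕ→ℚ-+ j j) (≡*[½+½] x) ⟩
    - ((x ℚ.+ x) ℚ.* ½) ℚ.+ x ℚ.* (½ ℚ.+ ½) ≡⟨ solve 2 (λ x ½ → :- ((x :+ x) :* ½) :+ x :* (½ :+ ½) := con 0ℚ) refl x ½ ⟩
    0ℚ ∎
    where
    open ≡-Reasoning
    open +-*-Solver
    x = ℕ→ℚ j

  -- D (D − 1) ⋯ (D − 2j + 1), which is 4^j (−D/2)_j (−D/2 + ½)_j by poch-halves.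
  fallingPairs : ℕ → ℕ → ℕ
  fallingPairs D zero = 1
  fallingPairs D (suc j) = fallingPairs D j ℕ.* ((D ℕ.∸ (j ℕ.+ j)) ℕ.* (D ℕ.∸ suc (j ℕ.+ j)))

  fallingPairs-vanishes : ∀ D j → D ℕ.< j ℕ.+ j → fallingPairs D j ≡ 0
  fallingPairs-vanishes D zero ()
  fallingPairs-vanishes D (suc j) lt = begin
    fallingPairs D j ℕ.* ((D ℕ.∸ (j ℕ.+ j)) ℕ.* (D ℕ.∸ suc (j ℕ.+ j)))
      ≡⟨ cong (λ z → fallingPairs D j ℕ.* ((D ℕ.∸ (j ℕ.+ j)) ℕ.* z)) (ℕP.m≤n⇒m∸n≡0 le) ⟩
    fallingPairs D j ℕ.* ((D ℕ.∸ (j ℕ.+ j)) ℕ.* 0) ≡⟨ cong (fallingPairs D j ℕ.*_) (ℕP.*-zeroʳ (D ℕ.∸ (j ℕ.+ j))) ⟩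
    fallingPairs D j ℕ.* 0 ≡⟨ ℕP.*-zeroʳ (fallingPairs D j) ⟩
    0 ∎
    where
    open ≡-Reasoning
    le : D ℕ.≤ suc (j ℕ.+ j)
    le = ℕP.≤-pred (ℕP.≤-trans lt (ℕP.≤-reflexive (cong suc (ℕP.+-suc j j))))

  0/ℕ : ∀ b → 0 /ℕ b ≡ 0ℚ
  0/ℕ b = ℚP.*-zeroˡ (inv₀ (ℕ→ℚ b))

  poch-halves : ∀ D j → poch (- (ℕ→ℚ D ℚ.* ½)) j ℚ.* poch (- (ℕ→ℚ D ℚ.* ½) ℚ.+ ½) j ≡ fallingPairs D j /ℕ (4 ℕ.^ j)
  poch-halves D zero = refl
  poch-halves D (suc j) = begin
    (poch a j ℚ.* (a ℚ.+ x)) ℚ.* (poch b j ℚ.* (b ℚ.+ x))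
      ≡⟨ solve 4 (λ p q r s → (p :* q) :* (r :* s) := (p :* r) :* (q :* s)) refl (poch a j) (a ℚ.+ x) (poch b j) (b ℚ.+ x) ⟩
    (poch a j ℚ.* poch b j) ℚ.* ((a ℚ.+ x) ℚ.* (b ℚ.+ x))
      ≡⟨ cong (ℚ._* ((a ℚ.+ x) ℚ.* (b ℚ.+ x))) (poch-halves D j) ⟩
    (fallingPairs D j /ℕ (4 ℕ.^ j)) ℚ.* ((a ℚ.+ x) ℚ.* (b ℚ.+ x))
      ≡⟨ stepP (ℕ.<-cmp D (j ℕ.+ j)) ⟩
    fallingPairs D (suc j) /ℕ (4 ℕ.^ suc j) ∎
    where
    open ≡-Reasoning
    open +-*-Solver
    open import Relation.Binary.Definitions using (Tri; tri<; tri≈; tri>)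
    a = - (ℕ→ℚ D ℚ.* ½)
    b = - (ℕ→ℚ D ℚ.* ½) ℚ.+ ½
    x = ℕ→ℚ j
    stepP : Tri (D ℕ.< j ℕ.+ j) (D ≡ j ℕ.+ j) (j ℕ.+ j ℕ.< D) →
      (fallingPairs D j /ℕ (4 ℕ.^ j)) ℚ.* ((a ℚ.+ x) ℚ.* (b ℚ.+ x)) ≡ fallingPairs D (suc j) /ℕ (4 ℕ.^ suc j)
    stepP (tri< lt _ _) = begin
      (fallingPairs D j /ℕ (4 ℕ.^ j)) ℚ.* ((a ℚ.+ x) ℚ.* (b ℚ.+ x))
        ≡⟨ cong (λ z → (z /ℕ (4 ℕ.^ j)) ℚ.* ((a ℚ.+ x) ℚ.* (b ℚ.+ x))) (fallingPairs-vanishes D j lt) ⟩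
      (0 /ℕ (4 ℕ.^ j)) ℚ.* ((a ℚ.+ x) ℚ.* (b ℚ.+ x))
        ≡⟨ cong (ℚ._* ((a ℚ.+ x) ℚ.* (b ℚ.+ x))) (0/ℕ (4 ℕ.^ j)) ⟩
      0ℚ ℚ.* ((a ℚ.+ x) ℚ.* (b ℚ.+ x)) ≡⟨ ℚP.*-zeroˡ ((a ℚ.+ x) ℚ.* (b ℚ.+ x)) ⟩
      0ℚ ≡⟨ sym (0/ℕ (4 ℕ.^ suc j)) ⟩
      0 /ℕ (4 ℕ.^ suc j) ≡⟨ cong (λ z → (z ℕ.* ((D ℕ.∸ (j ℕ.+ j)) ℕ.* (D ℕ.∸ suc (j ℕ.+ j)))) /ℕ (4 ℕ.^ suc j)) (sym (fallingPairs-vanishes D j lt)) ⟩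
      fallingPairs D (suc j) /ℕ (4 ℕ.^ suc j) ∎
    stepP (tri≈ _ refl _) = begin
      (fallingPairs D j /ℕ (4 ℕ.^ j)) ℚ.* ((a ℚ.+ x) ℚ.* (b ℚ.+ x))
        ≡⟨ cong (λ z → (fallingPairs D j /ℕ (4 ℕ.^ j)) ℚ.* (z ℚ.* (b ℚ.+ x))) (halfShift-zero j) ⟩
      (fallingPairs D j /ℕ (4 ℕ.^ j)) ℚ.* (0ℚ ℚ.* (b ℚ.+ x))
        ≡⟨ trans (cong ((fallingPairs D j /ℕ (4 ℕ.^ j)) ℚ.*_) (ℚP.*-zeroˡ (b ℚ.+ x))) (ℚP.*-zeroʳ (fallingPairs D j /ℕ (4 ℕ.^ j))) ⟩
      0ℚ ≡⟨ sym (0/ℕ (4 ℕ.^ suc j)) ⟩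
      0 /ℕ (4 ℕ.^ suc j) ≡⟨ cong (_/ℕ (4 ℕ.^ suc j)) (sym (trans (cong (λ z → fallingPairs D j ℕ.* (z ℕ.* (D ℕ.∸ suc (j ℕ.+ j)))) (ℕP.n∸n≡0 (j ℕ.+ j))) (ℕP.*-zeroʳ (fallingPairs D j)))) ⟩
      fallingPairs D (suc j) /ℕ (4 ℕ.^ suc j) ∎
    stepP (tri> _ _ gt) = go (D ℕ.∸ suc (j ℕ.+ j)) (sym (trans (ℕP.+-suc (j ℕ.+ j) _) (ℕP.m+[n∸m]≡n gt)))
      where
      go : ∀ e → D ≡ j ℕ.+ j ℕ.+ suc e → (fallingPairs D j /ℕ (4 ℕ.^ j)) ℚ.* ((a ℚ.+ x) ℚ.* (b ℚ.+ x)) ≡ fallingPairs D (suc j) /ℕ (4 ℕ.^ suc j)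
      go e refl = begin
        (fallingPairs D j /ℕ (4 ℕ.^ j)) ℚ.* ((a ℚ.+ x) ℚ.* (b ℚ.+ x)) ≡⟨ cong ((fallingPairs D j /ℕ (4 ℕ.^ j)) ℚ.*_) (halfShift-product j e) ⟩
        (fallingPairs D j /ℕ (4 ℕ.^ j)) ℚ.* ((suc e ℕ.* e) /ℕ 4) ≡⟨ /ℕ-* (fallingPairs D j) (4 ℕ.^ j) (suc e ℕ.* e) 4 ⟩
        (fallingPairs D j ℕ.* (suc e ℕ.* e)) /ℕ (4 ℕ.^ j ℕ.* 4)
          ≡⟨ cong₂ _/ℕ_ (cong (fallingPairs D j ℕ.*_) (sym (cong₂ ℕ._*_ (ℕP.m+n∸m≡n (j ℕ.+ j) (suc e)) (trans (cong (ℕ._∸ suc (j ℕ.+ j)) (ℕP.+-suc (j ℕ.+ j) e)) (ℕP.m+n∸m≡n (j ℕ.+ j) e))))) (ℕP.*-comm (4 ℕ.^ j) 4) ⟩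
        fallingPairs D (suc j) /ℕ (4 ℕ.^ suc j) ∎

  !≢0 : ∀ n → ¬ (n ! ≡ 0)
  !≢0 n e = ℕ.≢-nonZero⁻¹ (n !) {{ℕP._!≢0 n}} e

  ^≢0 : ∀ a l → ¬ a ≡ 0 → ¬ (a ^ l ≡ 0)
  ^≢0 a zero a≢0 ()
  ^≢0 a (suc l) a≢0 e with ℕP.m*n≡0⇒m≡0∨n≡0 a e
  ... | inj₁ x = a≢0 x
  ... | inj₂ y = ^≢0 a l a≢0 y

  *≢0 : ∀ a b → ¬ a ≡ 0 → ¬ b ≡ 0 → ¬ (a ℕ.* b ≡ 0)
  *≢0 a b a0 b0 e with ℕP.m*n≡0⇒m≡0∨n≡0 a e
  ... | inj₁ x = a0 x
  ... | inj₂ y = b0 y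

  poch-ℕ : ∀ c0 l → poch (ℕ→ℚ (c0 ℕ.+ 1)) l ≡ ((c0 ℕ.+ l) !) /ℕ (c0 !)
  poch-ℕ c0 zero = sym (trans (cong (λ z → (z !) /ℕ (c0 !)) (ℕP.+-identityʳ c0)) (/ℕ-self (c0 !) (!≢0 c0)))
  poch-ℕ c0 (suc l) = begin
    poch c l ℚ.* (c ℚ.+ ℕ→ℚ l) ≡⟨ cong₂ ℚ._*_ (poch-ℕ c0 l) (trans (sym (ℕ→ℚ-+ (c0 ℕ.+ 1) l)) (ℕ→ℚ≡/ℕ1 (c0 ℕ.+ 1 ℕ.+ l))) ⟩
    ((c0 ℕ.+ l) !) /ℕ (c0 !) ℚ.* ((c0 ℕ.+ 1 ℕ.+ l) /ℕ 1) ≡⟨ /ℕ-* ((c0 ℕ.+ l) !) (c0 !) (c0 ℕ.+ 1 ℕ.+ l) 1 ⟩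
    ((c0 ℕ.+ l) ! ℕ.* (c0 ℕ.+ 1 ℕ.+ l)) /ℕ (c0 ! ℕ.* 1) ≡⟨ cong₂ _/ℕ_ e1 (ℕP.*-identityʳ (c0 !)) ⟩
    ((c0 ℕ.+ suc l) !) /ℕ (c0 !) ∎
    where
    open ≡-Reasoning
    c = ℕ→ℚ (c0 ℕ.+ 1)
    e1 : (c0 ℕ.+ l) ! ℕ.* (c0 ℕ.+ 1 ℕ.+ l) ≡ (c0 ℕ.+ suc l) !
    e1 = begin
      (c0 ℕ.+ l) ! ℕ.* (c0 ℕ.+ 1 ℕ.+ l) ≡⟨ ℕP.*-comm ((c0 ℕ.+ l) !) (c0 ℕ.+ 1 ℕ.+ l) ⟩
      (c0 ℕ.+ 1 ℕ.+ l) ℕ.* (c0 ℕ.+ l) ! ≡⟨ cong (λ z → z ℕ.* (c0 ℕ.+ l) !) (trans (ℕP.+-assoc c0 1 l) (ℕP.+-suc c0 l)) ⟩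
      suc (c0 ℕ.+ l) ℕ.* (c0 ℕ.+ l) ! ≡⟨ cong _! (sym (ℕP.+-suc c0 l)) ⟩
      (c0 ℕ.+ suc l) ! ∎

  [8/3]^ℚ : ∀ l → (8 /ℕ 3) ^ℚ l ≡ (8 ^ l) /ℕ (3 ^ l)
  [8/3]^ℚ zero = refl
  [8/3]^ℚ (suc l) = trans (cong ((8 /ℕ 3) ℚ.*_) ([8/3]^ℚ l)) (/ℕ-* 8 3 (8 ^ l) (3 ^ l))

  hypTerm-halves : ∀ D c0 l → hypTerm (- (ℕ→ℚ D ℚ.* ½)) (- (ℕ→ℚ D ℚ.* ½) ℚ.+ ½) (ℕ→ℚ (c0 ℕ.+ 1)) (+ 8 / 3) l
         ≡ (fallingPairs D l ℕ.* (c0 ! ℕ.* 1) ℕ.* 8 ^ l) /ℕ (4 ^ l ℕ.* ((c0 ℕ.+ l) ! ℕ.* l !) ℕ.* 3 ^ l)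
  hypTerm-halves D c0 l = begin
    (poch a l ℚ.* poch b l) ℚ.* inv₀ (poch c l ℚ.* ℕ→ℚ (l !)) ℚ.* ((+ 8 / 3) ^ℚ l)
      ≡⟨ cong₂ (λ p q → p ℚ.* inv₀ q ℚ.* ((8 /ℕ 3) ^ℚ l)) (poch-halves D l) (cong₂ ℚ._*_ (poch-ℕ c0 l) (ℕ→ℚ≡/ℕ1 (l !))) ⟩
    (fallingPairs D l /ℕ (4 ^ l)) ℚ.* inv₀ (((c0 ℕ.+ l) !) /ℕ (c0 !) ℚ.* ((l !) /ℕ 1)) ℚ.* ((8 /ℕ 3) ^ℚ l)
      ≡⟨ cong₂ (λ p q → (fallingPairs D l /ℕ (4 ^ l)) ℚ.* inv₀ p ℚ.* q) (/ℕ-* ((c0 ℕ.+ l) !) (c0 !) (l !) 1) ([8/3]^ℚ l) ⟩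
    (fallingPairs D l /ℕ (4 ^ l)) ℚ.* inv₀ (((c0 ℕ.+ l) ! ℕ.* l !) /ℕ (c0 ! ℕ.* 1)) ℚ.* ((8 ^ l) /ℕ (3 ^ l))
      ≡⟨ cong (λ p → (fallingPairs D l /ℕ (4 ^ l)) ℚ.* p ℚ.* ((8 ^ l) /ℕ (3 ^ l))) (inv₀-/ℕ ((c0 ℕ.+ l) ! ℕ.* l !) (c0 ! ℕ.* 1)) ⟩
    (fallingPairs D l /ℕ (4 ^ l)) ℚ.* ((c0 ! ℕ.* 1) /ℕ ((c0 ℕ.+ l) ! ℕ.* l !)) ℚ.* ((8 ^ l) /ℕ (3 ^ l))
      ≡⟨ cong (ℚ._* ((8 ^ l) /ℕ (3 ^ l))) (/ℕ-* (fallingPairs D l) (4 ^ l) (c0 ! ℕ.* 1) ((c0 ℕ.+ l) ! ℕ.* l !)) ⟩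
    ((fallingPairs D l ℕ.* (c0 ! ℕ.* 1)) /ℕ (4 ^ l ℕ.* ((c0 ℕ.+ l) ! ℕ.* l !))) ℚ.* ((8 ^ l) /ℕ (3 ^ l))
      ≡⟨ /ℕ-* (fallingPairs D l ℕ.* (c0 ! ℕ.* 1)) (4 ^ l ℕ.* ((c0 ℕ.+ l) ! ℕ.* l !)) (8 ^ l) (3 ^ l) ⟩
    (fallingPairs D l ℕ.* (c0 ! ℕ.* 1) ℕ.* 8 ^ l) /ℕ (4 ^ l ℕ.* ((c0 ℕ.+ l) ! ℕ.* l !) ℕ.* 3 ^ l) ∎
    where
    open ≡-Reasoning
    a = - (ℕ→ℚ D ℚ.* ½)
    b = - (ℕ→ℚ D ℚ.* ½) ℚ.+ ½
    c = ℕ→ℚ (c0 ℕ.+ 1)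

  fallingPairs-*-! : ∀ l e → fallingPairs (l ℕ.+ l ℕ.+ e) l ℕ.* e ! ≡ (l ℕ.+ l ℕ.+ e) !
  fallingPairs-*-! zero e = ℕP.+-identityʳ (e !)
  fallingPairs-*-! (suc l) e = begin
    fallingPairs DD l ℕ.* ((DD ℕ.∸ (l ℕ.+ l)) ℕ.* (DD ℕ.∸ suc (l ℕ.+ l))) ℕ.* e !
      ≡⟨ cong (λ z → fallingPairs z l ℕ.* ((z ℕ.∸ (l ℕ.+ l)) ℕ.* (z ℕ.∸ suc (l ℕ.+ l))) ℕ.* e !) eD ⟩
    fallingPairs DD' l ℕ.* ((DD' ℕ.∸ (l ℕ.+ l)) ℕ.* (DD' ℕ.∸ suc (l ℕ.+ l))) ℕ.* e !
      ≡⟨ cong (λ z → fallingPairs DD' l ℕ.* z ℕ.* e !) (cong₂ ℕ._*_ (ℕP.m+n∸m≡n (l ℕ.+ l) (suc (suc e))) (trans (cong (ℕ._∸ suc (l ℕ.+ l)) (ℕP.+-suc (l ℕ.+ l) (suc e))) (ℕP.m+n∸m≡n (l ℕ.+ l) (suc e)))) ⟩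
    fallingPairs DD' l ℕ.* (suc (suc e) ℕ.* suc e) ℕ.* e !
      ≡⟨ trans (ℕP.*-assoc (fallingPairs DD' l) _ (e !)) (cong (fallingPairs DD' l ℕ.*_) (ℕP.*-assoc (suc (suc e)) (suc e) (e !))) ⟩
    fallingPairs DD' l ℕ.* (suc (suc e)) !
      ≡⟨ fallingPairs-*-! l (suc (suc e)) ⟩
    DD' ! ≡⟨ cong _! (sym eD) ⟩
    DD ! ∎
    where
    open ≡-Reasoning
    DD = suc l ℕ.+ suc l ℕ.+ e
    DD' = l ℕ.+ l ℕ.+ suc (suc e)
    eD : DD ≡ DD'
    eD = solve 2 (λ l e → (con 1 :+ l) :+ (con 1 :+ l) :+ e := l :+ l :+ (con 2 :+ e)) refl l e
      where open NSol.+-*-Solver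

  ^-distribʳ-* : ∀ a b l → (a ℕ.* b) ^ l ≡ a ^ l ℕ.* b ^ l
  ^-distribʳ-* a b zero = refl
  ^-distribʳ-* a b (suc l) = trans (cong ((a ℕ.* b) ℕ.*_) (^-distribʳ-* a b l))
    (solve 4 (λ a b x y → (a :* b) :* (x :* y) := (a :* x) :* (b :* y)) refl a b (a ^ l) (b ^ l))
    where open NSol.+-*-Solver

  2^[l+l]≡4^l : ∀ l → 2 ^ (l ℕ.+ l) ≡ 4 ^ l
  2^[l+l]≡4^l l = trans (ℕP.^-distribˡ-+-* 2 l l) (sym (^-distribʳ-* 2 2 l))

  4^l*4^l*3^l≡8^l*6^l : ∀ l → 4 ^ l ℕ.* 4 ^ l ℕ.* 3 ^ l ≡ 8 ^ l ℕ.* 6 ^ l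
  4^l*4^l*3^l≡8^l*6^l l = trans (cong (ℕ._* 3 ^ l) (sym (^-distribʳ-* 4 4 l))) (trans (sym (^-distribʳ-* 16 3 l)) (^-distribʳ-* 8 6 l))

  suc^≢0 : ∀ a l → ¬ (suc a) ^ l ≡ 0
  suc^≢0 a l = ^≢0 (suc a) l (λ ())

  smallCoefficient : ℕ → ℕ → ℚ
  smallCoefficient n η = (n ℕ.+ η) ! /ℕ (η ! ℕ.* (n ℕ.∸ η) ! ℕ.* 2 ^ η)

  smallSummand : ℕ → ℕ → ℕ → ℚ
  smallSummand n η l = smallCoefficient n η
    ℚ.* hypTerm (- (ℕ→ℚ η ℚ.* ½)) (- (ℕ→ℚ η ℚ.* ½) ℚ.+ ½) (ℕ→ℚ (n ℕ.∸ η ℕ.+ 1)) (+ 8 / 3) l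

  largeCoefficient : ℕ → ℕ → ℕ → ℚ
  largeCoefficient K n η = K ! /ℕ ((2 ℕ.* n ℕ.∸ η) ! ℕ.* (η ℕ.∸ n) ! ℕ.* 2 ^ n ℕ.* 3 ^ (η ℕ.∸ n))

  largeSummand : ℕ → ℕ → ℕ → ℚ
  largeSummand n η l = largeCoefficient (η ℕ.+ n) n η
    ℚ.* hypTerm ((- ℕ→ℚ n) ℚ.+ (ℕ→ℚ η ℚ.* ½)) (((- ℕ→ℚ n) ℚ.+ (ℕ→ℚ η ℚ.* ½)) ℚ.+ ½) (ℕ→ℚ (η ℕ.∸ n ℕ.+ 1)) (+ 8 / 3) l

  -- The l-th term counts the partitions with l triples, t pairs and c0 + l singletons.
  smallSummand-closedForm : ∀ l t c0 →
    let η = l ℕ.+ l ℕ.+ t ; n = η ℕ.+ c0 in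
    smallSummand n η l ≡ ℕ→ℚ (partsWith n (n ℕ.+ η) l)
  smallSummand-closedForm l t c0 = begin
    (K /ℕ (η ! ℕ.* (n ℕ.∸ η) ! ℕ.* 2 ^ η))
      ℚ.* hypTerm (- (ℕ→ℚ η ℚ.* ½)) (- (ℕ→ℚ η ℚ.* ½) ℚ.+ ½) (ℕ→ℚ (n ℕ.∸ η ℕ.+ 1)) (+ 8 / 3) l
      ≡⟨ cong (λ z → (K /ℕ (η ! ℕ.* z ! ℕ.* 2 ^ η)) ℚ.* hypTerm (- (ℕ→ℚ η ℚ.* ½)) (- (ℕ→ℚ η ℚ.* ½) ℚ.+ ½) (ℕ→ℚ (z ℕ.+ 1)) (+ 8 / 3) l) cn ⟩
    (K /ℕ B1) ℚ.* hypTerm (- (ℕ→ℚ η ℚ.* ½)) (- (ℕ→ℚ η ℚ.* ½) ℚ.+ ½) (ℕ→ℚ (c0 ℕ.+ 1)) (+ 8 / 3) l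
      ≡⟨ cong ((K /ℕ B1) ℚ.*_) (hypTerm-halves η c0 l) ⟩
    (K /ℕ B1) ℚ.* (X /ℕ B2) ≡⟨ /ℕ-* K B1 X B2 ⟩
    (K ℕ.* X) /ℕ (B1 ℕ.* B2) ≡⟨ /ℕ-cross (K ℕ.* X) (B1 ℕ.* B2) M 1 nzb (λ ()) ident ⟩
    M /ℕ 1 ≡⟨ sym (ℕ→ℚ≡/ℕ1 M) ⟩
    ℕ→ℚ M ∎
    where
    open ≡-Reasoning
    η = l ℕ.+ l ℕ.+ t
    n = η ℕ.+ c0
    K = (n ℕ.+ η) !
    B1 = η ! ℕ.* c0 ! ℕ.* 2 ^ η
    B2 = 4 ^ l ℕ.* ((c0 ℕ.+ l) ! ℕ.* l !) ℕ.* 3 ^ l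
    X = fallingPairs η l ℕ.* (c0 ! ℕ.* 1) ℕ.* 8 ^ l
    M = partsWith n (n ℕ.+ η) l
    cn : n ℕ.∸ η ≡ c0
    cn = ℕP.m+n∸m≡n η c0
    nzb : ¬ B1 ℕ.* B2 ≡ 0
    nzb = *≢0 B1 B2 (*≢0 _ _ (*≢0 _ _ (!≢0 η) (!≢0 c0)) (suc^≢0 1 η))
                    (*≢0 _ _ (*≢0 _ _ (suc^≢0 3 l) (*≢0 _ _ (!≢0 (c0 ℕ.+ l)) (!≢0 l))) (suc^≢0 2 l))
    e1 : c0 ℕ.+ l ℕ.+ t ℕ.+ l ≡ n
    e1 = solve 3 (λ c0 l t → c0 :+ l :+ t :+ l := l :+ l :+ t :+ c0) refl c0 l t
      where open NSol.+-*-Solver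
    e2 : c0 ℕ.+ l ℕ.+ 2 ℕ.* t ℕ.+ 3 ℕ.* l ≡ n ℕ.+ η
    e2 = solve 3 (λ c0 l t → c0 :+ l :+ con 2 :* t :+ con 3 :* l := (l :+ l :+ t :+ c0) :+ (l :+ l :+ t)) refl c0 l t
      where open NSol.+-*-Solver
    cl : M ℕ.* blockDenominator (c0 ℕ.+ l) t l ≡ K
    cl = partsWith-closedForm n (n ℕ.+ η) (c0 ℕ.+ l) t l e1 e2
    ident : K ℕ.* X ℕ.* 1 ≡ M ℕ.* (B1 ℕ.* B2)
    ident = begin
      K ℕ.* X ℕ.* 1 ≡⟨ cong (λ z → z ℕ.* X ℕ.* 1) (sym cl) ⟩
      M ℕ.* ((c0 ℕ.+ l) ! ℕ.* t ! ℕ.* l ! ℕ.* 2 ^ t ℕ.* 6 ^ l) ℕ.* (fallingPairs η l ℕ.* (c0 ! ℕ.* 1) ℕ.* 8 ^ l) ℕ.* 1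
        ≡⟨ solve 9 (λ M S T L F2 F6 P C F8 → M :* (S :* T :* L :* F2 :* F6) :* (P :* (C :* con 1) :* F8) :* con 1
               := M :* (P :* T :* C :* F2 :* S :* L :* (F8 :* F6))) refl
               M ((c0 ℕ.+ l) !) (t !) (l !) (2 ^ t) (6 ^ l) (fallingPairs η l) (c0 !) (8 ^ l) ⟩
      M ℕ.* (fallingPairs η l ℕ.* t ! ℕ.* c0 ! ℕ.* 2 ^ t ℕ.* (c0 ℕ.+ l) ! ℕ.* l ! ℕ.* (8 ^ l ℕ.* 6 ^ l))
        ≡⟨ cong (λ z → M ℕ.* (fallingPairs η l ℕ.* t ! ℕ.* c0 ! ℕ.* 2 ^ t ℕ.* (c0 ℕ.+ l) ! ℕ.* l ! ℕ.* z)) (sym (4^l*4^l*3^l≡8^l*6^l l)) ⟩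
      M ℕ.* (fallingPairs η l ℕ.* t ! ℕ.* c0 ! ℕ.* 2 ^ t ℕ.* (c0 ℕ.+ l) ! ℕ.* l ! ℕ.* (4 ^ l ℕ.* 4 ^ l ℕ.* 3 ^ l))
        ≡⟨ solve 9 (λ M S T L F2 F3 P C F4 → M :* (P :* T :* C :* F2 :* S :* L :* (F4 :* F4 :* F3))
               := M :* ((P :* T) :* C :* (F4 :* F2) :* (F4 :* (S :* L) :* F3))) refl
               M ((c0 ℕ.+ l) !) (t !) (l !) (2 ^ t) (3 ^ l) (fallingPairs η l) (c0 !) (4 ^ l) ⟩
      M ℕ.* ((fallingPairs η l ℕ.* t !) ℕ.* c0 ! ℕ.* (4 ^ l ℕ.* 2 ^ t) ℕ.* B2)
        ≡⟨ cong₂ (λ p q → M ℕ.* (p ℕ.* c0 ! ℕ.* q ℕ.* B2)) (fallingPairs-*-! l t)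
             (trans (cong (ℕ._* 2 ^ t) (sym (2^[l+l]≡4^l l))) (sym (ℕP.^-distribˡ-+-* 2 (l ℕ.+ l) t))) ⟩
      M ℕ.* (B1 ℕ.* B2) ∎
      where open NSol.+-*-Solver

  hypTerm-halves-vanishes : ∀ D c0 l → D ℕ.< l ℕ.+ l →
    hypTerm (- (ℕ→ℚ D ℚ.* ½)) (- (ℕ→ℚ D ℚ.* ½) ℚ.+ ½) (ℕ→ℚ (c0 ℕ.+ 1)) (+ 8 / 3) l ≡ 0ℚ
  hypTerm-halves-vanishes D c0 l lt = trans (hypTerm-halves D c0 l) (trans (cong (λ z → (z ℕ.* (c0 ! ℕ.* 1) ℕ.* 8 ^ l) /ℕ (4 ^ l ℕ.* ((c0 ℕ.+ l) ! ℕ.* l !) ℕ.* 3 ^ l)) (fallingPairs-vanishes D l lt)) (0/ℕ (4 ^ l ℕ.* ((c0 ℕ.+ l) ! ℕ.* l !) ℕ.* 3 ^ l)))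

  smallSummand≡partsWith : ∀ n η l → η ℕ.≤ n → smallSummand n η l ≡ ℕ→ℚ (partsWith n (n ℕ.+ η) l)
  smallSummand≡partsWith n η l η≤n with l ℕ.+ l ℕ.≤? η
  ... | yes le = atProfile (η ℕ.∸ (l ℕ.+ l)) (n ℕ.∸ η) η n (sym (ℕP.m+[n∸m]≡n le)) (sym (ℕP.m+[n∸m]≡n η≤n))
    where
    atProfile : ∀ t c0 η n → η ≡ l ℕ.+ l ℕ.+ t → n ≡ η ℕ.+ c0 → smallSummand n η l ≡ ℕ→ℚ (partsWith n (n ℕ.+ η) l)
    atProfile t c0 _ _ refl refl = smallSummand-closedForm l t c0
  ... | no gt = trans (cong (((n ℕ.+ η) ! /ℕ (η ! ℕ.* (n ℕ.∸ η) ! ℕ.* 2 ^ η)) ℚ.*_) (hypTerm-halves-vanishes η (n ℕ.∸ η) l (ℕP.≰⇒> gt)))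
                  (trans (ℚP.*-zeroʳ ((n ℕ.+ η) ! /ℕ (η ! ℕ.* (n ℕ.∸ η) ! ℕ.* 2 ^ η))) (sym (cong ℕ→ℚ (partsWith-vanishes n (n ℕ.+ η) l nv))))
    where
    nv : ¬ Profile n (n ℕ.+ η) l
    nv (s , t , e1 , e2) = gt (ℕP.≤-trans (ℕP.m≤n+m (l ℕ.+ l) t) (ℕP.≤-reflexive e3))
      where
      e3 : t ℕ.+ (l ℕ.+ l) ≡ η
      e3 = ℕP.+-cancelˡ-≡ n _ _ (begin
        n ℕ.+ (t ℕ.+ (l ℕ.+ l)) ≡⟨ cong (ℕ._+ (t ℕ.+ (l ℕ.+ l))) (sym e1) ⟩
        s ℕ.+ t ℕ.+ l ℕ.+ (t ℕ.+ (l ℕ.+ l)) ≡⟨ solve 3 (λ s t l → s :+ t :+ l :+ (t :+ (l :+ l)) := s :+ con 2 :* t :+ con 3 :* l) refl s t l ⟩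
        s ℕ.+ 2 ℕ.* t ℕ.+ 3 ℕ.* l ≡⟨ e2 ⟩
        n ℕ.+ η ∎)
        where open ≡-Reasoning
              open NSol.+-*-Solver

  largeParameter : ∀ n η d → n ℕ.+ n ≡ η ℕ.+ d → (- ℕ→ℚ n) ℚ.+ ℕ→ℚ η ℚ.* ½ ≡ - (ℕ→ℚ d ℚ.* ½)
  largeParameter n η d e = begin
    (- x) ℚ.+ y ℚ.* ½ ≡⟨ cong (λ z → (- z) ℚ.+ y ℚ.* ½) (≡*[½+½] x) ⟩
    (- (x ℚ.* (½ ℚ.+ ½))) ℚ.+ y ℚ.* ½ ≡⟨ solve 3 (λ x y ½ → (:- (x :* (½ :+ ½))) :+ y :* ½ := (:- ((x :+ x) :* ½)) :+ y :* ½) refl x y ½ ⟩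
    (- ((x ℚ.+ x) ℚ.* ½)) ℚ.+ y ℚ.* ½ ≡⟨ cong (λ z → (- (z ℚ.* ½)) ℚ.+ y ℚ.* ½) (trans (sym (ℕ→ℚ-+ n n)) (trans (cong ℕ→ℚ e) (ℕ→ℚ-+ η d))) ⟩
    (- ((y ℚ.+ w) ℚ.* ½)) ℚ.+ y ℚ.* ½ ≡⟨ solve 3 (λ y w ½ → (:- ((y :+ w) :* ½)) :+ y :* ½ := :- (w :* ½)) refl y w ½ ⟩
    - (w ℚ.* ½) ∎
    where
    open ≡-Reasoning
    open +-*-Solver
    x = ℕ→ℚ n
    y = ℕ→ℚ η
    w = ℕ→ℚ d

  largeSummandAt : ℕ → ℕ → ℕ → ℕ → ℕ → ℚ
  largeSummandAt n η d c0 l = ((η ℕ.+ n) ! /ℕ (d ! ℕ.* c0 ! ℕ.* 2 ^ n ℕ.* 3 ^ c0))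
      ℚ.* hypTerm (- (ℕ→ℚ d ℚ.* ½)) (- (ℕ→ℚ d ℚ.* ½) ℚ.+ ½) (ℕ→ℚ (c0 ℕ.+ 1)) (+ 8 / 3) l

  largeSummand≡At : ∀ n η d c0 l → n ≡ d ℕ.+ c0 → η ≡ n ℕ.+ c0 → largeSummand n η l ≡ largeSummandAt n η d c0 l
  largeSummand≡At n η d c0 l e1 e2 = cong₂ (λ p q → ((η ℕ.+ n) ! /ℕ (p ! ℕ.* q ! ℕ.* 2 ^ n ℕ.* 3 ^ q))
      ℚ.* hypTerm A (A ℚ.+ ½) (ℕ→ℚ (q ℕ.+ 1)) (+ 8 / 3) l) ed ec
    ∙ cong (λ A' → ((η ℕ.+ n) ! /ℕ (d ! ℕ.* c0 ! ℕ.* 2 ^ n ℕ.* 3 ^ c0)) ℚ.* hypTerm A' (A' ℚ.+ ½) (ℕ→ℚ (c0 ℕ.+ 1)) (+ 8 / 3) l) ea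
    where
    _∙_ = trans
    A = (- ℕ→ℚ n) ℚ.+ (ℕ→ℚ η ℚ.* ½)
    ec : η ℕ.∸ n ≡ c0
    ec = trans (cong (ℕ._∸ n) e2) (ℕP.m+n∸m≡n n c0)
    ed : 2 ℕ.* n ℕ.∸ η ≡ d
    ed = begin
      n ℕ.+ (n ℕ.+ 0) ℕ.∸ η ≡⟨ cong₂ (λ p q → n ℕ.+ p ℕ.∸ q) (ℕP.+-identityʳ n) e2 ⟩
      n ℕ.+ n ℕ.∸ (n ℕ.+ c0) ≡⟨ ℕP.[m+n]∸[m+o]≡n∸o n n c0 ⟩
      n ℕ.∸ c0 ≡⟨ cong (ℕ._∸ c0) e1 ⟩
      d ℕ.+ c0 ℕ.∸ c0 ≡⟨ ℕP.m+n∸n≡m d c0 ⟩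
      d ∎
      where open ≡-Reasoning
    ea : A ≡ - (ℕ→ℚ d ℚ.* ½)
    ea = largeParameter n η d (begin
      n ℕ.+ n ≡⟨ cong (n ℕ.+_) e1 ⟩
      n ℕ.+ (d ℕ.+ c0) ≡⟨ solve 3 (λ n d c → n :+ (d :+ c) := n :+ c :+ d) refl n d c0 ⟩
      n ℕ.+ c0 ℕ.+ d ≡⟨ cong (ℕ._+ d) (sym e2) ⟩
      η ℕ.+ d ∎)
      where open ≡-Reasoning
            open NSol.+-*-Solver

  -- The l-th term counts the partitions with c0 + l triples, t pairs and l singletons.
  largeSummandAt-closedForm : ∀ l t c0 →
    let d = l ℕ.+ l ℕ.+ t ; n = d ℕ.+ c0 ; η = n ℕ.+ c0 in
    largeSummandAt n η d c0 l ≡ ℕ→ℚ (partsWith n (n ℕ.+ η) (c0 ℕ.+ l))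
  largeSummandAt-closedForm l t c0 = begin
    (K /ℕ B1) ℚ.* hypTerm (- (ℕ→ℚ d ℚ.* ½)) (- (ℕ→ℚ d ℚ.* ½) ℚ.+ ½) (ℕ→ℚ (c0 ℕ.+ 1)) (+ 8 / 3) l
      ≡⟨ cong ((K /ℕ B1) ℚ.*_) (hypTerm-halves d c0 l) ⟩
    (K /ℕ B1) ℚ.* (X /ℕ B2) ≡⟨ /ℕ-* K B1 X B2 ⟩
    (K ℕ.* X) /ℕ (B1 ℕ.* B2) ≡⟨ /ℕ-cross (K ℕ.* X) (B1 ℕ.* B2) M 1 nzb (λ ()) ident ⟩
    M /ℕ 1 ≡⟨ sym (ℕ→ℚ≡/ℕ1 M) ⟩
    ℕ→ℚ M ∎
    where
    open ≡-Reasoning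
    d = l ℕ.+ l ℕ.+ t
    n = d ℕ.+ c0
    η = n ℕ.+ c0
    K = (η ℕ.+ n) !
    B1 = d ! ℕ.* c0 ! ℕ.* 2 ^ n ℕ.* 3 ^ c0
    B2 = 4 ^ l ℕ.* ((c0 ℕ.+ l) ! ℕ.* l !) ℕ.* 3 ^ l
    X = fallingPairs d l ℕ.* (c0 ! ℕ.* 1) ℕ.* 8 ^ l
    M = partsWith n (n ℕ.+ η) (c0 ℕ.+ l)
    nzb : ¬ B1 ℕ.* B2 ≡ 0
    nzb = *≢0 B1 B2 (*≢0 _ _ (*≢0 _ _ (*≢0 _ _ (!≢0 d) (!≢0 c0)) (suc^≢0 1 n)) (suc^≢0 2 c0))
                    (*≢0 _ _ (*≢0 _ _ (suc^≢0 3 l) (*≢0 _ _ (!≢0 (c0 ℕ.+ l)) (!≢0 l))) (suc^≢0 2 l))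
    e1 : l ℕ.+ t ℕ.+ (c0 ℕ.+ l) ≡ n
    e1 = solve 3 (λ c0 l t → l :+ t :+ (c0 :+ l) := l :+ l :+ t :+ c0) refl c0 l t
      where open NSol.+-*-Solver
    e2 : l ℕ.+ 2 ℕ.* t ℕ.+ 3 ℕ.* (c0 ℕ.+ l) ≡ n ℕ.+ η
    e2 = solve 3 (λ c0 l t → l :+ con 2 :* t :+ con 3 :* (c0 :+ l) := (l :+ l :+ t :+ c0) :+ (l :+ l :+ t :+ c0 :+ c0)) refl c0 l t
      where open NSol.+-*-Solver
    cl : M ℕ.* blockDenominator l t (c0 ℕ.+ l) ≡ (n ℕ.+ η) !
    cl = partsWith-closedForm n (n ℕ.+ η) l t (c0 ℕ.+ l) e1 e2
    e6 : 6 ^ (c0 ℕ.+ l) ≡ 2 ^ c0 ℕ.* 3 ^ c0 ℕ.* 6 ^ l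
    e6 = trans (ℕP.^-distribˡ-+-* 6 c0 l) (cong (ℕ._* 6 ^ l) (^-distribʳ-* 2 3 c0))
    e2n : 2 ^ n ≡ 4 ^ l ℕ.* 2 ^ t ℕ.* 2 ^ c0
    e2n = trans (ℕP.^-distribˡ-+-* 2 (l ℕ.+ l ℕ.+ t) c0) (cong (ℕ._* 2 ^ c0) (trans (ℕP.^-distribˡ-+-* 2 (l ℕ.+ l) t) (cong (ℕ._* 2 ^ t) (2^[l+l]≡4^l l))))
    ident : K ℕ.* X ℕ.* 1 ≡ M ℕ.* (B1 ℕ.* B2)
    ident = begin
      K ℕ.* X ℕ.* 1 ≡⟨ cong (λ z → z ! ℕ.* X ℕ.* 1) (ℕP.+-comm η n) ⟩
      (n ℕ.+ η) ! ℕ.* X ℕ.* 1 ≡⟨ cong (λ z → z ℕ.* X ℕ.* 1) (sym cl) ⟩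
      M ℕ.* (l ! ℕ.* t ! ℕ.* (c0 ℕ.+ l) ! ℕ.* 2 ^ t ℕ.* 6 ^ (c0 ℕ.+ l)) ℕ.* X ℕ.* 1
        ≡⟨ cong (λ z → M ℕ.* (l ! ℕ.* t ! ℕ.* (c0 ℕ.+ l) ! ℕ.* 2 ^ t ℕ.* z) ℕ.* X ℕ.* 1) e6 ⟩
      M ℕ.* (l ! ℕ.* t ! ℕ.* (c0 ℕ.+ l) ! ℕ.* 2 ^ t ℕ.* (2 ^ c0 ℕ.* 3 ^ c0 ℕ.* 6 ^ l)) ℕ.* (fallingPairs d l ℕ.* (c0 ! ℕ.* 1) ℕ.* 8 ^ l) ℕ.* 1
        ≡⟨ solve 11 (λ M L T S F2 G2 G3 F6 P C F8 → M :* (L :* T :* S :* F2 :* (G2 :* G3 :* F6)) :* (P :* (C :* con 1) :* F8) :* con 1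
               := M :* (P :* T :* C :* F2 :* G2 :* G3 :* S :* L :* (F8 :* F6))) refl
               M (l !) (t !) ((c0 ℕ.+ l) !) (2 ^ t) (2 ^ c0) (3 ^ c0) (6 ^ l) (fallingPairs d l) (c0 !) (8 ^ l) ⟩
      M ℕ.* (fallingPairs d l ℕ.* t ! ℕ.* c0 ! ℕ.* 2 ^ t ℕ.* 2 ^ c0 ℕ.* 3 ^ c0 ℕ.* (c0 ℕ.+ l) ! ℕ.* l ! ℕ.* (8 ^ l ℕ.* 6 ^ l))
        ≡⟨ cong (λ z → M ℕ.* (fallingPairs d l ℕ.* t ! ℕ.* c0 ! ℕ.* 2 ^ t ℕ.* 2 ^ c0 ℕ.* 3 ^ c0 ℕ.* (c0 ℕ.+ l) ! ℕ.* l ! ℕ.* z)) (sym (4^l*4^l*3^l≡8^l*6^l l)) ⟩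
      M ℕ.* (fallingPairs d l ℕ.* t ! ℕ.* c0 ! ℕ.* 2 ^ t ℕ.* 2 ^ c0 ℕ.* 3 ^ c0 ℕ.* (c0 ℕ.+ l) ! ℕ.* l ! ℕ.* (4 ^ l ℕ.* 4 ^ l ℕ.* 3 ^ l))
        ≡⟨ solve 11 (λ M L T S F2 G2 G3 F3 P C F4 → M :* (P :* T :* C :* F2 :* G2 :* G3 :* S :* L :* (F4 :* F4 :* F3))
               := M :* ((P :* T) :* C :* (F4 :* F2 :* G2) :* G3 :* (F4 :* (S :* L) :* F3))) refl
               M (l !) (t !) ((c0 ℕ.+ l) !) (2 ^ t) (2 ^ c0) (3 ^ c0) (3 ^ l) (fallingPairs d l) (c0 !) (4 ^ l) ⟩
      M ℕ.* ((fallingPairs d l ℕ.* t !) ℕ.* c0 ! ℕ.* (4 ^ l ℕ.* 2 ^ t ℕ.* 2 ^ c0) ℕ.* 3 ^ c0 ℕ.* B2)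
        ≡⟨ cong₂ (λ p q → M ℕ.* (p ℕ.* c0 ! ℕ.* q ℕ.* 3 ^ c0 ℕ.* B2)) (fallingPairs-*-! l t) (sym e2n) ⟩
      M ℕ.* (B1 ℕ.* B2) ∎
      where open NSol.+-*-Solver

  largeSummand≡partsWith : ∀ n η l → n ℕ.≤ η → η ℕ.≤ 2 ℕ.* n → largeSummand n η l ≡ ℕ→ℚ (partsWith n (n ℕ.+ η) ((η ℕ.∸ n) ℕ.+ l))
  largeSummand≡partsWith n η l n≤η η≤2n = trans (largeSummand≡At n η d c0 l en eη) (go (l ℕ.+ l ℕ.≤? d))
    where
    c0 = η ℕ.∸ n
    d = 2 ℕ.* n ℕ.∸ η
    eη : η ≡ n ℕ.+ c0
    eη = sym (ℕP.m+[n∸m]≡n n≤η)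
    e2n : η ℕ.+ d ≡ n ℕ.+ n
    e2n = trans (ℕP.m+[n∸m]≡n η≤2n) (cong (n ℕ.+_) (ℕP.+-identityʳ n))
    en : n ≡ d ℕ.+ c0
    en = ℕP.+-cancelˡ-≡ n _ _ (begin
      n ℕ.+ n ≡⟨ sym e2n ⟩
      η ℕ.+ d ≡⟨ cong (ℕ._+ d) eη ⟩
      n ℕ.+ c0 ℕ.+ d ≡⟨ solve 3 (λ n c d → n :+ c :+ d := n :+ (d :+ c)) refl n c0 d ⟩
      n ℕ.+ (d ℕ.+ c0) ∎)
      where open ≡-Reasoning
            open NSol.+-*-Solver
    atProfile : ∀ t c0 d n η → d ≡ l ℕ.+ l ℕ.+ t → n ≡ d ℕ.+ c0 → η ≡ n ℕ.+ c0 → largeSummandAt n η d c0 l ≡ ℕ→ℚ (partsWith n (n ℕ.+ η) (c0 ℕ.+ l))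
    atProfile t c0 _ _ _ refl refl refl = largeSummandAt-closedForm l t c0
    go : Relation.Nullary.Dec (l ℕ.+ l ℕ.≤ d) → largeSummandAt n η d c0 l ≡ ℕ→ℚ (partsWith n (n ℕ.+ η) (c0 ℕ.+ l))
    go (yes le) = atProfile (d ℕ.∸ (l ℕ.+ l)) c0 d n η (sym (ℕP.m+[n∸m]≡n le)) en eη
    go (no gt) = trans (cong (((η ℕ.+ n) ! /ℕ (d ! ℕ.* c0 ! ℕ.* 2 ^ n ℕ.* 3 ^ c0)) ℚ.*_) (hypTerm-halves-vanishes d c0 l (ℕP.≰⇒> gt)))
                  (trans (ℚP.*-zeroʳ ((η ℕ.+ n) ! /ℕ (d ! ℕ.* c0 ! ℕ.* 2 ^ n ℕ.* 3 ^ c0))) (sym (cong ℕ→ℚ (partsWith-vanishes n (n ℕ.+ η) (c0 ℕ.+ l) nv))))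
      where
      nv : ¬ Profile n (n ℕ.+ η) (c0 ℕ.+ l)
      nv (s , t , e1 , e2) = gt (ℕP.≤-trans (ℕP.m≤n+m (l ℕ.+ l) t) (ℕP.≤-reflexive e3))
        where
        e3 : t ℕ.+ (l ℕ.+ l) ≡ d
        e3 = ℕP.+-cancelˡ-≡ (n ℕ.+ c0 ℕ.+ c0) _ _ (begin
          n ℕ.+ c0 ℕ.+ c0 ℕ.+ (t ℕ.+ (l ℕ.+ l)) ≡⟨ cong (λ z → z ℕ.+ c0 ℕ.+ c0 ℕ.+ (t ℕ.+ (l ℕ.+ l))) (sym e1) ⟩
          s ℕ.+ t ℕ.+ (c0 ℕ.+ l) ℕ.+ c0 ℕ.+ c0 ℕ.+ (t ℕ.+ (l ℕ.+ l))
            ≡⟨ solve 4 (λ s t c l → s :+ t :+ (c :+ l) :+ c :+ c :+ (t :+ (l :+ l)) := s :+ con 2 :* t :+ con 3 :* (c :+ l)) refl s t c0 l ⟩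
          s ℕ.+ 2 ℕ.* t ℕ.+ 3 ℕ.* (c0 ℕ.+ l) ≡⟨ e2 ⟩
          n ℕ.+ η ≡⟨ cong (n ℕ.+_) eη ⟩
          n ℕ.+ (n ℕ.+ c0) ≡⟨ cong (λ z → n ℕ.+ (z ℕ.+ c0)) en ⟩
          n ℕ.+ (d ℕ.+ c0 ℕ.+ c0) ≡⟨ solve 3 (λ n d c → n :+ (d :+ c :+ c) := n :+ c :+ c :+ d) refl n d c0 ⟩
          n ℕ.+ c0 ℕ.+ c0 ℕ.+ d ∎)
          where open ≡-Reasoning
                open NSol.+-*-Solver


module PartitionsHypergeometric where

  open import Defs
  open NatRational
  open BoundedPartitions
  open HalfHypergeometric
  open import Data.Nat as ℕ using (ℕ; zero; suc; _!)
  import Data.Nat.Properties as ℕP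
  open import Data.Integer using (+_)
  open import Data.Rational as ℚ using (ℚ; _/_; -_)
  import Data.Rational.Properties as ℚP
  open import Data.List as List using (_∷_; applyUpTo; map)
  open import Relation.Binary.PropositionalEquality
  open import Relation.Nullary using (¬_)
  open import Data.Product using (_,_)
  import Data.Nat.Solver as NSol

  smallTerm : ℕ → ℕ → ℕ → ℚ
  smallTerm N n η = smallCoefficient n η ℚ.* ₂F₁≤ N (- (ℕ→ℚ η ℚ.* ½)) (- (ℕ→ℚ η ℚ.* ½) ℚ.+ ½) (ℕ→ℚ (n ℕ.∸ η ℕ.+ 1)) (+ 8 / 3)

  -- The numerator is K !, since the theorem writes the same number as η + n in (i) and as n + η in (ii).
  largeTerm : ℕ → ℕ → ℕ → ℕ → ℚ
  largeTerm K N n η = largeCoefficient K n η ℚ.* ₂F₁≤ N ((- ℕ→ℚ n) ℚ.+ (ℕ→ℚ η ℚ.* ½)) (((- ℕ→ℚ n) ℚ.+ (ℕ→ℚ η ℚ.* ½)) ℚ.+ ½) (ℕ→ℚ (η ℕ.∸ n ℕ.+ 1)) (+ 8 / 3)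

  Σℚ-applyUpTo : ∀ M (G : ℕ → ℕ) (g : ℕ → ℚ) → (∀ j → j ℕ.< M → g j ≡ ℕ→ℚ (G j)) →
    Σℚ (applyUpTo g M) ≡ ℕ→ℚ (sumTo M G)
  Σℚ-applyUpTo zero G g e = refl
  Σℚ-applyUpTo (suc M) G g e = begin
    g 0 ℚ.+ Σℚ (applyUpTo (λ j → g (suc j)) M)
      ≡⟨ cong₂ ℚ._+_ (e 0 ℕ.z<s) (Σℚ-applyUpTo M (λ j → G (suc j)) (λ j → g (suc j)) (λ j lt → e (suc j) (ℕ.s<s lt))) ⟩
    ℕ→ℚ (G 0) ℚ.+ ℕ→ℚ (sumTo M (λ j → G (suc j))) ≡⟨ sym (ℕ→ℚ-+ (G 0) _) ⟩
    ℕ→ℚ (G 0 ℕ.+ sumTo M (λ j → G (suc j)))       ≡⟨ cong ℕ→ℚ (sym (sumTo-shift M G)) ⟩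
    ℕ→ℚ (sumTo (suc M) G)                         ∎
    where open ≡-Reasoning

  map-applyUpTo : ∀ {A B : Set} (f : A → B) (g : ℕ → A) M → map f (applyUpTo g M) ≡ applyUpTo (λ j → f (g j)) M
  map-applyUpTo f g zero = refl
  map-applyUpTo f g (suc M) = cong (f (g 0) ∷_) (map-applyUpTo f (λ j → g (suc j)) M)

  *-distribˡ-Σℚ : ∀ c M (g : ℕ → ℚ) → c ℚ.* Σℚ (applyUpTo g M) ≡ Σℚ (applyUpTo (λ j → c ℚ.* g j) M)
  *-distribˡ-Σℚ c zero g = ℚP.*-zeroʳ c
  *-distribˡ-Σℚ c (suc M) g = trans (ℚP.*-distribˡ-+ c (g 0) _) (cong (c ℚ.* g 0 ℚ.+_) (*-distribˡ-Σℚ c M (λ j → g (suc j))))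

  parts-small : ∀ n η N → η ℕ.≤ n → n ℕ.≤ N → ℕ→ℚ (parts n (n ℕ.+ η)) ≡ smallTerm N n η
  parts-small n η N η≤n n≤N = begin
    ℕ→ℚ (parts n (n ℕ.+ η))                         ≡⟨ cong ℕ→ℚ (parts≡sumTo-partsWith n (n ℕ.+ η) (suc N) (ℕ.s≤s n≤N)) ⟩
    ℕ→ℚ (sumTo (suc N) (partsWith n (n ℕ.+ η)))      ≡⟨ sym (Σℚ-applyUpTo (suc N) _ (smallSummand n η) (λ j _ → smallSummand≡partsWith n η j η≤n)) ⟩
    Σℚ (applyUpTo (smallSummand n η) (suc N))       ≡⟨ sym (*-distribˡ-Σℚ (smallCoefficient n η) (suc N)
                                                         (hypTerm (- (ℕ→ℚ η ℚ.* ½)) (- (ℕ→ℚ η ℚ.* ½) ℚ.+ ½) (ℕ→ℚ (n ℕ.∸ η ℕ.+ 1)) (+ 8 / 3))) ⟩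
    smallTerm N n η                                 ∎
    where open ≡-Reasoning

  -- A profile has t + 2r = η and t + r ≤ n, hence at least η − n triples.
  partsWith-fewTriples : ∀ n η → n ℕ.≤ η → sumTo (η ℕ.∸ n) (partsWith n (n ℕ.+ η)) ≡ 0
  partsWith-fewTriples n η n≤η = sumTo-zero (η ℕ.∸ n) (partsWith n (n ℕ.+ η)) (λ r lt → partsWith-vanishes n (n ℕ.+ η) r (noProfile r lt))
    where
    noProfile : ∀ r → r ℕ.< η ℕ.∸ n → ¬ Profile n (n ℕ.+ η) r
    noProfile r lt (s , t , e1 , e2) = ℕP.<⇒≱ lt (ℕP.+-cancelˡ-≤ n (η ℕ.∸ n) r (begin
        n ℕ.+ (η ℕ.∸ n) ≡⟨ ℕP.m+[n∸m]≡n n≤η ⟩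
        η               ≡⟨ η≡t+2r ⟩
        t ℕ.+ r ℕ.+ r   ≤⟨ ℕP.+-monoˡ-≤ r (ℕP.≤-trans (ℕP.m≤n+m (t ℕ.+ r) s) (ℕP.≤-reflexive (trans (sym (ℕP.+-assoc s t r)) e1))) ⟩
        n ℕ.+ r         ∎))
      where
      open ℕP.≤-Reasoning
      open NSol.+-*-Solver
      η≡t+2r : η ≡ t ℕ.+ r ℕ.+ r
      η≡t+2r = sym (ℕP.+-cancelˡ-≡ n _ _ (trans (cong (ℕ._+ (t ℕ.+ r ℕ.+ r)) (sym e1))
               (trans (solve 3 (λ s t r → s :+ t :+ r :+ (t :+ r :+ r) := s :+ con 2 :* t :+ con 3 :* r) refl s t r) e2)))

  parts-large : ∀ n η N → n ℕ.≤ η → η ℕ.≤ 2 ℕ.* n → n ℕ.≤ N → ℕ→ℚ (parts n (n ℕ.+ η)) ≡ largeTerm (η ℕ.+ n) N n η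
  parts-large n η N n≤η η≤2n n≤N = begin
    ℕ→ℚ (parts n k)
      ≡⟨ cong ℕ→ℚ (parts≡sumTo-partsWith n k (c ℕ.+ suc N) (ℕP.≤-trans (ℕ.s≤s n≤N) (ℕP.m≤n+m (suc N) c))) ⟩
    ℕ→ℚ (sumTo (c ℕ.+ suc N) (partsWith n k))
      ≡⟨ cong ℕ→ℚ (sumTo-split c (suc N) (partsWith n k)) ⟩
    ℕ→ℚ (sumTo c (partsWith n k) ℕ.+ sumTo (suc N) (λ l → partsWith n k (c ℕ.+ l)))
      ≡⟨ cong (λ z → ℕ→ℚ (z ℕ.+ sumTo (suc N) (λ l → partsWith n k (c ℕ.+ l)))) (partsWith-fewTriples n η n≤η) ⟩
    ℕ→ℚ (sumTo (suc N) (λ l → partsWith n k (c ℕ.+ l)))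
      ≡⟨ sym (Σℚ-applyUpTo (suc N) _ (largeSummand n η) (λ j _ → largeSummand≡partsWith n η j n≤η η≤2n)) ⟩
    Σℚ (applyUpTo (largeSummand n η) (suc N))
      ≡⟨ sym (*-distribˡ-Σℚ (largeCoefficient (η ℕ.+ n) n η) (suc N) (hypTerm a (a ℚ.+ ½) (ℕ→ℚ (η ℕ.∸ n ℕ.+ 1)) (+ 8 / 3))) ⟩
    largeTerm (η ℕ.+ n) N n η ∎
    where
    open ≡-Reasoning
    k = n ℕ.+ η
    c = η ℕ.∸ n
    a = (- ℕ→ℚ n) ℚ.+ (ℕ→ℚ η ℚ.* ½)


module StealRecurrence where

  open BoundedPartitions
  open import Data.Nat
  open import Data.Nat.Properties
  open import Relation.Binary.PropositionalEquality
  import Data.Nat.Solver as NSol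

  addBlock≤3 : (ℕ → ℕ) → ℕ → ℕ
  addBlock≤3 F L = F L + L * F (L ∸ 1) + choose₂ L * F (L ∸ 2)

  addBlock≤2 : (ℕ → ℕ) → ℕ → ℕ
  addBlock≤2 F L = F L + L * F (L ∸ 1)

  addBlock≤3-cong : ∀ {F G : ℕ → ℕ} → (∀ L → F L ≡ G L) → ∀ L → addBlock≤3 F L ≡ addBlock≤3 G L
  addBlock≤3-cong e L = cong₂ _+_ (cong₂ _+_ (e L) (cong (L *_) (e (L ∸ 1)))) (cong (choose₂ L *_) (e (L ∸ 2)))

  addBlock≤2-cong : ∀ {F G : ℕ → ℕ} → (∀ L → F L ≡ G L) → ∀ L → addBlock≤2 F L ≡ addBlock≤2 G L
  addBlock≤2-cong e L = cong₂ _+_ (e L) (cong (L *_) (e (L ∸ 1)))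

  addBlock≤3-linear : ∀ (F G K : ℕ → ℕ) a b c L → addBlock≤3 (λ x → a * F x + b * G x + c * K x) L ≡ a * addBlock≤3 F L + b * addBlock≤3 G L + c * addBlock≤3 K L
  addBlock≤3-linear F G K a b c L = solve 14 (λ a b c L T f1 f2 f3 g1 g2 g3 k1 k2 k3 →
      (a :* f1 :+ b :* g1 :+ c :* k1) :+ L :* (a :* f2 :+ b :* g2 :+ c :* k2) :+ T :* (a :* f3 :+ b :* g3 :+ c :* k3)
      := a :* (f1 :+ L :* f2 :+ T :* f3) :+ b :* (g1 :+ L :* g2 :+ T :* g3) :+ c :* (k1 :+ L :* k2 :+ T :* k3)) refl
      a b c L (choose₂ L) (F L) (F (L ∸ 1)) (F (L ∸ 2)) (G L) (G (L ∸ 1)) (G (L ∸ 2)) (K L) (K (L ∸ 1)) (K (L ∸ 2))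
    where open NSol.+-*-Solver

  addBlock≤2-linear : ∀ (F G K : ℕ → ℕ) a b c L → addBlock≤2 (λ x → a * F x + b * G x + c * K x) L ≡ a * addBlock≤2 F L + b * addBlock≤2 G L + c * addBlock≤2 K L
  addBlock≤2-linear F G K a b c L = solve 10 (λ a b c L f1 f2 g1 g2 k1 k2 →
      (a :* f1 :+ b :* g1 :+ c :* k1) :+ L :* (a :* f2 :+ b :* g2 :+ c :* k2)
      := a :* (f1 :+ L :* f2) :+ b :* (g1 :+ L :* g2) :+ c :* (k1 :+ L :* k2)) refl
      a b c L (F L) (F (L ∸ 1)) (G L) (G (L ∸ 1)) (K L) (K (L ∸ 1))
    where open NSol.+-*-Solver

  addBlock≤3-shift : ∀ (F : ℕ → ℕ) L → addBlock≤3 F (suc L) ≡ addBlock≤3 (λ x → F (suc x)) L + addBlock≤2 F L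
  addBlock≤3-shift F L = begin
    F (suc L) + suc L * F L + (L + choose₂ L) * F (L ∸ 1)
      ≡⟨ solve 5 (λ a b c L T → a :+ (con 1 :+ L) :* b :+ (L :+ T) :* c := (a :+ L :* b :+ T :* c) :+ (b :+ L :* c)) refl (F (suc L)) (F L) (F (L ∸ 1)) L (choose₂ L) ⟩
    (F (suc L) + L * F L + choose₂ L * F (L ∸ 1)) + (F L + L * F (L ∸ 1))
      ≡⟨ cong₂ (λ x y → (F (suc L) + x + y) + (F L + L * F (L ∸ 1))) (sym (*-suc∸1 L F)) (sym (choose₂*-suc∸2 L F)) ⟩
    addBlock≤3 (λ x → F (suc x)) L + addBlock≤2 F L ∎
    where open ≡-Reasoning
          open NSol.+-*-Solver

  addBlock≤2-shift : ∀ (F : ℕ → ℕ) L → addBlock≤2 F (suc L) ≡ addBlock≤2 (λ x → F (suc x)) L + F L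
  addBlock≤2-shift F L = begin
    F (suc L) + suc L * F L ≡⟨ solve 3 (λ a b L → a :+ (con 1 :+ L) :* b := (a :+ L :* b) :+ b) refl (F (suc L)) (F L) L ⟩
    (F (suc L) + L * F L) + F L ≡⟨ cong (λ x → (F (suc L) + x) + F L) (sym (*-suc∸1 L F)) ⟩
    addBlock≤2 (λ x → F (suc x)) L + F L ∎
    where open ≡-Reasoning
          open NSol.+-*-Solver

  addBlock-comm : ∀ (F : ℕ → ℕ) L → addBlock≤2 (addBlock≤3 F) L ≡ addBlock≤3 (addBlock≤2 F) L
  addBlock-comm F zero = refl
  addBlock-comm F (suc zero) = solve 2 (λ a b → (a :+ con 1 :* b :+ con 0 :* b) :+ con 1 :* (b :+ con 0 :* b :+ con 0 :* b)
                                  := (a :+ con 1 :* b) :+ con 1 :* (b :+ con 0 :* b) :+ con 0 :* (b :+ con 0 :* b)) refl (F 1) (F 0)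
    where open NSol.+-*-Solver
  addBlock-comm F (suc (suc zero)) = solve 3 (λ a b c → (a :+ con 2 :* b :+ con 1 :* c) :+ con 2 :* (b :+ con 1 :* c :+ con 0 :* c)
                                  := (a :+ con 2 :* b) :+ con 2 :* (b :+ con 1 :* c) :+ con 1 :* (c :+ con 0 :* c)) refl (F 2) (F 1) (F 0)
    where open NSol.+-*-Solver
  addBlock-comm F (suc (suc (suc L))) = begin
    (a + K * b + T3 * c) + K * (b + (2 + L) * c + T2 * d)
      ≡⟨ solve 8 (λ a b c d K L T2 T3 → (a :+ K :* b :+ T3 :* c) :+ K :* (b :+ (con 2 :+ L) :* c :+ T2 :* d)
                   := (a :+ K :* b) :+ K :* (b :+ (con 2 :+ L) :* c) :+ T3 :* c :+ (K :* T2) :* d) refl a b c d K L T2 T3 ⟩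
    (a + K * b) + K * (b + (2 + L) * c) + T3 * c + (K * T2) * d
      ≡⟨ cong (λ z → (a + K * b) + K * (b + (2 + L) * c) + T3 * c + z * d) key ⟩
    (a + K * b) + K * (b + (2 + L) * c) + T3 * c + (T3 * (1 + L)) * d
      ≡⟨ solve 8 (λ a b c d K L T2 T3 → (a :+ K :* b) :+ K :* (b :+ (con 2 :+ L) :* c) :+ T3 :* c :+ (T3 :* (con 1 :+ L)) :* d
                   := (a :+ K :* b) :+ K :* (b :+ (con 2 :+ L) :* c) :+ T3 :* (c :+ (con 1 :+ L) :* d)) refl a b c d K L T2 T3 ⟩
    (a + K * b) + K * (b + (2 + L) * c) + T3 * (c + (1 + L) * d) ∎
    where
    open ≡-Reasoning
    open NSol.+-*-Solver
    a = F (3 + L)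
    b = F (2 + L)
    c = F (1 + L)
    d = F L
    K = 3 + L
    T2 = choose₂ (2 + L)
    T3 = choose₂ (3 + L)
    key : K * T2 ≡ T3 * (1 + L)
    key = *-cancelʳ-≡ (K * T2) (T3 * (1 + L)) 2 (begin
      K * T2 * 2 ≡⟨ *-assoc K T2 2 ⟩
      K * (T2 * 2) ≡⟨ cong (K *_) (choose₂*2 (2 + L)) ⟩
      K * ((2 + L) * (1 + L)) ≡⟨ solve 1 (λ L → (con 3 :+ L) :* ((con 2 :+ L) :* (con 1 :+ L)) := ((con 3 :+ L) :* (con 2 :+ L)) :* (con 1 :+ L)) refl L ⟩
      (K * (2 + L)) * (1 + L) ≡⟨ cong (_* (1 + L)) (sym (choose₂*2 (3 + L))) ⟩
      (T3 * 2) * (1 + L) ≡⟨ solve 2 (λ T L → (T :* con 2) :* (con 1 :+ L) := T :* (con 1 :+ L) :* con 2) refl T3 L ⟩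
      T3 * (1 + L) * 2 ∎)

  extParts : ℕ → ℕ → ℕ → ℕ → ℕ
  extParts zero zero o = parts o
  extParts zero (suc q) o = addBlock≤2 (extParts zero q o)
  extParts (suc p) q o = addBlock≤3 (extParts p q o)

  addBlock≤2-extParts : ∀ p q o L → addBlock≤2 (extParts p q o) L ≡ extParts p (suc q) o L
  addBlock≤2-extParts zero q o L = refl
  addBlock≤2-extParts (suc p) q o L = trans (addBlock-comm (extParts p q o) L) (addBlock≤3-cong (addBlock≤2-extParts p q o) L)

  extParts-taken : ℕ → ℕ → ℕ → ℕ → ℕ
  extParts-taken zero p q L = 0
  extParts-taken (suc o) p q L = extParts (suc p) q o L

  extParts-suc : ∀ p q o L → extParts p q o (suc L) ≡ extParts-taken o p q L + p * extParts (p ∸ 1) (suc q) o L + q * extParts p (q ∸ 1) o L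
  extParts-suc zero zero zero L = refl
  extParts-suc zero zero (suc o) L = sym (trans (+-identityʳ _) (+-identityʳ _))
  extParts-suc zero (suc q) o L = begin
    addBlock≤2 (extParts 0 q o) (suc L) ≡⟨ addBlock≤2-shift (extParts 0 q o) L ⟩
    addBlock≤2 (λ x → extParts 0 q o (suc x)) L + extParts 0 q o L
      ≡⟨ cong (_+ extParts 0 q o L) (trans (addBlock≤2-cong (λ x → trans (extParts-suc 0 q o x) (sym (lin x))) L) (addBlock≤2-linear (extParts-taken o 0 q) (extParts 0 (suc q) o) (extParts 0 (q ∸ 1) o) 1 0 q L)) ⟩
    1 * addBlock≤2 (extParts-taken o 0 q) L + 0 * addBlock≤2 (extParts 0 (suc q) o) L + q * addBlock≤2 (extParts 0 (q ∸ 1) o) L + extParts 0 q o L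
      ≡⟨ cong₂ (λ x y → 1 * x + 0 * addBlock≤2 (extParts 0 (suc q) o) L + y + extParts 0 q o L) (e1 o) (e2 q) ⟩
    1 * extParts-taken o 0 (suc q) L + 0 * addBlock≤2 (extParts 0 (suc q) o) L + q * extParts 0 q o L + extParts 0 q o L
      ≡⟨ solve 4 (λ a b c q' → con 1 :* a :+ con 0 :* b :+ q' :* c :+ c := a :+ con 0 :* b :+ (con 1 :+ q') :* c) refl (extParts-taken o 0 (suc q) L) (addBlock≤2 (extParts 0 (suc q) o) L) (extParts 0 q o L) q ⟩
    extParts-taken o 0 (suc q) L + 0 * extParts 0 (suc (suc q)) o L + suc q * extParts 0 q o L ∎
    where
    open ≡-Reasoning
    open NSol.+-*-Solver
    lin : ∀ x → 1 * extParts-taken o 0 q x + 0 * extParts 0 (suc q) o x + q * extParts 0 (q ∸ 1) o x ≡ extParts-taken o 0 q x + 0 * extParts 0 (suc q) o x + q * extParts 0 (q ∸ 1) o x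
    lin x = cong (λ z → z + 0 * extParts 0 (suc q) o x + q * extParts 0 (q ∸ 1) o x) (*-identityˡ _)
    e1 : ∀ o → addBlock≤2 (extParts-taken o 0 q) L ≡ extParts-taken o 0 (suc q) L
    e1 zero = *-zeroʳ L
    e1 (suc o) = addBlock≤2-extParts 1 q o L
    e2 : ∀ q → q * addBlock≤2 (extParts 0 (q ∸ 1) o) L ≡ q * extParts 0 q o L
    e2 zero = refl
    e2 (suc q) = refl
  extParts-suc (suc p) q o L = begin
    addBlock≤3 (extParts p q o) (suc L) ≡⟨ addBlock≤3-shift (extParts p q o) L ⟩
    addBlock≤3 (λ x → extParts p q o (suc x)) L + addBlock≤2 (extParts p q o) L
      ≡⟨ cong₂ _+_ (trans (addBlock≤3-cong (λ x → trans (extParts-suc p q o x) (sym (lin x))) L) (addBlock≤3-linear (extParts-taken o p q) (extParts (p ∸ 1) (suc q) o) (extParts p (q ∸ 1) o) 1 p q L)) (addBlock≤2-extParts p q o L) ⟩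
    1 * addBlock≤3 (extParts-taken o p q) L + p * addBlock≤3 (extParts (p ∸ 1) (suc q) o) L + q * addBlock≤3 (extParts p (q ∸ 1) o) L + extParts p (suc q) o L
      ≡⟨ cong₂ (λ x y → 1 * x + y + q * addBlock≤3 (extParts p (q ∸ 1) o) L + extParts p (suc q) o L) (e1 o) (e2 p) ⟩
    1 * extParts-taken o (suc p) q L + p * extParts p (suc q) o L + q * extParts (suc p) (q ∸ 1) o L + extParts p (suc q) o L
      ≡⟨ solve 5 (λ a b c p q → con 1 :* a :+ p :* b :+ q :* c :+ b := a :+ (con 1 :+ p) :* b :+ q :* c) refl (extParts-taken o (suc p) q L) (extParts p (suc q) o L) (extParts (suc p) (q ∸ 1) o L) p q ⟩
    extParts-taken o (suc p) q L + suc p * extParts p (suc q) o L + q * extParts (suc p) (q ∸ 1) o L ∎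
    where
    open ≡-Reasoning
    open NSol.+-*-Solver
    lin : ∀ x → 1 * extParts-taken o p q x + p * extParts (p ∸ 1) (suc q) o x + q * extParts p (q ∸ 1) o x ≡ extParts-taken o p q x + p * extParts (p ∸ 1) (suc q) o x + q * extParts p (q ∸ 1) o x
    lin x = cong (λ z → z + p * extParts (p ∸ 1) (suc q) o x + q * extParts p (q ∸ 1) o x) (*-identityˡ _)
    e1 : ∀ o → addBlock≤3 (extParts-taken o p q) L ≡ extParts-taken o (suc p) q L
    e1 zero = trans (cong₂ _+_ (*-zeroʳ L) (*-zeroʳ (choose₂ L))) refl
    e1 (suc o) = refl
    e2 : ∀ p → p * addBlock≤3 (extParts (p ∸ 1) (suc q) o) L ≡ p * extParts p (suc q) o L
    e2 zero = refl
    e2 (suc p) = refl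

  -- Scenarios with fuel f and r gifts still in the pool, where p unwrapped gifts were never stolen and q once.
  stealCount : ℕ → ℕ → ℕ → ℕ → ℕ
  stealCount f p q zero = 1
  stealCount zero p q (suc r) = 0
  stealCount (suc f) p q (suc r) = stealCount f (suc p) q r + p * stealCount f (p ∸ 1) (suc q) (suc r) + q * stealCount f p (q ∸ 1) (suc r)

  extParts-0 : ∀ p q o → extParts p q o 0 ≡ parts o 0
  extParts-0 zero zero o = refl
  extParts-0 zero (suc q) o = trans (+-identityʳ _) (extParts-0 zero q o)
  extParts-0 (suc p) q o = trans (trans (+-identityʳ _) (+-identityʳ _)) (extParts-0 p q o)

  stealCount≡sumTo : ∀ f p q o → stealCount f p q (suc o) ≡ sumTo f (extParts p q o)
  stealCount≡sumTo zero p q o = refl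
  stealCount≡sumTo (suc f) p q o = sym (begin
    sumTo (suc f) (extParts p q o) ≡⟨ sumTo-shift f (extParts p q o) ⟩
    extParts p q o 0 + sumTo f (λ L → extParts p q o (suc L)) ≡⟨ cong₂ _+_ (extParts-0 p q o) (sumTo-cong f (extParts-suc p q o)) ⟩
    parts o 0 + sumTo f (λ L → extParts-taken o p q L + p * extParts (p ∸ 1) (suc q) o L + q * extParts p (q ∸ 1) o L)
      ≡⟨ cong (parts o 0 +_) (trans (sumTo-+ f (λ L → extParts-taken o p q L + p * extParts (p ∸ 1) (suc q) o L) (λ L → q * extParts p (q ∸ 1) o L))
          (cong₂ _+_ (trans (sumTo-+ f (extParts-taken o p q) (λ L → p * extParts (p ∸ 1) (suc q) o L)) (cong (sumTo f (extParts-taken o p q) +_) (sumTo-* f p _))) (sumTo-* f q _))) ⟩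
    parts o 0 + (sumTo f (extParts-taken o p q) + p * sumTo f (extParts (p ∸ 1) (suc q) o) + q * sumTo f (extParts p (q ∸ 1) o))
      ≡⟨ sym (+-assoc (parts o 0) _ _) ∙ cong (_+ q * sumTo f (extParts p (q ∸ 1) o)) (sym (+-assoc (parts o 0) _ _)) ⟩
    parts o 0 + sumTo f (extParts-taken o p q) + p * sumTo f (extParts (p ∸ 1) (suc q) o) + q * sumTo f (extParts p (q ∸ 1) o)
      ≡⟨ cong₂ (λ x y → x + p * y + q * sumTo f (extParts p (q ∸ 1) o)) (first o) (sym (stealCount≡sumTo f (p ∸ 1) (suc q) o)) ⟩
    stealCount f (suc p) q o + p * stealCount f (p ∸ 1) (suc q) (suc o) + q * sumTo f (extParts p (q ∸ 1) o)
      ≡⟨ cong (λ y → stealCount f (suc p) q o + p * stealCount f (p ∸ 1) (suc q) (suc o) + q * y) (sym (stealCount≡sumTo f p (q ∸ 1) o)) ⟩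
    stealCount f (suc p) q o + p * stealCount f (p ∸ 1) (suc q) (suc o) + q * stealCount f p (q ∸ 1) (suc o) ∎)
    where
    open ≡-Reasoning
    _∙_ = trans
    first : ∀ o → parts o 0 + sumTo f (extParts-taken o p q) ≡ stealCount f (suc p) q o
    first zero = cong suc (sumTo-zero f (λ _ → 0) (λ _ _ → refl))
    first (suc o) = sym (stealCount≡sumTo f (suc p) q o)


module GiftExchange where

  open import Defs
  open StealRecurrence using (stealCount)
  open SetPartitions using (sumL; 𝟙; sumL-++; sumL-map; sumL-cong; sumL-zero; sumL-+; countB-sumL; countB-map; ==ℕ≡; ==ℕ-suc; ≤ℕ≡; T→≡; ¬T→≡)
  open import Data.Bool as B using (Bool; true; false; _∧_; not; if_then_else_; T)
  open import Data.Bool.Properties using (∧-zeroʳ)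
  open import Data.Nat as ℕ using (ℕ; zero; suc; _+_; _*_; _∸_; _<_; _≤_)
  import Data.Nat.Properties as ℕP
  open import Data.Fin as Fin using (Fin; toℕ)
  import Data.Fin.Properties as FinP
  open import Data.List as List using (List; []; _∷_; _++_; map; length; filter; allFin; tabulate; concatMap)
  open import Data.List.Properties using (≡-dec)
  open import Data.Vec as Vec using (Vec; []; _∷_; lookup; replicate; _[_]≔_)
  import Data.Vec.Properties as VecP
  open import Data.Maybe using (Maybe; just; nothing)
  open import Relation.Binary.PropositionalEquality
  open import Relation.Nullary using (Dec; yes; no; ¬_; does)
  open import Data.Empty using (⊥-elim; ⊥)
  open import Data.Product using (_×_; _,_; proj₁; proj₂)
  import Data.Nat.Solver as NSol

  open GameState

  length-filter-dec : ∀ {a p} {A : Set a} {P : A → Set p} (P? : (x : A) → Dec (P x)) xs →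
    length (filter P? xs) ≡ countB (λ x → does (P? x)) xs
  length-filter-dec P? [] = refl
  length-filter-dec P? (x ∷ xs) with does (P? x)
  ... | true = cong suc (length-filter-dec P? xs)
  ... | false = length-filter-dec P? xs

  filter-sumL : ∀ {a p} {A : Set a} {P : A → Set p} (P? : (x : A) → Dec (P x)) xs (g : A → ℕ) →
    sumL (filter P? xs) g ≡ sumL xs (λ x → if does (P? x) then g x else 0)
  filter-sumL P? [] g = refl
  filter-sumL P? (x ∷ xs) g with does (P? x)
  ... | true = cong (g x +_) (filter-sumL P? xs g)
  ... | false = filter-sumL P? xs g

  countB-concatMap : ∀ {a b} {A : Set a} {C : Set b} (P : C → Bool) (h : A → List C) xs →
    countB P (concatMap h xs) ≡ sumL xs (λ x → countB P (h x))
  countB-concatMap P h [] = refl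
  countB-concatMap P h (x ∷ xs) = trans (cnt++ (h x) (concatMap h xs)) (cong (countB P (h x) +_) (countB-concatMap P h xs))
    where
    cnt++ : ∀ ys zs → countB P (ys ++ zs) ≡ countB P ys + countB P zs
    cnt++ [] zs = refl
    cnt++ (y ∷ ys) zs with P y
    ... | true = cong suc (cnt++ ys zs)
    ... | false = cnt++ ys zs

  countB-cong : ∀ {a} {A : Set a} (xs : List A) {P Q : A → Bool} → (∀ x → P x ≡ Q x) → countB P xs ≡ countB Q xs
  countB-cong [] e = refl
  countB-cong (x ∷ xs) {P} {Q} e with P x | Q x | e x
  ... | true | true | refl = cong suc (countB-cong xs e)
  ... | false | false | refl = countB-cong xs e

  countB-∧ : ∀ {a} {A : Set a} (xs : List A) (b : Bool) (P : A → Bool) → countB (λ x → b ∧ P x) xs ≡ (if b then countB P xs else 0)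
  countB-∧ xs true P = refl
  countB-∧ [] false P = refl
  countB-∧ (x ∷ xs) false P = countB-∧ xs false P

  false≢true : false ≡ true → ⊥
  false≢true ()

  sameList : List ℕ → List ℕ → Bool
  sameList [] [] = true
  sameList [] (_ ∷ _) = false
  sameList (_ ∷ _) [] = false
  sameList (x ∷ xs) (y ∷ ys) = (x ==ℕ y) ∧ sameList xs ys

  sameList-refl : ∀ xs → sameList xs xs ≡ true
  sameList-refl [] = refl
  sameList-refl (x ∷ xs) = cong₂ _∧_ (trans (==ℕ≡ x x) (T→≡ (ℕP.≡⇒≡ᵇ x x refl))) (sameList-refl xs)

  ==ℕ-sound : ∀ x y → (x ==ℕ y) ≡ true → x ≡ y
  ==ℕ-sound x y e = ℕP.≡ᵇ⇒≡ x y (subst T (sym (trans (sym (==ℕ≡ x y)) e)) _)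

  sameList-sound : ∀ {m} (xs ys : List (Fin m)) → sameList (map toℕ xs) (map toℕ ys) ≡ true → xs ≡ ys
  sameList-sound [] [] e = refl
  sameList-sound [] (y ∷ ys) ()
  sameList-sound (x ∷ xs) [] ()
  sameList-sound (x ∷ xs) (y ∷ ys) e = cong₂ _∷_ (FinP.toℕ-injective (==ℕ-sound _ _ (∧-l _ _ e))) (sameList-sound xs ys (∧-r _ _ e))
    where
    ∧-l : ∀ a b → a ∧ b ≡ true → a ≡ true
    ∧-l true b e = refl
    ∧-r : ∀ a b → a ∧ b ≡ true → b ≡ true
    ∧-r true b e = e

  does-≡-dec : ∀ {m} (xs ys : List (Fin m)) → does (≡-dec FinP._≟_ xs ys) ≡ sameList (map toℕ xs) (map toℕ ys)
  does-≡-dec xs ys with ≡-dec FinP._≟_ xs ys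
  ... | yes refl = sym (sameList-refl (map toℕ xs))
  ... | no ¬p with sameList (map toℕ xs) (map toℕ ys) | inspect (sameList (map toℕ xs)) (map toℕ ys)
  ...   | true | [ e ] = ⊥-elim (¬p (sameList-sound xs ys e))
  ...   | false | _ = refl

  scenariosFrom-finished : ∀ {m} σ f (s : GameState m) → poolEmpty s ≡ true → scenariosFrom σ f s ≡ [] ∷ []
  scenariosFrom-finished σ f s e rewrite e = refl

  scenariosFrom-noFuel : ∀ {m} σ (s : GameState m) → poolEmpty s ≡ false → scenariosFrom σ 0 s ≡ []
  scenariosFrom-noFuel σ s e rewrite e = refl

  scenariosFrom-suc : ∀ {m} σ f (s : GameState m) → poolEmpty s ≡ false →
    scenariosFrom σ (suc f) s ≡ concatMap (λ mv → map (mv ∷_) (scenariosFrom σ f (step s mv))) (legalMoves σ s)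
  scenariosFrom-suc σ f s e rewrite e = refl

  range : ℕ → ℕ → List ℕ
  range j zero = []
  range j (suc r) = j ∷ range (suc j) r

  scenarioCount : ∀ {m} → ℕ → GameState m → ℕ → ℕ → ℕ
  scenarioCount f s j r = countB (λ ms → sameList (map toℕ (takenGifts ms)) (range j r)) (scenariosFrom 2 f s)

  moveCount : ∀ {m} → ℕ → GameState m → ℕ → ℕ → Move m → ℕ
  moveCount f s j r (take g) = if (toℕ g ==ℕ j) then scenarioCount f (step s (take g)) (suc j) r else 0
  moveCount f s j r (steal g) = scenarioCount f (step s (steal g)) j (suc r)

  scenarioCount-finished : ∀ {m} f (s : GameState m) j → poolEmpty s ≡ true → scenarioCount f s j 0 ≡ 1
  scenarioCount-finished f s j e rewrite scenariosFrom-finished 2 f s e = refl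

  scenarioCount-noFuel : ∀ {m} (s : GameState m) j r → poolEmpty s ≡ false → scenarioCount 0 s j r ≡ 0
  scenarioCount-noFuel s j r e rewrite scenariosFrom-noFuel 2 s e = refl

  scenarioCount-suc : ∀ {m} f (s : GameState m) j r → poolEmpty s ≡ false →
    scenarioCount (suc f) s j (suc r) ≡ sumL (legalMoves 2 s) (moveCount f s j r)
  scenarioCount-suc f s j r e = begin
    countB P (scenariosFrom 2 (suc f) s) ≡⟨ cong (countB P) (scenariosFrom-suc 2 f s e) ⟩
    countB P (concatMap (λ mv → map (mv ∷_) (scenariosFrom 2 f (step s mv))) (legalMoves 2 s))
      ≡⟨ countB-concatMap P _ (legalMoves 2 s) ⟩
    sumL (legalMoves 2 s) (λ mv → countB P (map (mv ∷_) (scenariosFrom 2 f (step s mv))))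
      ≡⟨ sumL-cong (legalMoves 2 s) (λ mv → trans (countB-map P (mv ∷_) (scenariosFrom 2 f (step s mv))) (each mv)) ⟩
    sumL (legalMoves 2 s) (moveCount f s j r) ∎
    where
    open ≡-Reasoning
    P = λ ms → sameList (map toℕ (takenGifts ms)) (range j (suc r))
    each : ∀ mv → countB (λ ms → P (mv ∷ ms)) (scenariosFrom 2 f (step s mv)) ≡ moveCount f s j r mv
    each (take g) = countB-∧ (scenariosFrom 2 f (step s (take g))) (toℕ g ==ℕ j) _
    each (steal g) = refl

  doesT : ∀ b → does (b B.≟ true) ≡ b
  doesT true = refl
  doesT false = refl

  scenarioCount-suc-gifts : ∀ {m} f (s : GameState m) j r → poolEmpty s ≡ false →
    scenarioCount (suc f) s j (suc r) ≡
      sumL (allFin m) (λ g → if inPool s g then (if (toℕ g ==ℕ j) then scenarioCount f (step s (take g)) (suc j) r else 0) else 0)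
    + sumL (allFin m) (λ g → if stealable 2 s g then scenarioCount f (step s (steal g)) j (suc r) else 0)
  scenarioCount-suc-gifts {m} f s j r e = begin
    scenarioCount (suc f) s j (suc r) ≡⟨ scenarioCount-suc f s j r e ⟩
    sumL (map take closedForm-singleton ++ map steal ST) (moveCount f s j r) ≡⟨ sumL-++ (map take closedForm-singleton) _ _ ⟩
    sumL (map take closedForm-singleton) (moveCount f s j r) + sumL (map steal ST) (moveCount f s j r)
      ≡⟨ cong₂ _+_ (trans (sumL-map take closedForm-singleton _) (filter-sumL (λ g → inPool s g B.≟ true) (allFin m) _))
                   (trans (sumL-map steal ST _) (filter-sumL (λ g → stealable 2 s g B.≟ true) (allFin m) _)) ⟩
    sumL (allFin m) (λ g → if does (inPool s g B.≟ true) then moveCount f s j r (take g) else 0)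
    + sumL (allFin m) (λ g → if does (stealable 2 s g B.≟ true) then moveCount f s j r (steal g) else 0)
      ≡⟨ cong₂ _+_ (sumL-cong (allFin m) (λ g → cong (λ b → if b then moveCount f s j r (take g) else 0) (doesT (inPool s g))))
                   (sumL-cong (allFin m) (λ g → cong (λ b → if b then moveCount f s j r (steal g) else 0) (doesT (stealable 2 s g)))) ⟩
    _ ∎
    where
    open ≡-Reasoning
    closedForm-singleton = filter (λ g → inPool s g B.≟ true) (allFin m)
    ST = filter (λ g → stealable 2 s g B.≟ true) (allFin m)

  sumL-tabulate : ∀ {a} {A : Set a} n (f : Fin n → A) (φ : A → ℕ) → sumL (tabulate f) φ ≡ sumL (allFin n) (λ i → φ (f i))
  sumL-tabulate zero f φ = refl
  sumL-tabulate (suc n) f φ = cong (φ (f Fin.zero) +_) (trans (sumL-tabulate n (λ i → f (Fin.suc i)) φ) (sym (sumL-tabulate n Fin.suc (λ i → φ (f i)))))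

  sumL-allFin-suc : ∀ n (φ : Fin (suc n) → ℕ) → sumL (allFin (suc n)) φ ≡ φ Fin.zero + sumL (allFin n) (λ i → φ (Fin.suc i))
  sumL-allFin-suc n φ = cong (φ Fin.zero +_) (sumL-tabulate n Fin.suc φ)

  sumL-allFin-single : ∀ n (φ : Fin n → ℕ) g0 → (∀ g → ¬ g ≡ g0 → φ g ≡ 0) → sumL (allFin n) φ ≡ φ g0
  sumL-allFin-single (suc n) φ Fin.zero e = trans (sumL-allFin-suc n φ)
    (trans (cong (φ Fin.zero +_) (sumL-zero (allFin n) (λ i → e (Fin.suc i) (λ ())))) (ℕP.+-identityʳ _))
  sumL-allFin-single (suc n) φ (Fin.suc g0) e = trans (sumL-allFin-suc n φ)
    (cong₂ _+_ (e Fin.zero (λ ())) (sumL-allFin-single n (λ i → φ (Fin.suc i)) g0 (λ g ne → e (Fin.suc g) (λ eq → ne (FinP.suc-injective eq)))))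

  sumL-allFin-swap : ∀ n (φ ψ : Fin n → ℕ) g0 → (∀ g → ¬ g ≡ g0 → φ g ≡ ψ g) →
    sumL (allFin n) φ + ψ g0 ≡ sumL (allFin n) ψ + φ g0
  sumL-allFin-swap (suc n) φ ψ Fin.zero e = begin
    sumL (allFin (suc n)) φ + ψ Fin.zero ≡⟨ cong (_+ ψ Fin.zero) (sumL-allFin-suc n φ) ⟩
    φ Fin.zero + sumL (allFin n) (λ i → φ (Fin.suc i)) + ψ Fin.zero
      ≡⟨ cong (λ z → φ Fin.zero + z + ψ Fin.zero) (sumL-cong (allFin n) (λ i → e (Fin.suc i) (λ ()))) ⟩
    φ Fin.zero + sumL (allFin n) (λ i → ψ (Fin.suc i)) + ψ Fin.zero
      ≡⟨ solve 3 (λ a b c → (a :+ b) :+ c := (c :+ b) :+ a) refl (φ Fin.zero) _ (ψ Fin.zero) ⟩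
    ψ Fin.zero + sumL (allFin n) (λ i → ψ (Fin.suc i)) + φ Fin.zero ≡⟨ cong (_+ φ Fin.zero) (sym (sumL-allFin-suc n ψ)) ⟩
    sumL (allFin (suc n)) ψ + φ Fin.zero ∎
    where
    open ≡-Reasoning
    open NSol.+-*-Solver
  sumL-allFin-swap (suc n) φ ψ (Fin.suc g0) e = begin
    sumL (allFin (suc n)) φ + ψ (Fin.suc g0) ≡⟨ cong (_+ ψ (Fin.suc g0)) (sumL-allFin-suc n φ) ⟩
    φ Fin.zero + sumL (allFin n) (λ i → φ (Fin.suc i)) + ψ (Fin.suc g0) ≡⟨ ℕP.+-assoc (φ Fin.zero) _ _ ⟩
    φ Fin.zero + (sumL (allFin n) (λ i → φ (Fin.suc i)) + ψ (Fin.suc g0))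
      ≡⟨ cong₂ _+_ (e Fin.zero (λ ())) (sumL-allFin-swap n (λ i → φ (Fin.suc i)) (λ i → ψ (Fin.suc i)) g0 (λ g ne → e (Fin.suc g) (λ eq → ne (FinP.suc-injective eq)))) ⟩
    ψ Fin.zero + (sumL (allFin n) (λ i → ψ (Fin.suc i)) + φ (Fin.suc g0)) ≡⟨ sym (ℕP.+-assoc (ψ Fin.zero) _ _) ⟩
    ψ Fin.zero + sumL (allFin n) (λ i → ψ (Fin.suc i)) + φ (Fin.suc g0) ≡⟨ cong (_+ φ (Fin.suc g0)) (sym (sumL-allFin-suc n ψ)) ⟩
    sumL (allFin (suc n)) ψ + φ (Fin.suc g0) ∎
    where open ≡-Reasoning

  stealable-wrapped : ∀ {m} (s : GameState m) g → lookup (holder s) g ≡ nothing → stealable 2 s g ≡ false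
  stealable-wrapped s g e rewrite e = refl

  stealable-held : ∀ {m} (s : GameState m) g q → lookup (holder s) g ≡ just q →
    stealable 2 s g ≡ not (q ==ℕ mover s) ∧ (suc (lookup (steals s) g) ≤ℕ 2)
  stealable-held s g q e rewrite e = refl

  step-steal : ∀ {m} (s : GameState m) g q → lookup (holder s) g ≡ just q →
    step s (steal g) ≡ record s { holder = holder s [ g ]≔ just (mover s)
                               ; steals = steals s [ g ]≔ suc (lookup (steals s) g)
                               ; mover = q }
  step-steal s g q e rewrite e = refl

  record Invariant {m} (s : GameState m) (j : ℕ) : Set where
    field
      pool : ∀ g → inPool s g ≡ (j ≤ℕ toℕ g)
      movfree : ∀ g → ¬ lookup (holder s) g ≡ just (mover s)
      inj : ∀ g g' q → lookup (holder s) g ≡ just q → lookup (holder s) g' ≡ just q → g ≡ g'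
      below : ∀ g q → lookup (holder s) g ≡ just q → q < called s
      movbelow : mover s < called s
      st0 : ∀ g → lookup (holder s) g ≡ nothing → lookup (steals s) g ≡ 0

  isTaken : ∀ {m} → GameState m → Fin m → Bool
  isTaken s g = not (inPool s g)

  isUnstolen isStolenOnce : ∀ {m} → GameState m → Fin m → Bool
  isUnstolen s g = isTaken s g ∧ (lookup (steals s) g ==ℕ 0)
  isStolenOnce s g = isTaken s g ∧ (lookup (steals s) g ==ℕ 1)

  unstolen stolenOnce : ∀ {m} → GameState m → ℕ
  unstolen {m} s = countB (isUnstolen s) (allFin m)
  stolenOnce {m} s = countB (isStolenOnce s) (allFin m)

  ≤ℕ-true : ∀ a b → a ≤ b → (a ≤ℕ b) ≡ true
  ≤ℕ-true a b le = trans (≤ℕ≡ a b) (T→≡ (ℕP.≤⇒≤ᵇ le))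

  ≤ℕ-false : ∀ a b → ¬ a ≤ b → (a ≤ℕ b) ≡ false
  ≤ℕ-false a b nle = trans (≤ℕ≡ a b) (¬T→≡ (λ t → nle (ℕP.≤ᵇ⇒≤ a b t)))

  ≤ℕ-ne : ∀ j t → ¬ t ≡ j → (j ≤ℕ t) ≡ (suc j ≤ℕ t)
  ≤ℕ-ne j t ne = go (j ℕP.≤? t)
    where
    go : Dec (j ≤ t) → (j ≤ℕ t) ≡ (suc j ≤ℕ t)
    go (yes le) = trans (≤ℕ-true j t le) (sym (≤ℕ-true (suc j) t (ℕP.≤∧≢⇒< le (λ e → ne (sym e)))))
    go (no nle) = trans (≤ℕ-false j t nle) (sym (≤ℕ-false (suc j) t (λ le → nle (ℕP.<⇒≤ le))))

  ==ℕ-true : ∀ a → (a ==ℕ a) ≡ true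
  ==ℕ-true a = trans (==ℕ≡ a a) (T→≡ (ℕP.≡⇒≡ᵇ a a refl))

  ==ℕ-false : ∀ a b → ¬ a ≡ b → (a ==ℕ b) ≡ false
  ==ℕ-false a b ne = trans (==ℕ≡ a b) (¬T→≡ (λ t → ne (ℕP.≡ᵇ⇒≡ a b t)))

  isNothingB : Maybe ℕ → Bool
  isNothingB nothing = true
  isNothingB (just _) = false

  inPool≡ : ∀ {m} (s : GameState m) g → inPool s g ≡ isNothingB (lookup (holder s) g)
  inPool≡ s g with lookup (holder s) g
  ... | nothing = refl
  ... | just _ = refl

  pool-nothing : ∀ {m} (s : GameState m) g → inPool s g ≡ true → lookup (holder s) g ≡ nothing
  pool-nothing s g e with lookup (holder s) g | inPool≡ s g
  ... | nothing | _ = refl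
  ... | just q | e' = ⊥-elim (false≢true (trans (sym e') e))

  allB-true : ∀ {a} {A : Set a} (p : A → Bool) xs → (∀ x → p x ≡ true) → allB p xs ≡ true
  allB-true p [] e = refl
  allB-true p (x ∷ xs) e = cong₂ _∧_ (e x) (allB-true p xs e)

  allB-allFin-false : ∀ n (p : Fin n → Bool) g0 → p g0 ≡ false → allB p (allFin n) ≡ false
  allB-allFin-false n p g0 e = trans (allB-tab' n p) (go n p g0 e)
    where
    allB-tab' : ∀ n (p : Fin n → Bool) → allB p (allFin n) ≡ SetPartitions.allFinB n p
    allB-tab' n p = SetPartitions.allB-tabulate n p (λ i → i)
    go : ∀ n (p : Fin n → Bool) g0 → p g0 ≡ false → SetPartitions.allFinB n p ≡ false
    go (suc n) p Fin.zero e = cong (_∧ SetPartitions.allFinB n (λ i → p (Fin.suc i))) e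
    go (suc n) p (Fin.suc g0) e = trans (cong (p Fin.zero ∧_) (go n (λ i → p (Fin.suc i)) g0 e)) (∧-zeroʳ (p Fin.zero))

  if-const0 : ∀ (b : Bool) → (if b then 0 else 0) ≡ 0
  if-const0 true = refl
  if-const0 false = refl

  lookup-update-same : ∀ {A : Set} {m} (v : Vec A m) g x → lookup (v [ g ]≔ x) g ≡ x
  lookup-update-same v g x = VecP.lookup∘update g v x

  lookup-update-other : ∀ {A : Set} {m} (v : Vec A m) g0 g x → ¬ g ≡ g0 → lookup (v [ g0 ]≔ x) g ≡ lookup v g
  lookup-update-other v g0 g x ne = VecP.lookup∘update′ {i = g} {j = g0} ne v x

  just-inj : ∀ {a b : ℕ} → just a ≡ just b → a ≡ b
  just-inj refl = refl

  just≢nothing : ∀ {a : ℕ} → ¬ just a ≡ nothing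
  just≢nothing ()

  module TakeStep {m} (s : GameState m) (j : ℕ) (g0 : Fin m) (I : Invariant s j) (tg : toℕ g0 ≡ j) where
    open Invariant I
    s' : GameState m
    s' = step s (take g0)

    h0 : lookup (holder s) g0 ≡ nothing
    h0 = pool-nothing s g0 (trans (pool g0) (trans (cong (j ≤ℕ_) tg) (≤ℕ-true j j ℕP.≤-refl)))

    hs : lookup (holder s') g0 ≡ just (mover s)
    hs = lookup-update-same (holder s) g0 (just (mover s))

    ho : ∀ g → ¬ g ≡ g0 → lookup (holder s') g ≡ lookup (holder s) g
    ho g ne = lookup-update-other (holder s) g0 g (just (mover s)) ne

    inv : Invariant s' (suc j)
    inv = record
      { pool = λ g → pool' g (g FinP.≟ g0)
      ; movfree = λ g → mf g (g FinP.≟ g0)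
      ; inj = λ g g' q → ij g g' q (g FinP.≟ g0) (g' FinP.≟ g0)
      ; below = λ g q → bl g q (g FinP.≟ g0)
      ; movbelow = ℕP.≤-refl
      ; st0 = λ g → s0 g (g FinP.≟ g0) }
      where
      pool' : ∀ g → Dec (g ≡ g0) → inPool s' g ≡ (suc j ≤ℕ toℕ g)
      pool' g (yes refl) = trans (inPool≡ s' g) (trans (cong isNothingB hs) (sym (≤ℕ-false (suc j) (toℕ g) (λ le → ℕP.<-irrefl (sym tg) le))))
      pool' g (no ne) = trans (inPool≡ s' g) (trans (cong isNothingB (ho g ne)) (trans (sym (inPool≡ s g))
                          (trans (pool g) (≤ℕ-ne j (toℕ g) (λ e → ne (FinP.toℕ-injective (trans e (sym tg))))))))
      mf : ∀ g → Dec (g ≡ g0) → ¬ lookup (holder s') g ≡ just (called s)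
      mf g (yes refl) e = ℕP.<-irrefl (just-inj (trans (sym hs) e)) movbelow
      mf g (no ne) e = ℕP.<-irrefl refl (below g (called s) (trans (sym (ho g ne)) e))
      ij : ∀ g g' q → Dec (g ≡ g0) → Dec (g' ≡ g0) → lookup (holder s') g ≡ just q → lookup (holder s') g' ≡ just q → g ≡ g'
      ij g g' q (yes refl) (yes refl) _ _ = refl
      ij g g' q (yes refl) (no ne') e e' = ⊥-elim (movfree g' (trans (sym (ho g' ne')) (trans e' (trans (sym e) hs))))
      ij g g' q (no ne) (yes refl) e e' = ⊥-elim (movfree g (trans (sym (ho g ne)) (trans e (trans (sym e') hs))))
      ij g g' q (no ne) (no ne') e e' = inj g g' q (trans (sym (ho g ne)) e) (trans (sym (ho g' ne')) e')
      bl : ∀ g q → Dec (g ≡ g0) → lookup (holder s') g ≡ just q → q < suc (called s)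
      bl g q (yes refl) e = ℕP.m≤n⇒m≤1+n (subst (_< called s) (just-inj (trans (sym hs) e)) movbelow)
      bl g q (no ne) e = ℕP.m≤n⇒m≤1+n (below g q (trans (sym (ho g ne)) e))
      s0 : ∀ g → Dec (g ≡ g0) → lookup (holder s') g ≡ nothing → lookup (steals s') g ≡ 0
      s0 g (yes refl) e = ⊥-elim (just≢nothing (trans (sym hs) e))
      s0 g (no ne) e = st0 g (trans (sym (ho g ne)) e)

    tk0 : isTaken s g0 ≡ false
    tk0 = cong not (trans (inPool≡ s g0) (cong isNothingB h0))
    tk1 : isTaken s' g0 ≡ true
    tk1 = cong not (trans (inPool≡ s' g0) (cong isNothingB hs))
    tko : ∀ g → ¬ g ≡ g0 → isTaken s' g ≡ isTaken s g
    tko g ne = cong not (trans (inPool≡ s' g) (trans (cong isNothingB (ho g ne)) (sym (inPool≡ s g))))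

    ψ1 : 𝟙 (isUnstolen s' g0) ≡ 1
    ψ1 = cong 𝟙 (cong₂ _∧_ tk1 (cong (_==ℕ 0) (st0 g0 h0)))
    φ0 : 𝟙 (isUnstolen s g0) ≡ 0
    φ0 = cong 𝟙 (cong (_∧ (lookup (steals s) g0 ==ℕ 0)) tk0)
    ψB : 𝟙 (isStolenOnce s' g0) ≡ 0
    ψB = cong 𝟙 (cong₂ _∧_ tk1 (cong (_==ℕ 1) (st0 g0 h0)))
    φB : 𝟙 (isStolenOnce s g0) ≡ 0
    φB = cong 𝟙 (cong (_∧ (lookup (steals s) g0 ==ℕ 1)) tk0)

    unstolen-take : unstolen s' ≡ suc (unstolen s)
    unstolen-take = trans (sym (ℕP.+-identityʳ (unstolen s'))) (trans (sym E') (ℕP.+-comm (unstolen s) 1))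
      where
      E' : unstolen s + 1 ≡ unstolen s' + 0
      E' = trans (cong₂ _+_ (countB-sumL (isUnstolen s) (allFin m)) (sym ψ1))
            (trans (sumL-allFin-swap m (λ g → 𝟙 (isUnstolen s g)) (λ g → 𝟙 (isUnstolen s' g)) g0 (λ g ne → cong (λ b → 𝟙 (b ∧ (lookup (steals s) g ==ℕ 0))) (sym (tko g ne))))
              (cong₂ _+_ (sym (countB-sumL (isUnstolen s') (allFin m))) φ0))

    stolenOnce-take : stolenOnce s' ≡ stolenOnce s
    stolenOnce-take = trans (sym (ℕP.+-identityʳ (stolenOnce s'))) (trans (sym E') (ℕP.+-identityʳ (stolenOnce s)))
      where
      E' : stolenOnce s + 0 ≡ stolenOnce s' + 0
      E' = trans (cong₂ _+_ (countB-sumL (isStolenOnce s) (allFin m)) (sym ψB))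
            (trans (sumL-allFin-swap m (λ g → 𝟙 (isStolenOnce s g)) (λ g → 𝟙 (isStolenOnce s' g)) g0 (λ g ne → cong (λ b → 𝟙 (b ∧ (lookup (steals s) g ==ℕ 1))) (sym (tko g ne))))
              (cong₂ _+_ (sym (countB-sumL (isStolenOnce s') (allFin m))) φB))

  module StealStep {m} (s : GameState m) (j : ℕ) (g : Fin m) (q : ℕ) (I : Invariant s j) (hg : lookup (holder s) g ≡ just q) where
    open Invariant I
    st = lookup (steals s) g
    r' : GameState m
    r' = record s { holder = holder s [ g ]≔ just (mover s)
                  ; steals = steals s [ g ]≔ suc st
                  ; mover = q }

    eqs : step s (steal g) ≡ r'
    eqs = step-steal s g q hg

    hs : lookup (holder r') g ≡ just (mover s)
    hs = lookup-update-same (holder s) g (just (mover s))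
    ho : ∀ g' → ¬ g' ≡ g → lookup (holder r') g' ≡ lookup (holder s) g'
    ho g' ne = lookup-update-other (holder s) g g' (just (mover s)) ne
    ss : lookup (steals r') g ≡ suc st
    ss = lookup-update-same (steals s) g (suc st)
    so : ∀ g' → ¬ g' ≡ g → lookup (steals r') g' ≡ lookup (steals s) g'
    so g' ne = lookup-update-other (steals s) g g' (suc st) ne

    q≢mv : ¬ q ≡ mover s
    q≢mv e = movfree g (trans hg (cong just e))

    inv : Invariant r' j
    inv = record
      { pool = λ g' → pl g' (g' FinP.≟ g)
      ; movfree = λ g' → mf g' (g' FinP.≟ g)
      ; inj = λ g1 g2 q' → ij g1 g2 q' (g1 FinP.≟ g) (g2 FinP.≟ g)
      ; below = λ g' q' → bl g' q' (g' FinP.≟ g)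
      ; movbelow = below g q hg
      ; st0 = λ g' → s0 g' (g' FinP.≟ g) }
      where
      pl : ∀ g' → Dec (g' ≡ g) → inPool r' g' ≡ (j ≤ℕ toℕ g')
      pl g' (yes refl) = trans (inPool≡ r' g') (trans (cong isNothingB hs) (trans (sym (cong isNothingB hg)) (trans (sym (inPool≡ s g')) (pool g'))))
      pl g' (no ne) = trans (inPool≡ r' g') (trans (cong isNothingB (ho g' ne)) (trans (sym (inPool≡ s g')) (pool g')))
      mf : ∀ g' → Dec (g' ≡ g) → ¬ lookup (holder r') g' ≡ just q
      mf g' (yes refl) e = q≢mv (sym (just-inj (trans (sym hs) e)))
      mf g' (no ne) e = ne (inj g' g q (trans (sym (ho g' ne)) e) hg)
      ij : ∀ g1 g2 q' → Dec (g1 ≡ g) → Dec (g2 ≡ g) → lookup (holder r') g1 ≡ just q' → lookup (holder r') g2 ≡ just q' → g1 ≡ g2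
      ij g1 g2 q' (yes refl) (yes refl) _ _ = refl
      ij g1 g2 q' (yes refl) (no ne2) e1 e2 = ⊥-elim (movfree g2 (trans (sym (ho g2 ne2)) (trans e2 (trans (sym e1) hs))))
      ij g1 g2 q' (no ne1) (yes refl) e1 e2 = ⊥-elim (movfree g1 (trans (sym (ho g1 ne1)) (trans e1 (trans (sym e2) hs))))
      ij g1 g2 q' (no ne1) (no ne2) e1 e2 = inj g1 g2 q' (trans (sym (ho g1 ne1)) e1) (trans (sym (ho g2 ne2)) e2)
      bl : ∀ g' q' → Dec (g' ≡ g) → lookup (holder r') g' ≡ just q' → q' < called s
      bl g' q' (yes refl) e = subst (_< called s) (just-inj (trans (sym hs) e)) movbelow
      bl g' q' (no ne) e = below g' q' (trans (sym (ho g' ne)) e)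
      s0 : ∀ g' → Dec (g' ≡ g) → lookup (holder r') g' ≡ nothing → lookup (steals r') g' ≡ 0
      s0 g' (yes refl) e = ⊥-elim (just≢nothing (trans (sym hs) e))
      s0 g' (no ne) e = trans (so g' ne) (st0 g' (trans (sym (ho g' ne)) e))

    tkg : isTaken s g ≡ true
    tkg = cong not (trans (inPool≡ s g) (cong isNothingB hg))
    tkg' : isTaken r' g ≡ true
    tkg' = cong not (trans (inPool≡ r' g) (cong isNothingB hs))
    tko : ∀ g' → ¬ g' ≡ g → isTaken r' g' ≡ isTaken s g'
    tko g' ne = cong not (trans (inPool≡ r' g') (trans (cong isNothingB (ho g' ne)) (sym (inPool≡ s g'))))

    Ao : ∀ g' → ¬ g' ≡ g → 𝟙 (isUnstolen s g') ≡ 𝟙 (isUnstolen r' g')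
    Ao g' ne = cong 𝟙 (cong₂ _∧_ (sym (tko g' ne)) (cong (_==ℕ 0) (sym (so g' ne))))
    Bo : ∀ g' → ¬ g' ≡ g → 𝟙 (isStolenOnce s g') ≡ 𝟙 (isStolenOnce r' g')
    Bo g' ne = cong 𝟙 (cong₂ _∧_ (sym (tko g' ne)) (cong (_==ℕ 1) (sym (so g' ne))))

    pcE : unstolen s + 𝟙 (isUnstolen r' g) ≡ unstolen r' + 𝟙 (isUnstolen s g)
    pcE = trans (cong (_+ 𝟙 (isUnstolen r' g)) (countB-sumL (isUnstolen s) (allFin m)))
           (trans (sumL-allFin-swap m (λ g' → 𝟙 (isUnstolen s g')) (λ g' → 𝟙 (isUnstolen r' g')) g Ao)
             (cong (_+ 𝟙 (isUnstolen s g)) (sym (countB-sumL (isUnstolen r') (allFin m)))))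
    qcE : stolenOnce s + 𝟙 (isStolenOnce r' g) ≡ stolenOnce r' + 𝟙 (isStolenOnce s g)
    qcE = trans (cong (_+ 𝟙 (isStolenOnce r' g)) (countB-sumL (isStolenOnce s) (allFin m)))
           (trans (sumL-allFin-swap m (λ g' → 𝟙 (isStolenOnce s g')) (λ g' → 𝟙 (isStolenOnce r' g')) g Bo)
             (cong (_+ 𝟙 (isStolenOnce s g)) (sym (countB-sumL (isStolenOnce r') (allFin m)))))

    Ags : isUnstolen s g ≡ (st ==ℕ 0)
    Ags = cong (_∧ (st ==ℕ 0)) tkg
    Bgs : isStolenOnce s g ≡ (st ==ℕ 1)
    Bgs = cong (_∧ (st ==ℕ 1)) tkg
    Agr : isUnstolen r' g ≡ (suc st ==ℕ 0)
    Agr = cong₂ _∧_ tkg' (cong (_==ℕ 0) ss)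
    Bgr : isStolenOnce r' g ≡ (suc st ==ℕ 1)
    Bgr = cong₂ _∧_ tkg' (cong (_==ℕ 1) ss)

    steal-unstolen : st ≡ 0 → (unstolen r' ≡ unstolen s ∸ 1) × (stolenOnce r' ≡ suc (stolenOnce s))
    steal-unstolen e0 = sym (trans (cong (_∸ 1) (trans (sym (ℕP.+-identityʳ (unstolen s))) (trans (cong (unstolen s +_) (sym a1)) (trans pcE (cong (unstolen r' +_) a2))))) (ℕP.m+n∸n≡m (unstolen r') 1))
             , trans (sym (ℕP.+-identityʳ (stolenOnce r'))) (trans (cong (stolenOnce r' +_) (sym b2)) (trans (sym qcE) (trans (cong (stolenOnce s +_) b1) (ℕP.+-comm (stolenOnce s) 1))))
      where
      a1 : 𝟙 (isUnstolen r' g) ≡ 0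
      a1 = cong 𝟙 (trans Agr (cong (λ z → suc z ==ℕ 0) e0))
      a2 : 𝟙 (isUnstolen s g) ≡ 1
      a2 = cong 𝟙 (trans Ags (cong (_==ℕ 0) e0))
      b1 : 𝟙 (isStolenOnce r' g) ≡ 1
      b1 = cong 𝟙 (trans Bgr (cong (λ z → suc z ==ℕ 1) e0))
      b2 : 𝟙 (isStolenOnce s g) ≡ 0
      b2 = cong 𝟙 (trans Bgs (cong (_==ℕ 1) e0))

    steal-stolenOnce : st ≡ 1 → (unstolen r' ≡ unstolen s) × (stolenOnce r' ≡ stolenOnce s ∸ 1)
    steal-stolenOnce e1 = sym (ℕP.+-cancelʳ-≡ 0 (unstolen s) (unstolen r') (trans (cong (unstolen s +_) (sym a1)) (trans pcE (cong (unstolen r' +_) a2))))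
             , sym (trans (cong (_∸ 1) (trans (sym (ℕP.+-identityʳ (stolenOnce s))) (trans (cong (stolenOnce s +_) (sym b1)) (trans qcE (cong (stolenOnce r' +_) b2))))) (ℕP.m+n∸n≡m (stolenOnce r') 1))
      where
      a1 : 𝟙 (isUnstolen r' g) ≡ 0
      a1 = cong 𝟙 (trans Agr (cong (λ z → suc z ==ℕ 0) e1))
      a2 : 𝟙 (isUnstolen s g) ≡ 0
      a2 = cong 𝟙 (trans Ags (cong (_==ℕ 0) e1))
      b1 : 𝟙 (isStolenOnce r' g) ≡ 0
      b1 = cong 𝟙 (trans Bgr (cong (λ z → suc z ==ℕ 1) e1))
      b2 : 𝟙 (isStolenOnce s g) ≡ 1
      b2 = cong 𝟙 (trans Bgs (cong (_==ℕ 1) e1))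

  sumL-*ʳ : ∀ {a} {A : Set a} (xs : List A) (f : A → ℕ) c → sumL xs (λ x → f x * c) ≡ sumL xs f * c
  sumL-*ʳ [] f c = refl
  sumL-*ʳ (x ∷ xs) f c = trans (cong (f x * c +_) (sumL-*ʳ xs f c)) (sym (ℕP.*-distribʳ-+ c (f x) (sumL xs f)))

  m+1+n≡o⇒m<o : ∀ m n o → m + suc n ≡ o → m < o
  m+1+n≡o⇒m<o m n o e = subst (m <_) e (ℕP.m<m+n m ℕ.z<s)

  pool-nonempty : ∀ {m} (s : GameState m) j r → Invariant s j → (e : j + suc r ≡ m) → poolEmpty s ≡ false
  pool-nonempty {m} s j r I e = allB-allFin-false m _ (Fin.fromℕ< (m+1+n≡o⇒m<o j r m e)) (cong not (trans (Invariant.pool I _) (trans (cong (j ≤ℕ_) (FinP.toℕ-fromℕ< (m+1+n≡o⇒m<o j r m e))) (≤ℕ-true j j ℕP.≤-refl))))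

  CountedBy : ℕ → ℕ → ℕ → ℕ → Set
  CountedBy f j r m = ∀ (s : GameState m) → Invariant s j → scenarioCount f s j r ≡ stealCount f (unstolen s) (stolenOnce s) r

  takeMoves-count : ∀ {m} f (s : GameState m) j r → Invariant s j → j + suc r ≡ m → CountedBy f (suc j) r m →
    sumL (allFin m) (λ g → if inPool s g then (if (toℕ g ==ℕ j) then scenarioCount f (step s (take g)) (suc j) r else 0) else 0)
      ≡ stealCount f (suc (unstolen s)) (stolenOnce s) r
  takeMoves-count {m} f s j r I e counted = begin
    sumL (allFin m) φ
      ≡⟨ sumL-allFin-single m φ g0 (λ g ne → trans (cong (λ b → if inPool s g then b else 0)
           (cong (λ b → if b then scenarioCount f (step s (take g)) (suc j) r else 0) (==ℕ-false (toℕ g) j (λ eq → ne (FinP.toℕ-injective (trans eq (sym tg0)))))))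
           (if-const0 (inPool s g))) ⟩
    φ g0
      ≡⟨ cong₂ (λ a b → if a then (if b then scenarioCount f (step s (take g0)) (suc j) r else 0) else 0)
           (trans (pool g0) (trans (cong (j ≤ℕ_) tg0) (≤ℕ-true j j ℕP.≤-refl))) (trans (cong (_==ℕ j) tg0) (==ℕ-true j)) ⟩
    scenarioCount f (step s (take g0)) (suc j) r
      ≡⟨ counted (step s (take g0)) (TakeStep.inv s j g0 I tg0) ⟩
    stealCount f (unstolen (step s (take g0))) (stolenOnce (step s (take g0))) r
      ≡⟨ cong₂ (λ a b → stealCount f a b r) (TakeStep.unstolen-take s j g0 I tg0) (TakeStep.stolenOnce-take s j g0 I tg0) ⟩
    stealCount f (suc (unstolen s)) (stolenOnce s) r ∎
    where
    open ≡-Reasoning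
    open Invariant I
    j<m = m+1+n≡o⇒m<o j r m e
    g0 = Fin.fromℕ< j<m
    tg0 : toℕ g0 ≡ j
    tg0 = FinP.toℕ-fromℕ< j<m
    φ : Fin m → ℕ
    φ g = if inPool s g then (if (toℕ g ==ℕ j) then scenarioCount f (step s (take g)) (suc j) r else 0) else 0

  stealMove-count : ∀ {m} f (s : GameState m) j r → Invariant s j → CountedBy f j (suc r) m → ∀ g →
    (if stealable 2 s g then scenarioCount f (step s (steal g)) j (suc r) else 0)
      ≡ 𝟙 (isUnstolen s g) * stealCount f (unstolen s ∸ 1) (suc (stolenOnce s)) (suc r)
        + 𝟙 (isStolenOnce s g) * stealCount f (unstolen s) (stolenOnce s ∸ 1) (suc r)
  stealMove-count {m} f s j r I counted g = byHolder (lookup (holder s) g) refl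
    where
    open ≡-Reasoning
    X = stealCount f (unstolen s ∸ 1) (suc (stolenOnce s)) (suc r)
    Y = stealCount f (unstolen s) (stolenOnce s ∸ 1) (suc r)
    χ = if stealable 2 s g then scenarioCount f (step s (steal g)) j (suc r) else 0
    byHolder : ∀ (mq : Maybe ℕ) → lookup (holder s) g ≡ mq → χ ≡ 𝟙 (isUnstolen s g) * X + 𝟙 (isStolenOnce s g) * Y
    byHolder nothing h = begin
      χ ≡⟨ cong (λ b → if b then scenarioCount f (step s (steal g)) j (suc r) else 0) (stealable-wrapped s g h) ⟩
      0 ≡⟨ sym (cong₂ (λ a b → 𝟙 (a ∧ (lookup (steals s) g ==ℕ 0)) * X + 𝟙 (b ∧ (lookup (steals s) g ==ℕ 1)) * Y) tk tk) ⟩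
      𝟙 (isUnstolen s g) * X + 𝟙 (isStolenOnce s g) * Y ∎
      where
      tk : isTaken s g ≡ false
      tk = cong not (trans (inPool≡ s g) (cong isNothingB h))
    byHolder (just q) h = bySteals (lookup (steals s) g) refl
      where
      module SS = StealStep s j g q I h
      stl : stealable 2 s g ≡ (suc (lookup (steals s) g) ≤ℕ 2)
      stl = trans (stealable-held s g q h) (cong (λ b → not b ∧ (suc (lookup (steals s) g) ≤ℕ 2)) (==ℕ-false q (mover s) SS.q≢mv))
      rec : scenarioCount f (step s (steal g)) j (suc r) ≡ stealCount f (unstolen SS.r') (stolenOnce SS.r') (suc r)
      rec = trans (cong (λ z → scenarioCount f z j (suc r)) SS.eqs) (counted SS.r' SS.inv)
      bySteals : ∀ st → lookup (steals s) g ≡ st → χ ≡ 𝟙 (isUnstolen s g) * X + 𝟙 (isStolenOnce s g) * Y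
      bySteals zero e0 = begin
        χ ≡⟨ cong (λ b → if b then scenarioCount f (step s (steal g)) j (suc r) else 0) (trans stl (cong (λ z → suc z ≤ℕ 2) e0)) ⟩
        scenarioCount f (step s (steal g)) j (suc r) ≡⟨ rec ⟩
        stealCount f (unstolen SS.r') (stolenOnce SS.r') (suc r) ≡⟨ cong₂ (λ a b → stealCount f a b (suc r)) (proj₁ (SS.steal-unstolen e0)) (proj₂ (SS.steal-unstolen e0)) ⟩
        X ≡⟨ sym (trans (ℕP.+-identityʳ _) (ℕP.+-identityʳ X)) ⟩
        1 * X + 0 * Y ≡⟨ cong₂ (λ a b → a * X + b * Y) (sym (cong 𝟙 (trans SS.Ags (cong (_==ℕ 0) e0)))) (sym (cong 𝟙 (trans SS.Bgs (cong (_==ℕ 1) e0)))) ⟩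
        𝟙 (isUnstolen s g) * X + 𝟙 (isStolenOnce s g) * Y ∎
      bySteals (suc zero) e1 = begin
        χ ≡⟨ cong (λ b → if b then scenarioCount f (step s (steal g)) j (suc r) else 0) (trans stl (cong (λ z → suc z ≤ℕ 2) e1)) ⟩
        scenarioCount f (step s (steal g)) j (suc r) ≡⟨ rec ⟩
        stealCount f (unstolen SS.r') (stolenOnce SS.r') (suc r) ≡⟨ cong₂ (λ a b → stealCount f a b (suc r)) (proj₁ (SS.steal-stolenOnce e1)) (proj₂ (SS.steal-stolenOnce e1)) ⟩
        Y ≡⟨ sym (ℕP.+-identityʳ Y) ⟩
        0 * X + 1 * Y ≡⟨ cong₂ (λ a b → a * X + b * Y) (sym (cong 𝟙 (trans SS.Ags (cong (_==ℕ 0) e1)))) (sym (cong 𝟙 (trans SS.Bgs (cong (_==ℕ 1) e1)))) ⟩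
        𝟙 (isUnstolen s g) * X + 𝟙 (isStolenOnce s g) * Y ∎
      bySteals (suc (suc k)) e2 = begin
        χ ≡⟨ cong (λ b → if b then scenarioCount f (step s (steal g)) j (suc r) else 0) (trans stl (trans (cong (λ z → suc z ≤ℕ 2) e2) (≤ℕ-false (3 + k) 2 (λ { (ℕ.s≤s (ℕ.s≤s ())) })))) ⟩
        0 ≡⟨ sym (cong₂ (λ a b → a * X + b * Y) (cong 𝟙 (trans SS.Ags (trans (cong (_==ℕ 0) e2) (==ℕ-false (2 + k) 0 (λ ()))))) (cong 𝟙 (trans SS.Bgs (trans (cong (_==ℕ 1) e2) (==ℕ-false (2 + k) 1 (λ ())))))) ⟩
        𝟙 (isUnstolen s g) * X + 𝟙 (isStolenOnce s g) * Y ∎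

  stealMoves-count : ∀ {m} f (s : GameState m) j r → Invariant s j → CountedBy f j (suc r) m →
    sumL (allFin m) (λ g → if stealable 2 s g then scenarioCount f (step s (steal g)) j (suc r) else 0)
      ≡ unstolen s * stealCount f (unstolen s ∸ 1) (suc (stolenOnce s)) (suc r) + stolenOnce s * stealCount f (unstolen s) (stolenOnce s ∸ 1) (suc r)
  stealMoves-count {m} f s j r I counted = begin
    sumL (allFin m) _ ≡⟨ sumL-cong (allFin m) (stealMove-count f s j r I counted) ⟩
    sumL (allFin m) (λ g → 𝟙 (isUnstolen s g) * X + 𝟙 (isStolenOnce s g) * Y)
      ≡⟨ sumL-+ (allFin m) (λ g → 𝟙 (isUnstolen s g) * X) (λ g → 𝟙 (isStolenOnce s g) * Y) ⟩
    sumL (allFin m) (λ g → 𝟙 (isUnstolen s g) * X) + sumL (allFin m) (λ g → 𝟙 (isStolenOnce s g) * Y)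
      ≡⟨ cong₂ _+_ (trans (sumL-*ʳ (allFin m) (λ g → 𝟙 (isUnstolen s g)) X) (cong (_* X) (sym (countB-sumL (isUnstolen s) (allFin m)))))
                   (trans (sumL-*ʳ (allFin m) (λ g → 𝟙 (isStolenOnce s g)) Y) (cong (_* Y) (sym (countB-sumL (isStolenOnce s) (allFin m))))) ⟩
    unstolen s * X + stolenOnce s * Y ∎
    where
    open ≡-Reasoning
    X = stealCount f (unstolen s ∸ 1) (suc (stolenOnce s)) (suc r)
    Y = stealCount f (unstolen s) (stolenOnce s ∸ 1) (suc r)

  scenarioCount≡stealCount : ∀ {m} f j r → j + r ≡ m → CountedBy f j r m
  scenarioCount≡stealCount {m} f j zero e s I = scenarioCount-finished f s j finished
    where
    open Invariant I
    finished : poolEmpty s ≡ true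
    finished = allB-true _ (allFin m) (λ g → cong not (trans (pool g) (≤ℕ-false j (toℕ g)
      (λ le → ℕP.<⇒≱ (FinP.toℕ<n g) (ℕP.≤-trans (ℕP.≤-reflexive (trans (sym e) (ℕP.+-identityʳ j))) le)))))
  scenarioCount≡stealCount zero j (suc r) e s I = scenarioCount-noFuel s j (suc r) (pool-nonempty s j r I e)
  scenarioCount≡stealCount (suc f) j (suc r) e s I = begin
    scenarioCount (suc f) s j (suc r)
      ≡⟨ scenarioCount-suc-gifts f s j r (pool-nonempty s j r I e) ⟩
    _ ≡⟨ cong₂ _+_ (takeMoves-count f s j r I e (scenarioCount≡stealCount f (suc j) r (trans (sym (ℕP.+-suc j r)) e)))
                   (stealMoves-count f s j r I (scenarioCount≡stealCount f j (suc r) e)) ⟩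
    stealCount f (suc (unstolen s)) (stolenOnce s) r + (unstolen s * _ + stolenOnce s * _)
      ≡⟨ sym (ℕP.+-assoc (stealCount f (suc (unstolen s)) (stolenOnce s) r) _ _) ⟩
    stealCount (suc f) (unstolen s) (stolenOnce s) (suc r) ∎
    where open ≡-Reasoning

  initialInvariant : ∀ m → Invariant (initialState m) 0
  initialInvariant m = record
    { pool = λ g → trans (inPool≡ (initialState m) g) (trans (cong isNothingB (VecP.lookup-replicate g nothing)) (sym (≤ℕ-true 0 (toℕ g) ℕ.z≤n)))
    ; movfree = λ g e → just≢nothing (trans (sym e) (VecP.lookup-replicate g nothing))
    ; inj = λ g g' q e _ → ⊥-elim (just≢nothing (trans (sym e) (VecP.lookup-replicate g nothing)))
    ; below = λ g q e → ⊥-elim (just≢nothing (trans (sym e) (VecP.lookup-replicate g nothing)))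
    ; movbelow = ℕ.s≤s ℕ.z≤n
    ; st0 = λ g _ → VecP.lookup-replicate g 0 }

  countB-allfalse : ∀ {a} {A : Set a} (P : A → Bool) xs → (∀ x → P x ≡ false) → countB P xs ≡ 0
  countB-allfalse P [] e = refl
  countB-allfalse P (x ∷ xs) e with P x | e x
  ... | false | refl = countB-allfalse P xs e

  isTaken-initial : ∀ m g → isTaken (initialState m) g ≡ false
  isTaken-initial m g = cong not (trans (inPool≡ (initialState m) g) (cong isNothingB (VecP.lookup-replicate g nothing)))

  unstolen-initial : ∀ m → unstolen (initialState m) ≡ 0
  unstolen-initial m = countB-allfalse _ (allFin m) (λ g → cong (_∧ (lookup (replicate m 0) g ==ℕ 0)) (isTaken-initial m g))

  stolenOnce-initial : ∀ m → stolenOnce (initialState m) ≡ 0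
  stolenOnce-initial m = countB-allfalse _ (allFin m) (λ g → cong (_∧ (lookup (replicate m 0) g ==ℕ 1)) (isTaken-initial m g))

  map-toℕ-tabulate : ∀ {m'} r a (f : Fin r → Fin m') → (∀ i → toℕ (f i) ≡ a + toℕ i) → map toℕ (tabulate f) ≡ range a r
  map-toℕ-tabulate zero a f e = refl
  map-toℕ-tabulate (suc r) a f e = cong₂ _∷_ (trans (e Fin.zero) (ℕP.+-identityʳ a))
    (map-toℕ-tabulate r (suc a) (λ i → f (Fin.suc i)) (λ i → trans (e (Fin.suc i)) (ℕP.+-suc a (toℕ i))))

  G₂≡stealCount : ∀ n → G₂ n ≡ stealCount (3 * suc n) 0 0 (suc n)
  G₂≡stealCount n = begin
    G₂ n ≡⟨ length-filter-dec (λ ms → ≡-dec FinP._≟_ (takenGifts ms) (allFin (suc n))) (scenarios 2 (suc n)) ⟩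
    countB (λ ms → does (≡-dec FinP._≟_ (takenGifts ms) (allFin (suc n)))) (scenarios 2 (suc n))
      ≡⟨ countB-cong (scenarios 2 (suc n)) (λ ms → trans (does-≡-dec (takenGifts ms) (allFin (suc n))) (cong (sameList (map toℕ (takenGifts ms))) (map-toℕ-tabulate (suc n) 0 (λ i → i) (λ i → refl)))) ⟩
    scenarioCount (3 * suc n) (initialState (suc n)) 0 (suc n) ≡⟨ scenarioCount≡stealCount (3 * suc n) 0 (suc n) refl (initialState (suc n)) (initialInvariant (suc n)) ⟩
    stealCount (3 * suc n) (unstolen (initialState (suc n))) (stolenOnce (initialState (suc n))) (suc n) ≡⟨ cong₂ (λ a b → stealCount (3 * suc n) a b (suc n)) (unstolen-initial (suc n)) (stolenOnce-initial (suc n)) ⟩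
    stealCount (3 * suc n) 0 0 (suc n) ∎
    where open ≡-Reasoning


open import Defs
open import Data.Nat using (ℕ; suc; _+_; _*_; _∸_; _^_; _≤_; _<_; _!)
open import Data.Nat.Properties
  using (≤-trans; ≤-refl; ≤-pred; ≤-reflexive; <⇒≤; m≤m+n; m+[n∸m]≡n; m+n∸m≡n; ∸-monoˡ-≤; +-monoʳ-≤; +-comm; +-identityʳ)
open import Data.Nat.Solver using (module +-*-Solver)
open import Data.Product using (_×_; _,_)
open import Data.List using (map; upTo)
open import Data.List.Properties using (map-∘)
open import Data.Integer using (+_)
open import Data.Rational using (_/_; -_) renaming (_+_ to _+ℚ_; _*_ to _*ℚ_)
open import Relation.Binary.PropositionalEquality using (_≡_; refl; sym; trans; cong; cong₂; module ≡-Reasoning)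
open NatRational using (ℕ→ℚ-+)
open BoundedPartitions using (parts; sumTo; sumTo-zero; sumTo-split; parts-tooFew; parts-tooMany)
open SetPartitions using (E₂≡parts)
open StealRecurrence using (stealCount≡sumTo)
open GiftExchange using (G₂≡stealCount)
open PartitionsHypergeometric

E₂≡parts[n+η] : ∀ n k → n ≤ k → ℕ→ℚ (E₂ n k) ≡ ℕ→ℚ (parts n (n + (k ∸ n)))
E₂≡parts[n+η] n k n≤k = cong ℕ→ℚ (trans (E₂≡parts n k) (cong (parts n) (sym (m+[n∸m]≡n n≤k))))

E₂-small : ∀ n k → n ≤ k → k ∸ n ≤ n → ∀ N → k ≤ N → ℕ→ℚ (E₂ n k) ≡ smallTerm N n (k ∸ n)
E₂-small n k n≤k η≤n N k≤N = trans (E₂≡parts[n+η] n k n≤k) (parts-small n (k ∸ n) N η≤n (≤-trans n≤k k≤N))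

E₂-large : ∀ n k → n ≤ k → k ≤ 3 * n → n ≤ k ∸ n → ∀ N → k ≤ N →
  ℕ→ℚ (E₂ n k) ≡ largeTerm (k ∸ n + n) N n (k ∸ n)
E₂-large n k n≤k k≤3n n≤η N k≤N = trans (E₂≡parts[n+η] n k n≤k) (parts-large n (k ∸ n) N n≤η η≤2n (≤-trans n≤k k≤N))
  where
  open +-*-Solver
  η≤2n : k ∸ n ≤ 2 * n
  η≤2n = ≤-trans (∸-monoˡ-≤ n k≤3n)
    (≤-reflexive (trans (cong (_∸ n) (solve 1 (λ n → con 3 :* n := n :+ con 2 :* n) refl n)) (m+n∸m≡n n (2 * n))))

-- The search fuel 3(n+1) becomes the range of L, and parts n L vanishes unless n ≤ L ≤ 3n.
G₂≡sumParts : ∀ n → G₂ n ≡ sumTo n (λ η → parts n (n + η)) + sumTo (suc n) (λ i → parts n (n + (n + i)))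
G₂≡sumParts n = begin
  G₂ n                                              ≡⟨ G₂≡stealCount n ⟩
  _                                                 ≡⟨ stealCount≡sumTo (3 * suc n) 0 0 n ⟩
  sumTo (3 * suc n) (parts n)                       ≡⟨ cong (λ z → sumTo z (parts n)) 3[n+1]≡ ⟩
  sumTo (n + (2 * n + 1 + 2)) (parts n)             ≡⟨ sumTo-split n _ (parts n) ⟩
  sumTo n (parts n) + sumTo (2 * n + 1 + 2) P       ≡⟨ cong (_+ sumTo (2 * n + 1 + 2) P) (sumTo-zero n (parts n) (parts-tooFew n)) ⟩
  sumTo (2 * n + 1 + 2) P                           ≡⟨ sumTo-split (2 * n + 1) 2 P ⟩
  sumTo (2 * n + 1) P + sumTo 2 (λ l → P (2 * n + 1 + l))
    ≡⟨ cong (λ z → sumTo (2 * n + 1) P + z) (sumTo-zero 2 _ (λ l _ → parts-tooMany n _ (3n< l))) ⟩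
  sumTo (2 * n + 1) P + 0                           ≡⟨ +-identityʳ _ ⟩
  sumTo (2 * n + 1) P                               ≡⟨ cong (λ z → sumTo z P) (solve 1 (λ n → con 2 :* n :+ con 1 := n :+ (con 1 :+ n)) refl n) ⟩
  sumTo (n + suc n) P                               ≡⟨ sumTo-split n (suc n) P ⟩
  sumTo n P + sumTo (suc n) (λ i → P (n + i))       ∎
  where
  open ≡-Reasoning
  open +-*-Solver
  P = λ η → parts n (n + η)
  3[n+1]≡ : 3 * suc n ≡ n + (2 * n + 1 + 2)
  3[n+1]≡ = solve 1 (λ n → con 3 :* (con 1 :+ n) := n :+ (con 2 :* n :+ con 1 :+ con 2)) refl n
  3n< : ∀ l → 3 * n < n + (2 * n + 1 + l)
  3n< l = ≤-trans (≤-reflexive (solve 1 (λ n → con 1 :+ con 3 :* n := n :+ (con 2 :* n :+ con 1)) refl n))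
                  (+-monoʳ-≤ n (m≤m+n (2 * n + 1) l))

G₂-hypergeometric : ∀ n N → 2 * n ≤ N →
  ℕ→ℚ (G₂ n) ≡ Σℚ (map (smallTerm N n) (upTo n)) +ℚ Σℚ (map (λ η → largeTerm (n + η) N n η) (map (λ i → n + i) (upTo (suc n))))
G₂-hypergeometric n N 2n≤N = begin
  ℕ→ℚ (G₂ n)                                        ≡⟨ cong ℕ→ℚ (G₂≡sumParts n) ⟩
  ℕ→ℚ (sumTo n P + sumTo (suc n) (λ i → P (n + i))) ≡⟨ ℕ→ℚ-+ (sumTo n P) _ ⟩
  ℕ→ℚ (sumTo n P) +ℚ ℕ→ℚ (sumTo (suc n) (λ i → P (n + i)))
    ≡⟨ cong₂ _+ℚ_ (sym (trans (cong Σℚ (map-applyUpTo (smallTerm N n) (λ j → j) n)) (Σℚ-applyUpTo n P _ small)))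
                  (sym (trans (cong Σℚ (trans (sym (map-∘ {g = λ η → largeTerm (n + η) N n η} {f = λ i → n + i} (upTo (suc n)))) (map-applyUpTo (λ i → largeTerm (n + (n + i)) N n (n + i)) (λ j → j) (suc n))))
                              (Σℚ-applyUpTo (suc n) (λ i → P (n + i)) _ large))) ⟩
  Σℚ (map (smallTerm N n) (upTo n)) +ℚ Σℚ (map (λ η → largeTerm (n + η) N n η) (map (λ i → n + i) (upTo (suc n)))) ∎
  where
  open ≡-Reasoning
  P = λ η → parts n (n + η)
  n≤N : n ≤ N
  n≤N = ≤-trans (m≤m+n n (n + 0)) 2n≤N
  small : ∀ η → η < n → smallTerm N n η ≡ ℕ→ℚ (P η)
  small η η<n = sym (parts-small n η N (<⇒≤ η<n) n≤N)
  large : ∀ i → i < suc n → largeTerm (n + (n + i)) N n (n + i) ≡ ℕ→ℚ (P (n + i))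
  large i i≤n = sym (trans (parts-large n (n + i) N (m≤m+n n i) (+-monoʳ-≤ n (≤-trans (≤-pred i≤n) (≤-reflexive (sym (+-identityʳ n))))) n≤N)
                           (cong (λ K → largeTerm K N n (n + i)) (+-comm (n + i) n)))

theorem5 :
  ((n k : ℕ) → n ≤ k → k ≤ 3 * n →
    let η = k ∸ n in
    (η ≤ n → (N : ℕ) → k ≤ N →
      ℕ→ℚ (E₂ n k)
        ≡ ((n + η) ! /ℕ (η ! * (n ∸ η) ! * 2 ^ η))
          *ℚ ₂F₁≤ N (- (ℕ→ℚ η *ℚ (+ 1 / 2)))
                    ((- (ℕ→ℚ η *ℚ (+ 1 / 2))) +ℚ (+ 1 / 2))
                    (ℕ→ℚ (n ∸ η + 1))
                    (+ 8 / 3))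
    × (n ≤ η → (N : ℕ) → k ≤ N →
      ℕ→ℚ (E₂ n k)
        ≡ ((η + n) ! /ℕ ((2 * n ∸ η) ! * (η ∸ n) ! * 2 ^ n * 3 ^ (η ∸ n)))
          *ℚ ₂F₁≤ N ((- ℕ→ℚ n) +ℚ (ℕ→ℚ η *ℚ (+ 1 / 2)))
                    (((- ℕ→ℚ n) +ℚ (ℕ→ℚ η *ℚ (+ 1 / 2))) +ℚ (+ 1 / 2))
                    (ℕ→ℚ (η ∸ n + 1))
                    (+ 8 / 3)))
  ×
  ((n N : ℕ) → 2 * n ≤ N →
    ℕ→ℚ (G₂ n)
      ≡ Σℚ (map (λ η → ((n + η) ! /ℕ (η ! * (n ∸ η) ! * 2 ^ η))
                   *ℚ ₂F₁≤ N (- (ℕ→ℚ η *ℚ (+ 1 / 2)))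
                             ((- (ℕ→ℚ η *ℚ (+ 1 / 2))) +ℚ (+ 1 / 2))
                             (ℕ→ℚ (n ∸ η + 1))
                             (+ 8 / 3))
                (upTo n))
        +ℚ Σℚ (map (λ η → ((n + η) ! /ℕ ((2 * n ∸ η) ! * (η ∸ n) ! * 2 ^ n * 3 ^ (η ∸ n)))
                   *ℚ ₂F₁≤ N ((- ℕ→ℚ n) +ℚ (ℕ→ℚ η *ℚ (+ 1 / 2)))
                             (((- ℕ→ℚ n) +ℚ (ℕ→ℚ η *ℚ (+ 1 / 2))) +ℚ (+ 1 / 2))
                             (ℕ→ℚ (η ∸ n + 1))
                             (+ 8 / 3))
                (map (λ i → n + i) (upTo (suc n)))))
theorem5 = (λ n k n≤k k≤3n → E₂-small n k n≤k , E₂-large n k n≤k k≤3n) , G₂-hypergeometric
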